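{- Let $n>3$ be a positive odd integer. Then \[ \sum_{k=0}^{(n+1)/2}[4k+1]\frac{(q^{ -1};q^2)_k^2\, (q;q^2)_k^2} {(q^4;q^2)_k^2\, (q^2;q^2)_k^2}\, q^{4k} \equiv 0 \pmod{[n]\Phi_n(q)^2}. \]
   Context: Here $q$ is an indeterminate. For $x$ and a base $p$ (a power of $q$), $(x;p)_k=\prod_{j=0}^{k-1}(1-xp^j)$ for integers $k\ge0$. The $q$-integer is $[j]=1+q+\cdots+q^{j-1}$, and $\Phi_n(q)$ is the $n$-th cyclotomic polynomial. For rational functions $A(q),B(q)$ and a polynomial $P(q)$, $A\equiv B\pmod{P}$ means that the numerator of the reduced form of $A-B$ is divisible by $P$ in $\mathbb{Z}[q]$. -}

module Defs where

open import Data.Nat using (ℕ; zero; suc; _<?_; _∸_)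
open import Data.Nat.Divisibility using (_∣?_)
open import Data.Integer as ℤ using (ℤ; +_; -[1+_])
open import Data.List using (List; []; _∷_; replicate; _++_; map; reverse; drop; length; foldr; filter; upTo)
open import Data.List.Relation.Unary.All using (All)
open import Data.Product using (_×_; _,_; ∃)
open import Relation.Binary.PropositionalEquality using (_≡_)
open import Relation.Nullary using (¬_; yes; no)

-- Polynomials in ℤ[q]: coefficient lists, lowest degree first.

Poly : Set
Poly = List ℤ

infixl 6 _+ₚ_ _-ₚ_
infixl 7 _*ₚ_

_+ₚ_ : Poly → Poly → Poly
[]       +ₚ ys       = ys
(x ∷ xs) +ₚ []       = x ∷ xs
(x ∷ xs) +ₚ (y ∷ ys) = (x ℤ.+ y) ∷ (xs +ₚ ys)

negₚ : Poly → Poly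
negₚ = map (λ x → ℤ.- x)

_-ₚ_ : Poly → Poly → Poly
p -ₚ r = p +ₚ negₚ r

scaleₚ : ℤ → Poly → Poly
scaleₚ c = map (c ℤ.*_)

_*ₚ_ : Poly → Poly → Poly
[]       *ₚ r = []
(a ∷ p)  *ₚ r = scaleₚ a r +ₚ (+ 0 ∷ (p *ₚ r))

oneₚ : Poly
oneₚ = + 1 ∷ []

Xpow : ℕ → Poly
Xpow k = replicate k (+ 0) ++ (+ 1 ∷ [])

prodₚ : List Poly → Poly
prodₚ = foldr _*ₚ_ oneₚ

-- Equality in ℤ[q] (ignoring trailing zero coefficients).
infix 4 _≈ₚ_
_≈ₚ_ : Poly → Poly → Set
p ≈ₚ r = All (_≡ + 0) (p -ₚ r)

infix 4 _∣ₚ_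
_∣ₚ_ : Poly → Poly → Set
d ∣ₚ p = ∃ λ r → d *ₚ r ≈ₚ p

subPrefix : List ℤ → List ℤ → List ℤ
subPrefix (x ∷ xs) (y ∷ ys) = (x ℤ.- y) ∷ subPrefix xs ys
subPrefix xs       []       = xs
subPrefix []       (_ ∷ _)  = []

-- f and the divisor g given highest degree first; gt = g without its
-- leading coefficient 1.  Returns the quotient, highest degree first.
divHigh : ℕ → List ℤ → List ℤ → List ℤ
divHigh zero     gt f        = []
divHigh (suc fu) gt []       = []
divHigh (suc fu) gt (c ∷ rest) with length rest <? length gt
... | yes _ = []
... | no  _ = c ∷ divHigh fu gt (subPrefix rest (map (c ℤ.*_) gt))

divMonic : Poly → Poly → Poly
divMonic f g = reverse (divHigh (length f) (drop 1 (reverse g)) (reverse f))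

properDivisors : ℕ → List ℕ
properDivisors n = filter (_∣? n) (map suc (upTo (n ∸ 1)))

-- Φ_n defined by  q^n - 1 = ∏_{d ∣ n} Φ_d, i.e.
-- Φ_n = (q^n - 1) / ∏_{d ∣ n, d < n} Φ_d  (fuel-bounded recursion).
cycFuel : ℕ → ℕ → Poly
cycFuel zero     n = oneₚ
cycFuel (suc fu) n =
  divMonic (Xpow n -ₚ oneₚ) (prodₚ (map (cycFuel fu) (properDivisors n)))

Φ : ℕ → Poly
Φ n = cycFuel n n

qint : ℕ → Poly
qint j = replicate j (+ 1)

Frac : Set
Frac = Poly × Poly

poly : Poly → Frac
poly p = p , oneₚ

infixl 6 _+f_ _-f_
infixl 7 _*f_

_+f_ : Frac → Frac → Frac
(a , b) +f (c , d) = (a *ₚ d +ₚ c *ₚ b) , (b *ₚ d)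

_-f_ : Frac → Frac → Frac
(a , b) -f (c , d) = (a *ₚ d -ₚ c *ₚ b) , (b *ₚ d)

_*f_ : Frac → Frac → Frac
(a , b) *f (c , d) = (a *ₚ c) , (b *ₚ d)

_/f_ : Frac → Frac → Frac
(a , b) /f (c , d) = (a *ₚ d) , (b *ₚ c)

oneF : Frac
oneF = poly oneₚ

zeroF : Frac
zeroF = poly []

qpowF : ℤ → Frac
qpowF (+ n)      = poly (Xpow n)
qpowF -[1+ n ]   = oneₚ , Xpow (suc n)

prodF : List Frac → Frac
prodF = foldr _*f_ oneF

sumF : List Frac → Frac
sumF = foldr _+f_ zeroF

poch : ℤ → ℕ → ℕ → Frac
poch a b k = prodF (map (λ j → oneF -f qpowF (a ℤ.+ + (b Data.Nat.* j))) (upTo k))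

-- Congruence of rational functions modulo a polynomial:
-- A ≡ B (mod P) iff the numerator of the reduced form of A - B is
-- divisible by P.  A reduced form N'/D' of N/D is one with
-- N·D' = N'·D, D' ≠ 0, and gcd(N',D') = 1 (every common divisor in
-- ℤ[q] is a unit).

NonZeroₚ : Poly → Set
NonZeroₚ p = ¬ (p ≈ₚ [])

Reduced : Poly → Poly → Set
Reduced n d = ∀ c → c ∣ₚ n → c ∣ₚ d → c ∣ₚ oneₚ

CongMod : Frac → Frac → Poly → Set
CongMod A B P with A -f B
... | (N , D) = ∃ λ N' → ∃ λ D' →
      NonZeroₚ D' × (N *ₚ D' ≈ₚ N' *ₚ D) × Reduced N' D' × (P ∣ₚ N')

sq : Frac → Frac
sq x = x *f x

term : ℕ → Frac
term k =
  ((poly (qint (suc (4 Data.Nat.* k))) *f sq (poch -[1+ 0 ] 2 k) *f sq (poch (+ 1) 2 k))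
    /f (sq (poch (+ 4) 2 k) *f sq (poch (+ 2) 2 k)))
  *f qpowF (+ (4 Data.Nat.* k))

sumTo : ℕ → Frac
sumTo N = sumF (map term (upTo (suc N)))

-- The summand is Gosper-summable: with y = q^{2k}, u_k = (q;q²)_k and v_k = (q²;q²)_k it is T_{k+1} − T_k for
--   T_k = q (1+q)² u_k⁴ (1−y)² α(y) / ((1−q)² [3] v_k⁴ (q−y)²),   α(y) = q(1+q) − 2(1+q²) y + (1+q) y²,
-- and T_0 = 0.  At the upper limit m = (n+1)/2 the quotient u_m / v_m equals (1 − q^n) times a q-binomial coefficient
-- over factors 1 + q^j and 1 − q^{n+1}, none of which shares a root with [n].
-- So the sum contains (1 − q^n)⁴, and only [3] (1 − q^{n+3})² in its denominator can meet [n], namely in [3] when 3 ∣ n.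
-- To read this off a reduced numerator: if N/D = P M / E with E and the monic P coprime over ℚ, and N/D = N′/D′,
-- then P ∣ N′ E, hence P divides an integer multiple of N′, hence P ∣ N′.

module Submission where

open import Defs
open import Algebra.Bundles using (CommutativeRing)
import Algebra.Solver.Ring as RingSolver
import Algebra.Solver.Ring.AlmostCommutativeRing as ACR
open import Algebra.Structures using (IsCommutativeRing)
open import Data.Empty using (⊥-elim)
open import Data.Integer as ℤ using (ℤ; +_; -[1+_])
import Data.Integer.Divisibility.Signed as ℤ∣
import Data.Integer.Properties as ℤₚ
open import Data.List using (List; []; _∷_; _∷ʳ_; _++_; applyUpTo; drop; length; map; reverse; upTo)
open import Data.List.Membership.Propositional using (_∈_)
open import Data.List.Membership.Propositional.Properties using (∈-filter⁺; ∈-filter⁻; ∈-map⁺; ∈-map⁻; ∈-upTo⁺; ∈-upTo⁻)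
import Data.List.Properties as Listₚ
open import Data.List.Relation.Unary.All as All using (All; []; _∷_)
open import Data.List.Relation.Unary.AllPairs using ([]; _∷_)
open import Data.List.Relation.Unary.Any using (here; there)
open import Data.List.Relation.Unary.Unique.Propositional using (Unique)
import Data.List.Relation.Unary.Unique.Propositional.Properties as Uniqueₚ
import Data.Maybe as Maybe
open import Data.Nat as ℕ using (ℕ; zero; suc; _<_; _≤_; _<?_; _∸_; _/_; _%_; z≤n; s≤s)
open import Data.Nat.Coprimality as ℕCoprime using (coprime⇒gcd≡1; 1-coprimeTo; coprime-+; coprime-divisor)
open import Data.Nat.DivMod using (m≡m%n+[m/n]*n; m*n/n≡m)
import Data.Nat.Divisibility as ℕ∣
open import Data.Nat.GCD using (gcd; gcd-GCD; gcd[m,n]∣m; gcd[m,n]∣n; gcd[m,n]≤n; gcd[m,n]≢0; gcd-greatest; module Bézout)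
open import Data.Nat.Induction using (<-rec)
open import Data.Nat.Primality using (prime?; prime⇒irreducible; prime[2])
import Data.Nat.Properties as ℕₚ
import Data.Nat.Solver as ℕSolver
open import Data.Product using (_×_; _,_; ∃; proj₁; proj₂)
open import Data.Sum using (_⊎_; inj₁; inj₂)
open import Function using (_∘_)
open import Relation.Binary.Definitions using (tri<; tri≈; tri>)
open import Relation.Binary.PropositionalEquality as ≡ using (_≡_; _≢_; refl; cong; cong₂; subst)
import Relation.Binary.Reasoning.Setoid as SetoidReasoning
open import Relation.Nullary using (¬_; yes; no)
open import Relation.Nullary.Decidable using (dec⇒maybe; from-yes)

-- Polynomials as a commutative ring

-- Roots of unity never occur. Coprimality is an explicit Bézout identity, and since ℤ[q] is not a
-- principal ideal ring its right-hand side is a non-zero integer rather than 1. Such integers can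
-- be cancelled at the end because `qint n` and `Φ n` are monic. The congruence asks for a reduced
-- form to exist, and reducedness in ℤ[q] also excludes common integer factors. Euclid's algorithm
-- with denominators cleared is therefore followed by division by contents. `Φ n` is the output of a
-- long division that discards its remainder. That this remainder is zero rests on the pairwise
-- coprimality of the earlier `Φ d`, which in turn needs the factorisation of the earlier q^d - 1;
-- both go through one induction. Of the four factors 1 - q^n one yields [n]. The other three have
-- to yield Φ_n² and to absorb what [3] (1 - q^{n+3})² shares with [n].

coeff : Poly → ℕ → ℤ
coeff []      _       = + 0
coeff (a ∷ p) zero    = a
coeff (a ∷ p) (suc i) = coeff p i

-- The same relation as _≈ₚ_, as a record so that its arguments can be inferred.
infix 4 _≋_
record _≋_ (p r : Poly) : Set where
  constructor mk≋
  field at : ∀ i → coeff p i ≡ coeff r i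
open _≋_

coeff-+ : ∀ p r i → coeff (p +ₚ r) i ≡ coeff p i ℤ.+ coeff r i
coeff-+ []      r       i       = ≡.sym (ℤₚ.+-identityˡ _)
coeff-+ (a ∷ p) []      i       = ≡.sym (ℤₚ.+-identityʳ _)
coeff-+ (a ∷ p) (b ∷ r) zero    = refl
coeff-+ (a ∷ p) (b ∷ r) (suc i) = coeff-+ p r i

coeff-neg : ∀ p i → coeff (negₚ p) i ≡ ℤ.- coeff p i
coeff-neg []      i       = refl
coeff-neg (a ∷ p) zero    = refl
coeff-neg (a ∷ p) (suc i) = coeff-neg p i

coeff-scale : ∀ c p i → coeff (scaleₚ c p) i ≡ c ℤ.* coeff p i
coeff-scale c []      i       = ≡.sym (ℤₚ.*-zeroʳ c)
coeff-scale c (a ∷ p) zero    = refl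
coeff-scale c (a ∷ p) (suc i) = coeff-scale c p i

All≡0⇒≋[] : ∀ {p} → All (_≡ + 0) p → p ≋ []
All≡0⇒≋[] []       = mk≋ λ _ → refl
All≡0⇒≋[] (e ∷ es) = mk≋ λ { zero → e ; (suc i) → at (All≡0⇒≋[] es) i }

≋[]⇒All≡0 : ∀ p → p ≋ [] → All (_≡ + 0) p
≋[]⇒All≡0 []      _ = []
≋[]⇒All≡0 (a ∷ p) e = at e 0 ∷ ≋[]⇒All≡0 p (mk≋ (at e ∘ suc))

coeff-- : ∀ p r i → coeff (p -ₚ r) i ≡ coeff p i ℤ.- coeff r i
coeff-- p r i = ≡.trans (coeff-+ p (negₚ r) i) (cong (λ c → coeff p i ℤ.+ c) (coeff-neg r i))

≈⇒≋ : ∀ {p r} → p ≈ₚ r → p ≋ r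
≈⇒≋ {p} {r} e = mk≋ λ i →
  ℤₚ.i-j≡0⇒i≡j _ _ (≡.trans (≡.sym (coeff-- p r i)) (at (All≡0⇒≋[] e) i))

≋⇒≈ : ∀ {p r} → p ≋ r → p ≈ₚ r
≋⇒≈ {p} {r} e = ≋[]⇒All≡0 _ (mk≋ λ i →
  ≡.trans (coeff-- p r i) (ℤₚ.i≡j⇒i-j≡0 (at e i)))

≋-refl : ∀ {p} → p ≋ p
≋-refl = mk≋ λ _ → refl

≋-sym : ∀ {p r} → p ≋ r → r ≋ p
≋-sym e = mk≋ (≡.sym ∘ at e)

≋-trans : ∀ {p r s} → p ≋ r → r ≋ s → p ≋ s
≋-trans e f = mk≋ λ i → ≡.trans (at e i) (at f i)

≋-reflexive : ∀ {p r} → p ≡ r → p ≋ r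
≋-reflexive refl = ≋-refl

∷-cong : ∀ {a b p r} → a ≡ b → p ≋ r → a ∷ p ≋ b ∷ r
∷-cong e f = mk≋ λ { zero → e ; (suc i) → at f i }

+ₚ-cong : ∀ {p p′ r r′} → p ≋ p′ → r ≋ r′ → p +ₚ r ≋ p′ +ₚ r′
+ₚ-cong {p} {p′} {r} {r′} e f = mk≋ λ i →
  ≡.trans (coeff-+ p r i) (≡.trans (cong₂ ℤ._+_ (at e i) (at f i)) (≡.sym (coeff-+ p′ r′ i)))

+ₚ-assoc : ∀ p r s → (p +ₚ r) +ₚ s ≋ p +ₚ (r +ₚ s)
+ₚ-assoc p r s = mk≋ λ i → begin
  coeff ((p +ₚ r) +ₚ s) i                    ≡⟨ coeff-+ (p +ₚ r) s i ⟩
  coeff (p +ₚ r) i ℤ.+ coeff s i              ≡⟨ cong (ℤ._+ coeff s i) (coeff-+ p r i) ⟩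
  coeff p i ℤ.+ coeff r i ℤ.+ coeff s i        ≡⟨ ℤₚ.+-assoc (coeff p i) _ _ ⟩
  coeff p i ℤ.+ (coeff r i ℤ.+ coeff s i)      ≡⟨ cong (λ c → coeff p i ℤ.+ c) (coeff-+ r s i) ⟨
  coeff p i ℤ.+ coeff (r +ₚ s) i              ≡⟨ coeff-+ p (r +ₚ s) i ⟨
  coeff (p +ₚ (r +ₚ s)) i                    ∎
  where open ≡.≡-Reasoning

+ₚ-comm : ∀ p r → p +ₚ r ≋ r +ₚ p
+ₚ-comm p r = mk≋ λ i →
  ≡.trans (coeff-+ p r i) (≡.trans (ℤₚ.+-comm (coeff p i) _) (≡.sym (coeff-+ r p i)))

+ₚ-identityʳ : ∀ p → p +ₚ [] ≋ p
+ₚ-identityʳ p = +ₚ-comm p []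

negₚ-cong : ∀ {p r} → p ≋ r → negₚ p ≋ negₚ r
negₚ-cong {p} {r} e = mk≋ λ i →
  ≡.trans (coeff-neg p i) (≡.trans (cong ℤ.-_ (at e i)) (≡.sym (coeff-neg r i)))

+ₚ-inverseʳ : ∀ p → p +ₚ negₚ p ≋ []
+ₚ-inverseʳ p = mk≋ λ i → ≡.trans (coeff-- p p i) (ℤₚ.+-inverseʳ (coeff p i))

scale-cong : ∀ {c d p r} → c ≡ d → p ≋ r → scaleₚ c p ≋ scaleₚ d r
scale-cong {c} {d} {p} {r} e f = mk≋ λ i →
  ≡.trans (coeff-scale c p i) (≡.trans (cong₂ ℤ._*_ e (at f i)) (≡.sym (coeff-scale d r i)))

scale-+ : ∀ c p r → scaleₚ c (p +ₚ r) ≋ scaleₚ c p +ₚ scaleₚ c r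
scale-+ c p r = mk≋ λ i → begin
  coeff (scaleₚ c (p +ₚ r)) i                   ≡⟨ coeff-scale c (p +ₚ r) i ⟩
  c ℤ.* coeff (p +ₚ r) i                         ≡⟨ cong (c ℤ.*_) (coeff-+ p r i) ⟩
  c ℤ.* (coeff p i ℤ.+ coeff r i)                ≡⟨ ℤₚ.*-distribˡ-+ c _ _ ⟩
  c ℤ.* coeff p i ℤ.+ c ℤ.* coeff r i             ≡⟨ cong₂ ℤ._+_ (coeff-scale c p i) (coeff-scale c r i) ⟨
  coeff (scaleₚ c p) i ℤ.+ coeff (scaleₚ c r) i  ≡⟨ coeff-+ (scaleₚ c p) (scaleₚ c r) i ⟨
  coeff (scaleₚ c p +ₚ scaleₚ c r) i            ∎
  where open ≡.≡-Reasoning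

scale-scale : ∀ c d p → scaleₚ c (scaleₚ d p) ≋ scaleₚ (c ℤ.* d) p
scale-scale c d p = mk≋ λ i → begin
  coeff (scaleₚ c (scaleₚ d p)) i  ≡⟨ coeff-scale c (scaleₚ d p) i ⟩
  c ℤ.* coeff (scaleₚ d p) i        ≡⟨ cong (c ℤ.*_) (coeff-scale d p i) ⟩
  c ℤ.* (d ℤ.* coeff p i)           ≡⟨ ℤₚ.*-assoc c d _ ⟨
  c ℤ.* d ℤ.* coeff p i             ≡⟨ coeff-scale (c ℤ.* d) p i ⟨
  coeff (scaleₚ (c ℤ.* d) p) i     ∎
  where open ≡.≡-Reasoning

scale-0 : ∀ p → scaleₚ (+ 0) p ≋ []
scale-0 p = mk≋ (coeff-scale (+ 0) p)

scale-1 : ∀ p → scaleₚ (+ 1) p ≋ p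
scale-1 p = mk≋ λ i → ≡.trans (coeff-scale (+ 1) p i) (ℤₚ.*-identityˡ _)

0∷[]≋[] : + 0 ∷ [] ≋ []
0∷[]≋[] = mk≋ λ { zero → refl ; (suc i) → refl }

+ₚ-interchange : ∀ p r s t → (p +ₚ r) +ₚ (s +ₚ t) ≋ (p +ₚ s) +ₚ (r +ₚ t)
+ₚ-interchange p r s t =
  ≋-trans (+ₚ-assoc p r _) (≋-trans (+ₚ-cong (≋-refl {p})
    (≋-trans (≋-sym (+ₚ-assoc r s t)) (≋-trans (+ₚ-cong (+ₚ-comm r s) ≋-refl) (+ₚ-assoc s r t))))
    (≋-sym (+ₚ-assoc p s _)))

*ₚ-zeroʳ : ∀ p → p *ₚ [] ≋ []
*ₚ-zeroʳ []      = ≋-refl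
*ₚ-zeroʳ (a ∷ p) = ≋-trans (∷-cong refl (*ₚ-zeroʳ p)) 0∷[]≋[]

-- The product recurses on its left factor. This is the mirrored recursion, and commutativity
-- follows by matching the two; the laws in the other argument are then transported along
-- commutativity.
*ₚ-∷ : ∀ p b r → p *ₚ (b ∷ r) ≋ scaleₚ b p +ₚ (+ 0 ∷ (p *ₚ r))
*ₚ-∷ []      b r = ≋-sym 0∷[]≋[]
*ₚ-∷ (a ∷ p) b r = ∷-cong (cong (ℤ._+ + 0) (ℤₚ.*-comm a b)) (
  ≋-trans (+ₚ-cong ≋-refl (*ₚ-∷ p b r)) (
  ≋-trans (≋-sym (+ₚ-assoc (scaleₚ a r) (scaleₚ b p) _)) (
  ≋-trans (+ₚ-cong (+ₚ-comm (scaleₚ a r) (scaleₚ b p)) ≋-refl)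
          (+ₚ-assoc (scaleₚ b p) (scaleₚ a r) _))))

*ₚ-comm : ∀ p r → p *ₚ r ≋ r *ₚ p
*ₚ-comm []      r = ≋-sym (*ₚ-zeroʳ r)
*ₚ-comm (a ∷ p) r = ≋-trans (+ₚ-cong ≋-refl (∷-cong refl (*ₚ-comm p r))) (≋-sym (*ₚ-∷ r a p))

*ₚ-congˡ : ∀ p {r s} → r ≋ s → p *ₚ r ≋ p *ₚ s
*ₚ-congˡ []      e = ≋-refl
*ₚ-congˡ (a ∷ p) e = +ₚ-cong (scale-cong {a} refl e) (∷-cong refl (*ₚ-congˡ p e))

*ₚ-cong : ∀ {p p′ r r′} → p ≋ p′ → r ≋ r′ → p *ₚ r ≋ p′ *ₚ r′
*ₚ-cong {p} {p′} {r} {r′} e f =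
  ≋-trans (*ₚ-congˡ p f) (≋-trans (*ₚ-comm p r′) (≋-trans (*ₚ-congˡ r′ e) (*ₚ-comm r′ p′)))

*ₚ-distribˡ-+ : ∀ p r s → p *ₚ (r +ₚ s) ≋ p *ₚ r +ₚ p *ₚ s
*ₚ-distribˡ-+ []      r s = ≋-refl
*ₚ-distribˡ-+ (a ∷ p) r s =
  ≋-trans (+ₚ-cong (scale-+ a r s) (∷-cong refl (*ₚ-distribˡ-+ p r s)))
          (+ₚ-interchange (scaleₚ a r) (scaleₚ a s) (+ 0 ∷ p *ₚ r) (+ 0 ∷ p *ₚ s))

*ₚ-distribʳ-+ : ∀ s p r → (p +ₚ r) *ₚ s ≋ p *ₚ s +ₚ r *ₚ s
*ₚ-distribʳ-+ s p r = ≋-trans (*ₚ-comm (p +ₚ r) s)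
  (≋-trans (*ₚ-distribˡ-+ s p r) (+ₚ-cong (*ₚ-comm s p) (*ₚ-comm s r)))

scale-* : ∀ c p r → scaleₚ c p *ₚ r ≋ scaleₚ c (p *ₚ r)
scale-* c []      r = ≋-refl
scale-* c (a ∷ p) r = ≋-trans
  (+ₚ-cong (≋-sym (scale-scale c a r))
          (∷-cong (≡.sym (ℤₚ.*-zeroʳ c)) (scale-* c p r)))
  (≋-sym (scale-+ c (scaleₚ a r) (+ 0 ∷ p *ₚ r)))

shift-* : ∀ p r → (+ 0 ∷ p) *ₚ r ≋ + 0 ∷ (p *ₚ r)
shift-* p r = +ₚ-cong (scale-0 r) ≋-refl

*ₚ-assoc : ∀ p r s → (p *ₚ r) *ₚ s ≋ p *ₚ (r *ₚ s)
*ₚ-assoc []      r s = ≋-refl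
*ₚ-assoc (a ∷ p) r s = ≋-trans (*ₚ-distribʳ-+ s (scaleₚ a r) (+ 0 ∷ p *ₚ r))
  (+ₚ-cong (scale-* a r s) (≋-trans (shift-* (p *ₚ r) s) (∷-cong refl (*ₚ-assoc p r s))))

*ₚ-identityˡ : ∀ p → oneₚ *ₚ p ≋ p
*ₚ-identityˡ p = ≋-trans (+ₚ-cong (scale-1 p) 0∷[]≋[]) (+ₚ-identityʳ p)

-- Degree bounds and top coefficients

DegLt : ℕ → Poly → Set
DegLt k p = ∀ i → k ≤ i → coeff p i ≡ + 0

DegLt-mono : ∀ {k l p} → k ≤ l → DegLt k p → DegLt l p
DegLt-mono k≤l d i l≤i = d i (ℕₚ.≤-trans k≤l l≤i)

DegLt-≋ : ∀ {k p r} → p ≋ r → DegLt k p → DegLt k r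
DegLt-≋ e d i k≤i = ≡.trans (≡.sym (at e i)) (d i k≤i)

DegLt-+ : ∀ {k} p r → DegLt k p → DegLt k r → DegLt k (p +ₚ r)
DegLt-+ p r d e i k≤i = ≡.trans (coeff-+ p r i) (cong₂ ℤ._+_ (d i k≤i) (e i k≤i))

DegLt-scale : ∀ {k} c p → DegLt k p → DegLt k (scaleₚ c p)
DegLt-scale c p d i k≤i =
  ≡.trans (coeff-scale c p i) (≡.trans (cong (λ x → c ℤ.* x) (d i k≤i)) (ℤₚ.*-zeroʳ c))

DegLt-∷ : ∀ {k a p} → DegLt k p → DegLt (suc k) (a ∷ p)
DegLt-∷ d (suc i) (s≤s k≤i) = d i k≤i

DegLt-tail : ∀ {k a p} → DegLt (suc k) (a ∷ p) → DegLt k p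
DegLt-tail d i k≤i = d (suc i) (s≤s k≤i)

DegLt-length : ∀ p → DegLt (length p) p
DegLt-length []      i       _        = refl
DegLt-length (a ∷ p) (suc i) (s≤s le) = DegLt-length p i le

DegLt-0 : ∀ {p} → DegLt 0 p → p ≋ []
DegLt-0 d = mk≋ λ i → d i z≤n

DegLt-pred : ∀ {k p} → DegLt (suc k) p → coeff p k ≡ + 0 → DegLt k p
DegLt-pred {k} d e i k≤i with ℕₚ.m≤n⇒m<n∨m≡n k≤i
... | inj₁ k<i  = d i k<i
... | inj₂ refl = e

DegLt-* : ∀ {k l} p r → DegLt (suc k) p → DegLt (suc l) r → DegLt (suc (k ℕ.+ l)) (p *ₚ r)
DegLt-* []      r _ _ i _ = refl
-- The bound makes `p` zero only up to `≋`: a list of zeros may remain.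
DegLt-* {zero} {l} (a ∷ p) r d e = DegLt-≋ {p = scaleₚ a r}
  (≋-sym (≋-trans (+ₚ-cong (≋-refl {scaleₚ a r}) (≋-trans (∷-cong refl (*ₚ-cong {r = r} (DegLt-0 {p} (DegLt-tail {a = a} d)) ≋-refl)) 0∷[]≋[]))
                  (+ₚ-identityʳ _)))
  (DegLt-scale a r e)
DegLt-* {suc k} {l} (a ∷ p) r d e = DegLt-+ (scaleₚ a r) (+ 0 ∷ p *ₚ r)
  (DegLt-mono {p = scaleₚ a r} (s≤s (ℕₚ.m≤n+m l (suc k))) (DegLt-scale a r e))
  (DegLt-∷ {p = p *ₚ r} (DegLt-* p r (DegLt-tail {a = a} d) e))

-- Only the product of the two top coefficients reaches this index. `k` and `l` are bounds and not
-- exact degrees, so either top coefficient may vanish.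
coeff-*-top : ∀ {k l} p r → DegLt (suc k) p → DegLt (suc l) r →
  coeff (p *ₚ r) (k ℕ.+ l) ≡ coeff p k ℤ.* coeff r l
coeff-*-top []      r _ _ = refl
coeff-*-top {zero} {l} (a ∷ p) r d e = ≡.trans
  (at (≋-trans (+ₚ-cong (≋-refl {scaleₚ a r}) (≋-trans (∷-cong refl (*ₚ-cong {r = r} (DegLt-0 {p} (DegLt-tail {a = a} d)) ≋-refl)) 0∷[]≋[]))
               (+ₚ-identityʳ _)) l)
  (coeff-scale a r l)
coeff-*-top {suc k} {l} (a ∷ p) r d e = begin
  coeff (scaleₚ a r +ₚ (+ 0 ∷ p *ₚ r)) (suc k ℕ.+ l)
    ≡⟨ coeff-+ (scaleₚ a r) (+ 0 ∷ p *ₚ r) (suc k ℕ.+ l) ⟩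
  coeff (scaleₚ a r) (suc k ℕ.+ l) ℤ.+ coeff (p *ₚ r) (k ℕ.+ l)
    ≡⟨ cong (ℤ._+ coeff (p *ₚ r) (k ℕ.+ l)) (DegLt-scale a r e (suc k ℕ.+ l) (s≤s (ℕₚ.m≤n+m l k))) ⟩
  + 0 ℤ.+ coeff (p *ₚ r) (k ℕ.+ l)  ≡⟨ ℤₚ.+-identityˡ _ ⟩
  coeff (p *ₚ r) (k ℕ.+ l)          ≡⟨ coeff-*-top p r (DegLt-tail {a = a} d) e ⟩
  coeff p k ℤ.* coeff r l           ∎
  where open ≡.≡-Reasoning

infixl 6 _⊕_ _⊝_
infixl 7 _⊗_
infix  8 ⊖_

-- Opaque copies of the operations: they do not unfold during unification.
opaque
  _⊕_ _⊗_ : Poly → Poly → Poly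
  _⊕_ = _+ₚ_
  _⊗_ = _*ₚ_

  ⊖_ : Poly → Poly
  ⊖_ = negₚ

_⊝_ : Poly → Poly → Poly
p ⊝ r = p ⊕ ⊖ r

opaque
  unfolding _⊕_

  +ₚ≡⊕ : ∀ p r → p +ₚ r ≡ p ⊕ r
  +ₚ≡⊕ p r = refl

  *ₚ≡⊗ : ∀ p r → p *ₚ r ≡ p ⊗ r
  *ₚ≡⊗ p r = refl

  -ₚ≡⊝ : ∀ p r → p -ₚ r ≡ p ⊝ r
  -ₚ≡⊝ p r = refl

  ℤ[q]-isCommutativeRing : IsCommutativeRing _≋_ _⊕_ _⊗_ ⊖_ [] oneₚ
  ℤ[q]-isCommutativeRing = record
    { isRing = record
      { +-isAbelianGroup = record
        { isGroup = record
          { isMonoid = record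
            { isSemigroup = record
              { isMagma = record
                { isEquivalence = record { refl = ≋-refl ; sym = ≋-sym ; trans = ≋-trans }
                ; ∙-cong = +ₚ-cong }
              ; assoc = +ₚ-assoc }
            ; identity = (λ _ → ≋-refl) , +ₚ-identityʳ }
          ; inverse = (λ p → ≋-trans (+ₚ-comm (negₚ p) p) (+ₚ-inverseʳ p)) , +ₚ-inverseʳ
          ; ⁻¹-cong = negₚ-cong }
        ; comm = +ₚ-comm }
      ; *-cong = *ₚ-cong
      ; *-assoc = *ₚ-assoc
      ; *-identity = *ₚ-identityˡ , (λ p → ≋-trans (*ₚ-comm p oneₚ) (*ₚ-identityˡ p))
      ; distrib = *ₚ-distribˡ-+ , *ₚ-distribʳ-+ }
    ; *-comm = *ₚ-comm }

constₚ : ℤ → Poly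
constₚ c = c ∷ []

X : Poly
X = + 0 ∷ + 1 ∷ []

HasDegree : ℕ → Poly → Set
HasDegree k p = coeff p k ≢ + 0 × DegLt (suc k) p

*-nonzero-ℤ : ∀ {a b} → a ≢ + 0 → b ≢ + 0 → a ℤ.* b ≢ + 0
*-nonzero-ℤ {a} a≢0 b≢0 e with ℤₚ.i*j≡0⇒i≡0∨j≡0 a e
... | inj₁ a≡0 = a≢0 a≡0
... | inj₂ b≡0 = b≢0 b≡0

opaque
  unfolding _⊕_

  coeff-⊝ : ∀ p r i → coeff (p ⊝ r) i ≡ coeff p i ℤ.- coeff r i
  coeff-⊝ = coeff--

  const-+ : ∀ c d → constₚ (c ℤ.+ d) ≋ constₚ c ⊕ constₚ d
  const-+ c d = ≋-refl

  const-⊖ : ∀ c → constₚ (ℤ.- c) ≋ ⊖ constₚ c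
  const-⊖ c = ≋-refl

  const-⊗ : ∀ c p → constₚ c ⊗ p ≋ scaleₚ c p
  const-⊗ c p = ≋-trans (+ₚ-cong (≋-refl {scaleₚ c p}) 0∷[]≋[]) (+ₚ-identityʳ _)

  const-* : ∀ c d → constₚ (c ℤ.* d) ≋ constₚ c ⊗ constₚ d
  const-* c d = ≋-sym (const-⊗ c (constₚ d))

  X-⊗ : ∀ p → X ⊗ p ≋ + 0 ∷ p
  X-⊗ p = ≋-trans (shift-* oneₚ p) (∷-cong refl (*ₚ-identityˡ p))

  horner : ∀ a p → a ∷ p ≋ constₚ a ⊕ X ⊗ p
  horner a p = ≋-sym (≋-trans (+ₚ-cong (≋-refl {constₚ a}) (X-⊗ p)) (∷-cong (ℤₚ.+-identityʳ a) ≋-refl))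

  scale-neg : ∀ c p → scaleₚ (ℤ.- c) p ≋ ⊖ scaleₚ c p
  scale-neg c p = mk≋ λ i → ≡.trans (coeff-scale (ℤ.- c) p i) (≡.trans (≡.sym (ℤₚ.neg-distribˡ-* c (coeff p i)))
    (≡.sym (≡.trans (coeff-neg (scaleₚ c p) i) (cong ℤ.-_ (coeff-scale c p i)))))

  DegLt-⊕ : ∀ {k} p r → DegLt k p → DegLt k r → DegLt k (p ⊕ r)
  DegLt-⊕ = DegLt-+

  coeff-⊗-top : ∀ {k l} p r → DegLt (suc k) p → DegLt (suc l) r →
    coeff (p ⊗ r) (k ℕ.+ l) ≡ coeff p k ℤ.* coeff r l
  coeff-⊗-top = coeff-*-top

  HasDegree-⊗ : ∀ {k l} p r → HasDegree k p → HasDegree l r → HasDegree (k ℕ.+ l) (p ⊗ r)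
  HasDegree-⊗ p r (nz , d) (nz′ , d′) =
    (λ e → *-nonzero-ℤ nz nz′ (≡.trans (≡.sym (coeff-*-top p r d d′)) e)) , DegLt-* p r d d′

ℤ[q] : CommutativeRing _ _
ℤ[q] = record { isCommutativeRing = ℤ[q]-isCommutativeRing }

open CommutativeRing ℤ[q] using
  ( setoid; +-cong; +-comm; +-identityˡ; +-identityʳ; -‿cong; -‿inverseʳ
  ; *-cong; *-assoc; *-comm; *-identityˡ; *-identityʳ; zeroˡ; zeroʳ; distribʳ )

-- The solver computes with integer coefficients, whose equality is decidable; `X`, its powers and
-- all other polynomials enter its goals as variables.
constₚ-morphism : ℤ.+-*-rawRing ACR.-Raw-AlmostCommutative⟶ ACR.fromCommutativeRing ℤ[q]
constₚ-morphism = record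
  { ⟦_⟧    = constₚ
  ; +-homo = const-+
  ; *-homo = const-*
  ; -‿homo = const-⊖
  ; 0-homo = 0∷[]≋[]
  ; 1-homo = ≋-refl }

constₚ-≟ : ∀ c d → Maybe.Maybe (constₚ c ≋ constₚ d)
constₚ-≟ c d = Maybe.map (λ e → ≋-reflexive (cong constₚ e)) (dec⇒maybe (c ℤ.≟ d))

module Solver = RingSolver ℤ.+-*-rawRing (ACR.fromCommutativeRing ℤ[q]) constₚ-morphism constₚ-≟

module ≋-Reasoning = SetoidReasoning setoid

DegLt-scale⊝ : ∀ {k} c p d r → DegLt k p → DegLt k r → DegLt k (scaleₚ c p ⊝ scaleₚ d r)
DegLt-scale⊝ c p d r dp dr = DegLt-≋ {p = scaleₚ c p ⊕ scaleₚ (ℤ.- d) r}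
  (+-cong ≋-refl (scale-neg d r))
  (DegLt-⊕ (scaleₚ c p) (scaleₚ (ℤ.- d) r) (DegLt-scale c p dp) (DegLt-scale (ℤ.- d) r dr))

degree? : ∀ p → p ≋ [] ⊎ ∃ λ k → HasDegree k p
degree? []      = inj₁ ≋-refl
degree? (a ∷ p) with degree? p
... | inj₂ (k , nz , d) = inj₂ (suc k , nz , DegLt-∷ {p = p} d)
... | inj₁ e with a ℤ.≟ + 0
...   | yes refl = inj₁ (≋-trans (∷-cong refl e) 0∷[]≋[])
...   | no nz    = inj₂ (0 , nz , DegLt-∷ {p = p} (λ i _ → at e i))

HasDegree⇒≢0 : ∀ {k p} → HasDegree k p → ¬ p ≋ []
HasDegree⇒≢0 {k} (nz , _) e = nz (at e k)

-- Leading coefficients multiply in ℤ, which has no zero divisors. Every later cancellation in a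
-- cross-multiplied identity rests on this.
⊗-nonzero : ∀ {p r} → ¬ p ≋ [] → ¬ r ≋ [] → ¬ p ⊗ r ≋ []
⊗-nonzero {p} {r} p≢0 r≢0 with degree? p | degree? r
... | inj₁ e | _      = ⊥-elim (p≢0 e)
... | _      | inj₁ e = ⊥-elim (r≢0 e)
... | inj₂ (k , d) | inj₂ (l , d′) = HasDegree⇒≢0 (HasDegree-⊗ p r d d′)

⊗-nonzeroʳ⁻ : ∀ {p r} → ¬ p ⊗ r ≋ [] → ¬ r ≋ []
⊗-nonzeroʳ⁻ {p} nz e = nz (≋-trans (*-cong ≋-refl e) (zeroʳ p))

⊗-cancelˡ-0 : ∀ {p r} → ¬ p ≋ [] → p ⊗ r ≋ [] → r ≋ []
⊗-cancelˡ-0 {p} {r} p≢0 e with degree? r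
... | inj₁ r≋0     = r≋0
... | inj₂ (_ , d) = ⊥-elim (⊗-nonzero p≢0 (HasDegree⇒≢0 d) e)

⊝≋0⇒≋ : ∀ {p r} → p ⊝ r ≋ [] → p ≋ r
⊝≋0⇒≋ {p} {r} e = mk≋ λ i → ℤₚ.i-j≡0⇒i≡j _ _ (≡.trans (≡.sym (coeff-⊝ p r i)) (at e i))

≋⇒⊝≋0 : ∀ {p r} → p ≋ r → p ⊝ r ≋ []
≋⇒⊝≋0 {p} {r} e = mk≋ λ i → ≡.trans (coeff-⊝ p r i) (ℤₚ.i≡j⇒i-j≡0 (at e i))

⊗-distribˡ-⊝ : ∀ p r s → p ⊗ (r ⊝ s) ≋ p ⊗ r ⊝ p ⊗ s
⊗-distribˡ-⊝ = solve 3 (λ p r s → p :* (r :- s) := p :* r :- p :* s) ≋-refl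
  where open Solver

⊗-cancelˡ : ∀ {p r s} → ¬ p ≋ [] → p ⊗ r ≋ p ⊗ s → r ≋ s
⊗-cancelˡ {p} {r} {s} p≢0 e = ⊝≋0⇒≋ (⊗-cancelˡ-0 p≢0 (≋-trans (⊗-distribˡ-⊝ p r s) (≋⇒⊝≋0 e)))

const-nonzero : ∀ {c} → c ≢ + 0 → ¬ constₚ c ≋ []
const-nonzero nz e = nz (at e 0)

-- Pseudo-division over ℤ

record PseudoDivision (k : ℕ) (l : ℤ) (p d : Poly) : Set where
  field
    exponent           : ℕ
    quotient remainder : Poly
    equation           : constₚ (l ℤ.^ exponent) ⊗ p ≋ d ⊗ quotient ⊕ remainder
    remainder-degree   : DegLt k remainder

-- The recursion reads `a ∷ p` as a + q p. Multiplying the identity for p by l q leaves one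
-- coefficient, of index k, to be removed, at the cost of one more factor l. For l = 1 the power
-- disappears and this is ordinary division with remainder.
pseudoDivide : ∀ {k l} p d → coeff d k ≡ l → DegLt (suc k) d → PseudoDivision k l p d
pseudoDivide []      d _ _ = record
  { exponent = 0 ; quotient = [] ; remainder = [] ; remainder-degree = λ _ _ → refl
  ; equation = ≋-trans (zeroʳ oneₚ) (≋-sym (≋-trans (+-identityʳ _) (zeroʳ d))) }
pseudoDivide {k} {l} (a ∷ p) d refl dd = record
  { exponent = suc e
  ; quotient = constₚ l ⊗ (X ⊗ Q) ⊕ constₚ r
  ; remainder = R′
  ; equation = begin
      constₚ (l ℤ.^ suc e) ⊗ (a ∷ p)
        ≈⟨ *-cong (const-* l (l ℤ.^ e)) (horner a p) ⟩
      (constₚ l ⊗ constₚ (l ℤ.^ e)) ⊗ (constₚ a ⊕ X ⊗ p)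
        ≈⟨ solve 5 (λ l le a x p → (l :* le) :* (a :+ x :* p) := l :* (le :* a) :+ l :* (x :* (le :* p)))
             ≋-refl (constₚ l) (constₚ (l ℤ.^ e)) (constₚ a) X p ⟩
      constₚ l ⊗ (constₚ (l ℤ.^ e) ⊗ constₚ a) ⊕ constₚ l ⊗ (X ⊗ (constₚ (l ℤ.^ e) ⊗ p))
        ≈⟨ +-cong ≋-refl (*-cong ≋-refl (*-cong ≋-refl (PseudoDivision.equation rec))) ⟩
      constₚ l ⊗ (constₚ (l ℤ.^ e) ⊗ constₚ a) ⊕ constₚ l ⊗ (X ⊗ (d ⊗ Q ⊕ R))
        ≈⟨ solve 8 (λ l le a x d Q R r → l :* (le :* a) :+ l :* (x :* (d :* Q :+ R))
             := d :* (l :* (x :* Q) :+ r) :+ (l :* (le :* a :+ x :* R) :- r :* d))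
             ≋-refl (constₚ l) (constₚ (l ℤ.^ e)) (constₚ a) X d Q R (constₚ r) ⟩
      d ⊗ (constₚ l ⊗ (X ⊗ Q) ⊕ constₚ r) ⊕
        (constₚ l ⊗ (constₚ (l ℤ.^ e) ⊗ constₚ a ⊕ X ⊗ R) ⊝ constₚ r ⊗ d)
        ≈⟨ +-cong ≋-refl (+-cong (≋-trans (const-⊗ l _) (scale-cong {l} refl
             (≋-trans (+-cong (≋-sym (const-* (l ℤ.^ e) a)) ≋-refl) (≋-sym (horner _ R)))))
             (-‿cong (const-⊗ r d))) ⟩
      d ⊗ (constₚ l ⊗ (X ⊗ Q) ⊕ constₚ r) ⊕ R′ ∎
  ; remainder-degree = DegLt-pred {p = R′}
      (DegLt-scale⊝ l S r d (DegLt-∷ {p = R} (PseudoDivision.remainder-degree rec)) dd)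
      (≡.trans (coeff-⊝ (scaleₚ l S) (scaleₚ r d) k) (ℤₚ.i≡j⇒i-j≡0 (≡.trans (coeff-scale l S k)
        (≡.trans (ℤₚ.*-comm l r) (≡.sym (coeff-scale r d k))))))
  }
  where
  open ≋-Reasoning
  open Solver
  rec = pseudoDivide {k} p d refl dd
  open PseudoDivision rec using () renaming (exponent to e; quotient to Q; remainder to R)
  -- The remainder of `p`, shifted by q and completed by the new constant term. In l S - r d the
  -- coefficients of index `k` cancel.
  S = (l ℤ.^ e) ℤ.* a ∷ R
  r = coeff S k
  R′ = scaleₚ l S ⊝ scaleₚ r d

-- Lowest terms in ℤ[q]

infix 4 _∣ᵖ_
_∣ᵖ_ : Poly → Poly → Set
d ∣ᵖ p = ∃ λ r → d ⊗ r ≋ p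

∣ᵖ⇒∣ₚ : ∀ {d p} → d ∣ᵖ p → d ∣ₚ p
∣ᵖ⇒∣ₚ {d} {p} (r , e) = r , ≋⇒≈ (subst (_≋ p) (≡.sym (*ₚ≡⊗ d r)) e)

∣ₚ⇒∣ᵖ : ∀ {d p} → d ∣ₚ p → d ∣ᵖ p
∣ₚ⇒∣ᵖ {d} {p} (r , e) = r , subst (_≋ p) (*ₚ≡⊗ d r) (≈⇒≋ e)

∣ᵖ-refl : ∀ {p} → p ∣ᵖ p
∣ᵖ-refl {p} = oneₚ , *-identityʳ p

∣ᵖ-respʳ : ∀ {d p r} → p ≋ r → d ∣ᵖ p → d ∣ᵖ r
∣ᵖ-respʳ e (s , f) = s , ≋-trans f e

∣ᵖ-trans : ∀ {p r s} → p ∣ᵖ r → r ∣ᵖ s → p ∣ᵖ s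
∣ᵖ-trans {p} (a , e) (b , f) =
  a ⊗ b , ≋-trans (≋-sym (*-assoc p a b)) (≋-trans (*-cong e ≋-refl) f)

∣ᵖ-⊗ʳ : ∀ {d p} r → d ∣ᵖ p → d ∣ᵖ p ⊗ r
∣ᵖ-⊗ʳ {d} r (s , e) = s ⊗ r , ≋-trans (≋-sym (*-assoc d s r)) (*-cong e ≋-refl)

∣ᵖ-⊗ˡ : ∀ {d p} r → d ∣ᵖ p → d ∣ᵖ r ⊗ p
∣ᵖ-⊗ˡ r d = ∣ᵖ-respʳ (*-comm _ r) (∣ᵖ-⊗ʳ r d)

-- Coprimality in ℚ[q], with denominators cleared.
Coprime : Poly → Poly → Set
Coprime f g = ∃ λ u → ∃ λ v → ∃ λ c → c ≢ + 0 × u ⊗ f ⊕ v ⊗ g ≋ constₚ c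

Coprime-sym : ∀ {f g} → Coprime f g → Coprime g f
Coprime-sym (u , v , c , nz , e) = v , u , c , nz , ≋-trans (+-comm _ _) e

Coprime-∣ : ∀ {f g h} → g ∣ᵖ h → Coprime f h → Coprime f g
Coprime-∣ {f} {g} {h} (s , gs) (u , v , c , nz , e) = u , v ⊗ s , c , nz ,
  ≋-trans (+-cong ≋-refl (≋-trans (*-assoc v s g) (*-cong ≋-refl (≋-trans (*-comm s g) gs)))) e

Coprime-respʳ : ∀ {f g h} → g ≋ h → Coprime f g → Coprime f h
Coprime-respʳ e (u , v , c , nz , f) = u , v , c , nz ,
  ≋-trans (+-cong ≋-refl (*-cong ≋-refl (≋-sym e))) f

-- Multiply the two Bézout identities: every term except the one in g h contains f.
Coprime-⊗ : ∀ {f g h} → Coprime f g → Coprime f h → Coprime f (g ⊗ h)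
Coprime-⊗ {f} {g} {h} (u , v , c , nz , e) (u′ , v′ , c′ , nz′ , e′) =
  u ⊗ (u′ ⊗ f ⊕ v′ ⊗ h) ⊕ v ⊗ g ⊗ u′ , v ⊗ v′ , c ℤ.* c′ , *-nonzero-ℤ nz nz′ , (begin
    (u ⊗ (u′ ⊗ f ⊕ v′ ⊗ h) ⊕ v ⊗ g ⊗ u′) ⊗ f ⊕ v ⊗ v′ ⊗ (g ⊗ h)
      ≈⟨ solve 7 (λ u v u′ v′ f g h → (u :* (u′ :* f :+ v′ :* h) :+ v :* g :* u′) :* f :+ v :* v′ :* (g :* h)
           := (u :* f :+ v :* g) :* (u′ :* f :+ v′ :* h)) ≋-refl u v u′ v′ f g h ⟩
    (u ⊗ f ⊕ v ⊗ g) ⊗ (u′ ⊗ f ⊕ v′ ⊗ h)  ≈⟨ *-cong e e′ ⟩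
    constₚ c ⊗ constₚ c′                 ≈⟨ const-* c c′ ⟨
    constₚ (c ℤ.* c′)                    ∎)
  where open ≋-Reasoning
        open Solver

1≢0 : + 1 ≢ + 0
1≢0 ()

Coprime-1 : ∀ f → Coprime f oneₚ
Coprime-1 f = [] , oneₚ , + 1 , 1≢0 , ≋-trans (+-cong (zeroˡ f) (*-identityˡ oneₚ)) (+-identityˡ oneₚ)

^-nonzero : ∀ {l} e → l ≢ + 0 → l ℤ.^ e ≢ + 0
^-nonzero zero    nz = 1≢0
^-nonzero (suc e) nz = *-nonzero-ℤ nz (^-nonzero e nz)

record LowestTerms (N D : Poly) : Set where
  field
    num den   : Poly
    cross     : N ⊗ den ≋ num ⊗ D
    den≢0     : ¬ den ≋ []
    coprime   : Coprime num den

-- Euclid's algorithm, with `k` bounding the degree of the denominator. From c N = D Q + R and D/R =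
-- x/y it follows that N/D = (Q x + y)/(c x), and a Bézout identity for x, y turns into one for the
-- new pair. Integers common to numerator and denominator may survive.
lowestTerms : ∀ k N D → DegLt k D → ¬ D ≋ [] → LowestTerms N D
lowestTerms zero    N D d D≢0 = ⊥-elim (D≢0 (DegLt-0 d))
lowestTerms (suc k) N D d D≢0 with degree? D
... | inj₁ D≋0 = ⊥-elim (D≢0 D≋0)
... | inj₂ (j , nz , dj) with pseudoDivide {j} N D refl dj
...   | record { exponent = e ; quotient = Q ; remainder = R ; equation = eq ; remainder-degree = dR }
        with degree? R
...     | inj₁ R≋0 = record
  { num = Q ; den = constₚ c ; den≢0 = const-nonzero c≢0
  ; cross = begin
      N ⊗ constₚ c  ≈⟨ *-comm N _ ⟩
      constₚ c ⊗ N  ≈⟨ eq ⟩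
      D ⊗ Q ⊕ R     ≈⟨ +-cong ≋-refl R≋0 ⟩
      D ⊗ Q ⊕ []    ≈⟨ +-identityʳ _ ⟩
      D ⊗ Q         ≈⟨ *-comm D Q ⟩
      Q ⊗ D         ∎
  ; coprime = [] , oneₚ , c , c≢0 , ≋-trans (+-cong (zeroˡ Q) (*-identityˡ _)) (+-identityˡ _) }
  where
  open ≋-Reasoning
  c = coeff D j ℤ.^ e
  c≢0 = ^-nonzero e nz
...     | inj₂ (_ , hR) = record
  { num = num ; den = den
  ; den≢0 = ⊗-nonzero (const-nonzero c≢0) x≢0
  ; cross = begin
      N ⊗ (constₚ c ⊗ x)           ≈⟨ solve 3 (λ n c x → n :* (c :* x) := (c :* n) :* x) ≋-refl N (constₚ c) x ⟩
      constₚ c ⊗ N ⊗ x             ≈⟨ *-cong eq ≋-refl ⟩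
      (D ⊗ Q ⊕ R) ⊗ x              ≈⟨ solve 4 (λ d q r x → (d :* q :+ r) :* x := d :* q :* x :+ x :* r) ≋-refl D Q R x ⟩
      D ⊗ Q ⊗ x ⊕ x ⊗ R            ≈⟨ +-cong ≋-refl (LowestTerms.cross rec) ⟨
      D ⊗ Q ⊗ x ⊕ D ⊗ y            ≈⟨ solve 4 (λ d q x y → d :* q :* x :+ d :* y := (q :* x :+ y) :* d) ≋-refl D Q x y ⟩
      num ⊗ D                      ∎
  ; coprime = combine (LowestTerms.coprime rec) }
  where
  open ≋-Reasoning
  open Solver
  c = coeff D j ℤ.^ e
  c≢0 = ^-nonzero e nz
  rec = lowestTerms k D R (DegLt-mono {p = R} (ℕₚ.≤-pred (ℕₚ.≰⇒> (λ k<j → nz (d j k<j)))) dR) (HasDegree⇒≢0 hR)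
  x = LowestTerms.num rec
  y = LowestTerms.den rec
  den = constₚ c ⊗ x
  num = Q ⊗ x ⊕ y
  x≢0 : ¬ x ≋ []
  x≢0 x≋0 = ⊗-nonzero D≢0 (LowestTerms.den≢0 rec)
    (≋-trans (LowestTerms.cross rec) (≋-trans (*-cong x≋0 ≋-refl) (zeroˡ R)))
  combine : Coprime x y → Coprime num den
  combine (α , β , c′ , c′≢0 , h) = constₚ c ⊗ β , α ⊝ β ⊗ Q , c ℤ.* c′ , *-nonzero-ℤ c≢0 c′≢0 , (begin
    constₚ c ⊗ β ⊗ num ⊕ (α ⊝ β ⊗ Q) ⊗ den
      ≈⟨ solve 6 (λ c α β q x y → c :* β :* (q :* x :+ y) :+ (α :- β :* q) :* (c :* x)
           := c :* (α :* x :+ β :* y)) ≋-refl (constₚ c) α β Q x y ⟩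
    constₚ c ⊗ (α ⊗ x ⊕ β ⊗ y)  ≈⟨ *-cong ≋-refl h ⟩
    constₚ c ⊗ constₚ c′        ≈⟨ const-* c c′ ⟨
    constₚ (c ℤ.* c′)           ∎)

-- Contents and reduced forms

content : Poly → ℕ
content []      = 0
content (a ∷ p) = gcd ℤ.∣ a ∣ (content p)

content-greatest : ∀ {d} p → (∀ i → d ℕ∣.∣ ℤ.∣ coeff p i ∣) → d ℕ∣.∣ content p
content-greatest []      h = _ ℕ∣.∣0
content-greatest (a ∷ p) h = gcd-greatest (h 0) (content-greatest p (h ∘ suc))

content-∣ : ∀ {d} p → d ℕ∣.∣ content p → ∃ λ r → p ≡ scaleₚ (+ d) r
content-∣ []      h = [] , refl
content-∣ {d} (a ∷ p) h
  with content-∣ p (ℕ∣.∣-trans h (gcd[m,n]∣n ℤ.∣ a ∣ _))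
     | ℤ∣.∣ᵤ⇒∣ {+ d} {a} (ℕ∣.∣-trans h (gcd[m,n]∣m ℤ.∣ a ∣ (content p)))
... | r , e | ℤ∣.divides b f = b ∷ r , cong₂ _∷_ (≡.trans f (ℤₚ.*-comm b (+ d))) e

content≢0 : ∀ {p} → ¬ p ≋ [] → content p ≢ 0
content≢0 {p} nz e = nz (subst (_≋ []) (≡.sym (proj₂ q)) (scale-0 (proj₁ q)))
  -- With d = 0: content 0 exhibits `p` as 0 times a polynomial.
  where q = content-∣ p (subst (0 ℕ∣.∣_) (≡.sym e) (ℕ∣.∣-refl {0}))

const-degree : ∀ {k c p r} → HasDegree k p → c ≢ + 0 → p ⊗ r ≋ constₚ c → k ≡ 0
const-degree {k} {c} {p} {r} hp c≢0 e with degree? r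
... | inj₁ r≋0 = ⊥-elim (const-nonzero c≢0 (≋-trans (≋-sym e) (≋-trans (*-cong ≋-refl r≋0) (zeroʳ p))))
... | inj₂ (l , hr) with k ℕ.+ l in eq
...   | zero  = ℕₚ.m+n≡0⇒m≡0 k eq
...   | suc j = ⊥-elim (proj₁ (HasDegree-⊗ p r hp hr) (subst (λ i → coeff (p ⊗ r) i ≡ + 0) (≡.sym eq) (at e (suc j))))

abs≡1 : ∀ a → ℤ.∣ a ∣ ≡ 1 → a ℤ.* a ≡ + 1
abs≡1 (+ 1)    refl = refl
abs≡1 -[1+ 0 ] refl = refl

const-factor : ∀ {a p} g r → p ≡ scaleₚ (+ g) r → constₚ a ∣ᵖ r → ∀ i → g ℕ.* ℤ.∣ a ∣ ℕ∣.∣ ℤ.∣ coeff p i ∣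
const-factor {a} g r refl (s , e) i = ℕ∣.divides ℤ.∣ coeff s i ∣ (begin
  ℤ.∣ coeff (scaleₚ (+ g) r) i ∣            ≡⟨ cong ℤ.∣_∣ (coeff-scale (+ g) r i) ⟩
  ℤ.∣ + g ℤ.* coeff r i ∣                   ≡⟨ ℤₚ.abs-* (+ g) (coeff r i) ⟩
  g ℕ.* ℤ.∣ coeff r i ∣                     ≡⟨ cong (λ t → g ℕ.* ℤ.∣ t ∣) (≡.trans (≡.sym (at e i))
                                                (≡.trans (at (const-⊗ a s) i) (coeff-scale a s i))) ⟩
  g ℕ.* ℤ.∣ a ℤ.* coeff s i ∣               ≡⟨ cong (g ℕ.*_) (ℤₚ.abs-* a (coeff s i)) ⟩
  g ℕ.* (ℤ.∣ a ∣ ℕ.* ℤ.∣ coeff s i ∣)       ≡⟨ ℕₚ.*-assoc g _ _ ⟨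
  g ℕ.* ℤ.∣ a ∣ ℕ.* ℤ.∣ coeff s i ∣         ≡⟨ ℕₚ.*-comm (g ℕ.* ℤ.∣ a ∣) _ ⟩
  ℤ.∣ coeff s i ∣ ℕ.* (g ℕ.* ℤ.∣ a ∣)       ∎)
  where open ≡.≡-Reasoning

record ReducedForm (N D : Poly) : Set where
  field
    num den : Poly
    cross   : N ⊗ den ≋ num ⊗ D
    den≢0   : ¬ den ≋ []
    reduced : Reduced num den

-- Dividing lowest terms x/y by the gcd g of both contents removes the common integers. A common
-- divisor e of the quotients divides the Bézout constant of x and y, so it is a constant a. Then g
-- |a| divides every coefficient of x and y, hence divides g, and a is a unit.
reducedForm : ∀ N D → ¬ D ≋ [] → ReducedForm N D
reducedForm N D D≢0 with lowestTerms (length D) N D (DegLt-length D) D≢0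
... | record { num = x ; den = y ; cross = cr ; den≢0 = y≢0 ; coprime = (α , β , c , c≢0 , bez) } =
  record { num = x′ ; den = y′ ; cross = ⊗-cancelˡ (const-nonzero g≢0) cross′ ; den≢0 = y′≢0 ; reduced = red }
  where
  g = gcd (content x) (content y)
  g∣x = content-∣ x (gcd[m,n]∣m (content x) (content y))
  g∣y = content-∣ y (gcd[m,n]∣n (content x) (content y))
  x′ = proj₁ g∣x
  y′ = proj₁ g∣y
  G = constₚ (+ g)
  Gx : G ⊗ x′ ≋ x
  Gx = ≋-trans (const-⊗ (+ g) x′) (≋-reflexive (≡.sym (proj₂ g∣x)))
  Gy : G ⊗ y′ ≋ y
  Gy = ≋-trans (const-⊗ (+ g) y′) (≋-reflexive (≡.sym (proj₂ g∣y)))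
  gℕ≢0 : g ≢ 0
  gℕ≢0 e = content≢0 y≢0 (ℕ∣.0∣⇒≡0 (subst (ℕ∣._∣ content y) e (gcd[m,n]∣n (content x) (content y))))
  g≢0 : + g ≢ + 0
  g≢0 e = gℕ≢0 (ℤₚ.+-injective e)
  y′≢0 : ¬ y′ ≋ []
  y′≢0 e = y≢0 (≋-trans (≋-sym Gy) (≋-trans (*-cong ≋-refl e) (zeroʳ G)))
  open Solver
  cross′ : G ⊗ (N ⊗ y′) ≋ G ⊗ (x′ ⊗ D)
  cross′ = begin
    G ⊗ (N ⊗ y′)  ≈⟨ solve 3 (λ g n y → g :* (n :* y) := n :* (g :* y)) ≋-refl G N y′ ⟩
    N ⊗ (G ⊗ y′)  ≈⟨ *-cong ≋-refl Gy ⟩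
    N ⊗ y         ≈⟨ cr ⟩
    x ⊗ D         ≈⟨ *-cong Gx ≋-refl ⟨
    G ⊗ x′ ⊗ D    ≈⟨ *-assoc G x′ D ⟩
    G ⊗ (x′ ⊗ D)  ∎
    where open ≋-Reasoning
  constant-divisor : ∀ e → e ∣ᵖ x′ → e ∣ᵖ y′ → ∃ λ a → e ≋ constₚ a
  constant-divisor e (r , er) (s , es) with degree? e
  ... | inj₁ e≋0 = + 0 , ≋-trans e≋0 (≋-sym 0∷[]≋[])
  ... | inj₂ (k , h) with const-degree {r = G ⊗ (α ⊗ r ⊕ β ⊗ s)} h c≢0 (begin
      e ⊗ (G ⊗ (α ⊗ r ⊕ β ⊗ s))
        ≈⟨ solve 6 (λ e g α β r s → e :* (g :* (α :* r :+ β :* s)) := α :* (g :* (e :* r)) :+ β :* (g :* (e :* s)))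
             ≋-refl e G α β r s ⟩
      α ⊗ (G ⊗ (e ⊗ r)) ⊕ β ⊗ (G ⊗ (e ⊗ s))
        ≈⟨ +-cong (*-cong ≋-refl (≋-trans (*-cong ≋-refl er) Gx)) (*-cong ≋-refl (≋-trans (*-cong ≋-refl es) Gy)) ⟩
      α ⊗ x ⊕ β ⊗ y  ≈⟨ bez ⟩
      constₚ c ∎)
      where open ≋-Reasoning
  ...   | refl = coeff e 0 , mk≋ λ { zero → refl ; (suc i) → proj₂ h (suc i) (s≤s z≤n) }
  red : Reduced x′ y′
  red e e∣x e∣y with constant-divisor e (∣ₚ⇒∣ᵖ e∣x) (∣ₚ⇒∣ᵖ e∣y)
  -- A unit of ℤ is its own inverse, so `constₚ a` is the cofactor.
  ... | a , e≋a = ∣ᵖ⇒∣ₚ (constₚ a , ≋-trans (*-cong e≋a ≋-refl)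
        (≋-trans (≋-sym (const-* a a)) (≋-reflexive (cong constₚ (abs≡1 a a-unit)))))
    where
    toConst : ∀ {p} → e ∣ₚ p → constₚ a ∣ᵖ p
    toConst d = let (r , er) = ∣ₚ⇒∣ᵖ d in r , ≋-trans (*-cong (≋-sym e≋a) ≋-refl) er
    ga∣g : g ℕ.* ℤ.∣ a ∣ ℕ∣.∣ g
    ga∣g = gcd-greatest
      (content-greatest x (const-factor g x′ (proj₂ g∣x) (toConst e∣x)))
      (content-greatest y (const-factor g y′ (proj₂ g∣y) (toConst e∣y)))
    a-unit : ℤ.∣ a ∣ ≡ 1
    a-unit = ℕ∣.∣1⇒≡1 (ℕ∣.*-cancelˡ-∣ g {{ℕ.≢-nonZero gℕ≢0}} (subst (g ℕ.* ℤ.∣ a ∣ ℕ∣.∣_) (≡.sym (ℕₚ.*-identityʳ g)) ga∣g))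

-- Cancellation in multiples of a monic polynomial

record Monic (k : ℕ) (p : Poly) : Set where
  constructor monic
  field
    leading : coeff p k ≡ + 1
    degree  : DegLt (suc k) p

Monic⇒HasDegree : ∀ {k p} → Monic k p → HasDegree k p
Monic⇒HasDegree (monic l d) = (λ e → 1≢0 (≡.trans (≡.sym l) e)) , d

Monic⇒≢0 : ∀ {k p} → Monic k p → ¬ p ≋ []
Monic⇒≢0 m = HasDegree⇒≢0 (Monic⇒HasDegree m)

multiple-of-small-degree : ∀ {k p s} r → HasDegree k p → DegLt k s → p ⊗ r ≋ s → s ≋ []
multiple-of-small-degree {k} {p} {s} r hp ds e with degree? r
... | inj₁ r≋0 = ≋-trans (≋-sym e) (≋-trans (*-cong ≋-refl r≋0) (zeroʳ p))
... | inj₂ (l , hr) = ⊥-elim (proj₁ (HasDegree-⊗ p r hp hr)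
        (≡.trans (at e (k ℕ.+ l)) (ds (k ℕ.+ l) (ℕₚ.m≤m+n k l))))

-- Gauss's lemma in the easy, monic case. Division of r by p leaves a remainder R over ℤ; c R is a
-- multiple of p of smaller degree than p, hence zero. This is how the integers in Bézout identities
-- are disposed of.
monic-∣-const : ∀ {k p r c} → Monic k p → c ≢ + 0 → p ∣ᵖ constₚ c ⊗ r → p ∣ᵖ r
monic-∣-const {k} {p} {r} {c} m c≢0 (K , e) with pseudoDivide {k} r p (Monic.leading m) (Monic.degree m)
... | record { exponent = x ; quotient = Q ; remainder = R ; equation = eq ; remainder-degree = dR } =
  Q , (begin
    p ⊗ Q                   ≈⟨ +-identityʳ _ ⟨
    p ⊗ Q ⊕ []              ≈⟨ +-cong ≋-refl R≋0 ⟨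
    p ⊗ Q ⊕ R               ≈⟨ eq′ ⟨
    r                       ∎)
  where
  open ≋-Reasoning
  open Solver
  eq′ : r ≋ p ⊗ Q ⊕ R
  eq′ = begin
    r                         ≈⟨ *-identityˡ r ⟨
    oneₚ ⊗ r                  ≈⟨ *-cong (≋-reflexive (cong constₚ (ℤₚ.^-zeroˡ x))) ≋-refl ⟨
    constₚ ((+ 1) ℤ.^ x) ⊗ r    ≈⟨ eq ⟩
    p ⊗ Q ⊕ R                 ∎
  R≋0 : R ≋ []
  R≋0 = ⊗-cancelˡ-0 (const-nonzero c≢0) (multiple-of-small-degree (K ⊝ constₚ c ⊗ Q) (Monic⇒HasDegree m)
    (DegLt-≋ {p = scaleₚ c R} (≋-sym (const-⊗ c R)) (DegLt-scale c R dR)) (begin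
      p ⊗ (K ⊝ constₚ c ⊗ Q)
        ≈⟨ solve 4 (λ p k c q → p :* (k :- c :* q) := p :* k :- c :* (p :* q)) ≋-refl p K (constₚ c) Q ⟩
      p ⊗ K ⊝ constₚ c ⊗ (p ⊗ Q)
        ≈⟨ +-cong (≋-trans e (*-cong ≋-refl eq′)) ≋-refl ⟩
      constₚ c ⊗ (p ⊗ Q ⊕ R) ⊝ constₚ c ⊗ (p ⊗ Q)
        ≈⟨ solve 4 (λ p q r c → c :* (p :* q :+ r) :- c :* (p :* q) := c :* r) ≋-refl p Q R (constₚ c) ⟩
      constₚ c ⊗ R ∎))

coprime-∣-cancel : ∀ {k p f r} → Monic k p → Coprime f p → p ∣ᵖ r ⊗ f → p ∣ᵖ r
coprime-∣-cancel {p = p} {f} {r} m (u , v , c , c≢0 , bez) (s , e) = monic-∣-const m c≢0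
  (u ⊗ s ⊕ v ⊗ r , (begin
    p ⊗ (u ⊗ s ⊕ v ⊗ r)       ≈⟨ solve 5 (λ p u s v r → p :* (u :* s :+ v :* r) := u :* (p :* s) :+ v :* p :* r)
                                   ≋-refl p u s v r ⟩
    u ⊗ (p ⊗ s) ⊕ v ⊗ p ⊗ r   ≈⟨ +-cong (*-cong ≋-refl e) ≋-refl ⟩
    u ⊗ (r ⊗ f) ⊕ v ⊗ p ⊗ r   ≈⟨ solve 5 (λ p u f v r → u :* (r :* f) :+ v :* p :* r := (u :* f :+ v :* p) :* r)
                                   ≋-refl p u f v r ⟩
    (u ⊗ f ⊕ v ⊗ p) ⊗ r       ≈⟨ *-cong bez ≋-refl ⟩
    constₚ c ⊗ r              ∎))
  where open ≋-Reasoning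
        open Solver

coprime-product-∣ : ∀ {k f g h} → Monic k (f ⊗ g) → Coprime f g → f ∣ᵖ h → g ∣ᵖ h → f ⊗ g ∣ᵖ h
coprime-product-∣ {f = f} {g} {h} m (u , v , c , c≢0 , bez) (r , fr) (s , gs) = monic-∣-const m c≢0
  (u ⊗ s ⊕ v ⊗ r , (begin
    f ⊗ g ⊗ (u ⊗ s ⊕ v ⊗ r)                ≈⟨ solve 6 (λ f g u s v r → f :* g :* (u :* s :+ v :* r)
                                                 := u :* f :* (g :* s) :+ v :* g :* (f :* r)) ≋-refl f g u s v r ⟩
    u ⊗ f ⊗ (g ⊗ s) ⊕ v ⊗ g ⊗ (f ⊗ r)      ≈⟨ +-cong (*-cong ≋-refl gs) (*-cong ≋-refl fr) ⟩
    u ⊗ f ⊗ h ⊕ v ⊗ g ⊗ h                  ≈⟨ distribʳ h (u ⊗ f) (v ⊗ g) ⟨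
    (u ⊗ f ⊕ v ⊗ g) ⊗ h                    ≈⟨ *-cong bez ≋-refl ⟩
    constₚ c ⊗ h                           ∎))
  where open ≋-Reasoning
        open Solver

congruentToZero : ∀ {k N D P E M} → Monic k P → ¬ D ≋ [] → Coprime E P →
  N ⊗ E ≋ P ⊗ M ⊗ D → CongMod (N , D) zeroF P
congruentToZero {N = N} {D} {P} {E} {M} m D≢0 cop eq =
  num , den , (λ e → den≢0 (≈⇒≋ e)) , ≋⇒≈ cross₀ , reduced , ∣ᵖ⇒∣ₚ (coprime-∣-cancel m cop P∣)
  where
  open ReducedForm (reducedForm N D D≢0)
  open Solver
  open ≋-Reasoning
  -- Subtracting `zeroF` multiplies both components by `oneₚ` and subtracts a zero product; the next
  -- two equations remove these traces.
  N≋ : N *ₚ oneₚ -ₚ [] *ₚ D ≋ N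
  N≋ = ≋-trans (≋-reflexive (-ₚ≡⊝ _ _)) (≋-trans (+-cong
    (≋-trans (≋-reflexive (*ₚ≡⊗ N oneₚ)) (*-identityʳ N)) ≋-refl)
    (mk≋ λ i → ≡.trans (coeff-⊝ N [] i) (ℤₚ.+-identityʳ _)))
  D≋ : D *ₚ oneₚ ≋ D
  D≋ = ≋-trans (≋-reflexive (*ₚ≡⊗ D oneₚ)) (*-identityʳ D)
  cross₀ : (N *ₚ oneₚ -ₚ [] *ₚ D) *ₚ den ≋ num *ₚ (D *ₚ oneₚ)
  cross₀ = begin
    (N *ₚ oneₚ -ₚ [] *ₚ D) *ₚ den  ≡⟨ *ₚ≡⊗ _ den ⟩
    (N *ₚ oneₚ -ₚ [] *ₚ D) ⊗ den   ≈⟨ *-cong N≋ ≋-refl ⟩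
    N ⊗ den                        ≈⟨ cross ⟩
    num ⊗ D                        ≈⟨ *-cong ≋-refl D≋ ⟨
    num ⊗ (D *ₚ oneₚ)              ≡⟨ *ₚ≡⊗ num _ ⟨
    num *ₚ (D *ₚ oneₚ)             ∎
  P∣ : P ∣ᵖ num ⊗ E
  P∣ = M ⊗ den , ⊗-cancelˡ D≢0 (begin
    D ⊗ (P ⊗ (M ⊗ den))  ≈⟨ solve 4 (λ d p m y → d :* (p :* (m :* y)) := p :* m :* d :* y) ≋-refl D P M den ⟩
    P ⊗ M ⊗ D ⊗ den      ≈⟨ *-cong eq ≋-refl ⟨
    N ⊗ E ⊗ den          ≈⟨ solve 3 (λ n e y → n :* e :* y := n :* y :* e) ≋-refl N E den ⟩
    N ⊗ den ⊗ E          ≈⟨ *-cong cross ≋-refl ⟩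
    num ⊗ D ⊗ E          ≈⟨ solve 3 (λ x d e → x :* d :* e := d :* (x :* e)) ≋-refl num D E ⟩
    D ⊗ (num ⊗ E)        ∎)

-- Division by monic polynomials

Xpow-suc : ∀ k → Xpow (suc k) ≋ X ⊗ Xpow k
Xpow-suc k = ≋-sym (X-⊗ (Xpow k))

Xpow-+ : ∀ k l → Xpow (k ℕ.+ l) ≋ Xpow k ⊗ Xpow l
Xpow-+ zero    l = ≋-sym (*-identityˡ (Xpow l))
Xpow-+ (suc k) l = begin
  Xpow (suc (k ℕ.+ l))     ≈⟨ Xpow-suc (k ℕ.+ l) ⟩
  X ⊗ Xpow (k ℕ.+ l)       ≈⟨ *-cong ≋-refl (Xpow-+ k l) ⟩
  X ⊗ (Xpow k ⊗ Xpow l)    ≈⟨ *-assoc X _ _ ⟨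
  X ⊗ Xpow k ⊗ Xpow l      ≈⟨ *-cong (Xpow-suc k) ≋-refl ⟨
  Xpow (suc k) ⊗ Xpow l    ∎
  where open ≋-Reasoning

++-singleton : ∀ p c → p ++ c ∷ [] ≋ p ⊕ constₚ c ⊗ Xpow (length p)
++-singleton []      c = ≋-sym (≋-trans (+-identityˡ _) (*-identityʳ _))
++-singleton (a ∷ p) c = begin
  a ∷ (p ++ c ∷ [])                                        ≈⟨ horner a _ ⟩
  constₚ a ⊕ X ⊗ (p ++ c ∷ [])                             ≈⟨ +-cong ≋-refl (*-cong ≋-refl (++-singleton p c)) ⟩
  constₚ a ⊕ X ⊗ (p ⊕ constₚ c ⊗ Xpow (length p))          ≈⟨ solve 5 (λ a x p c y → a :+ x :* (p :+ c :* y)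
                                                                := a :+ x :* p :+ c :* (x :* y)) ≋-refl (constₚ a) X p (constₚ c) _ ⟩
  constₚ a ⊕ X ⊗ p ⊕ constₚ c ⊗ (X ⊗ Xpow (length p))      ≈⟨ +-cong (horner a p) (*-cong ≋-refl (Xpow-suc (length p))) ⟨
  (a ∷ p) ⊕ constₚ c ⊗ Xpow (length (a ∷ p))               ∎
  where open ≋-Reasoning
        open Solver

reverse-∷ : ∀ c l → reverse (c ∷ l) ≋ reverse l ⊕ constₚ c ⊗ Xpow (length l)
reverse-∷ c l = begin
  reverse (c ∷ l)                                   ≡⟨ Listₚ.unfold-reverse c l ⟩
  reverse l ++ c ∷ []                               ≈⟨ ++-singleton (reverse l) c ⟩
  reverse l ⊕ constₚ c ⊗ Xpow (length (reverse l))  ≡⟨ cong (λ n → reverse l ⊕ constₚ c ⊗ Xpow n) (Listₚ.length-reverse l) ⟩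
  reverse l ⊕ constₚ c ⊗ Xpow (length l)            ∎
  where open ≋-Reasoning

reverse-scale : ∀ c l → reverse (map (c ℤ.*_) l) ≋ constₚ c ⊗ reverse l
reverse-scale c l = ≋-trans (≋-reflexive (≡.sym (Listₚ.reverse-map (c ℤ.*_) l))) (≋-sym (const-⊗ c (reverse l)))

length-subPrefix : ∀ xs ys → length ys ≤ length xs → length (subPrefix xs ys) ≡ length xs
length-subPrefix []       []       _        = refl
length-subPrefix (x ∷ xs) []       _        = refl
length-subPrefix (x ∷ xs) (y ∷ ys) (s≤s le) = cong suc (length-subPrefix xs ys le)

-- In lists with the highest degree first, aligning the heads of `xs` and `ys` means multiplying
-- `ys` by the power of q that makes up the difference of lengths.
reverse-subPrefix : ∀ xs ys → length ys ≤ length xs →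
  reverse xs ≋ reverse (subPrefix xs ys) ⊕ reverse ys ⊗ Xpow (length xs ∸ length ys)
reverse-subPrefix []       []       _ = ≋-sym (≋-trans (+-identityˡ _) (zeroˡ _))
reverse-subPrefix (x ∷ xs) []       _ = ≋-sym (≋-trans (+-cong ≋-refl (zeroˡ _)) (+-identityʳ _))
reverse-subPrefix (x ∷ xs) (y ∷ ys) (s≤s le) = begin
  reverse (x ∷ xs)
    ≈⟨ reverse-∷ x xs ⟩
  reverse xs ⊕ constₚ x ⊗ Xpow (length xs)
    ≈⟨ +-cong (reverse-subPrefix xs ys le) ≋-refl ⟩
  S ⊕ Y ⊗ D ⊕ constₚ x ⊗ Xpow (length xs)
    ≈⟨ solve 6 (λ s y d x c l → s :+ y :* d :+ x :* l := s :+ (x :- c) :* l :+ (y :* d :+ c :* l))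
         ≋-refl S Y D (constₚ x) (constₚ y) (Xpow (length xs)) ⟩
  S ⊕ (constₚ x ⊝ constₚ y) ⊗ Xpow (length xs) ⊕ (Y ⊗ D ⊕ constₚ y ⊗ Xpow (length xs))
    ≈⟨ +-cong (+-cong ≋-refl (*-cong (≋-trans (+-cong ≋-refl (≋-sym (const-⊖ y))) (≋-sym (const-+ x _))) ≋-refl))
              (+-cong ≋-refl (*-cong ≋-refl
                (≋-trans (≋-reflexive (cong Xpow (≡.sym (ℕₚ.m+[n∸m]≡n le)))) (Xpow-+ (length ys) _)))) ⟩
  S ⊕ constₚ (x ℤ.- y) ⊗ Xpow (length xs) ⊕ (Y ⊗ D ⊕ constₚ y ⊗ (Xpow (length ys) ⊗ D))
    ≈⟨ +-cong ≋-refl (solve 4 (λ y d c l → y :* d :+ c :* (l :* d) := (y :+ c :* l) :* d)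
         ≋-refl Y D (constₚ y) (Xpow (length ys))) ⟩
  S ⊕ constₚ (x ℤ.- y) ⊗ Xpow (length xs) ⊕ (Y ⊕ constₚ y ⊗ Xpow (length ys)) ⊗ D
    ≡⟨ cong (λ n → S ⊕ constₚ (x ℤ.- y) ⊗ Xpow n ⊕ (Y ⊕ constₚ y ⊗ Xpow (length ys)) ⊗ D) (length-subPrefix xs ys le) ⟨
  S ⊕ constₚ (x ℤ.- y) ⊗ Xpow (length (subPrefix xs ys)) ⊕ (Y ⊕ constₚ y ⊗ Xpow (length ys)) ⊗ D
    ≈⟨ +-cong (reverse-∷ (x ℤ.- y) (subPrefix xs ys)) (*-cong (reverse-∷ y ys) ≋-refl) ⟨
  reverse (x ℤ.- y ∷ subPrefix xs ys) ⊕ reverse (y ∷ ys) ⊗ D ∎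
  where
  open ≋-Reasoning
  open Solver
  S = reverse (subPrefix xs ys)
  Y = reverse ys
  D = Xpow (length xs ∸ length ys)

-- The quotient keeps its zero coefficients, so its length depends on lengths alone. That length
-- fixes the power of q for which each quotient coefficient stands.
length-divHigh : ∀ fu gt f → length f ≤ fu → length (divHigh fu gt f) ≡ length f ∸ length gt
length-divHigh zero     gt []         _ = ≡.sym (ℕₚ.0∸n≡0 (length gt))
length-divHigh (suc fu) gt []         _ = ≡.sym (ℕₚ.0∸n≡0 (length gt))
length-divHigh (suc fu) gt (c ∷ rest) (s≤s le) with length rest <? length gt
... | yes lt = ≡.sym (ℕₚ.m≤n⇒m∸n≡0 lt)
... | no ¬lt = begin
  suc (length (divHigh fu gt rest′))  ≡⟨ cong suc (length-divHigh fu gt rest′ (subst (_≤ fu) (≡.sym len) le)) ⟩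
  suc (length rest′ ∸ length gt)      ≡⟨ cong (λ l → suc (l ∸ length gt)) len ⟩
  suc (length rest ∸ length gt)       ≡⟨ ℕₚ.+-∸-assoc 1 (ℕₚ.≮⇒≥ ¬lt) ⟨
  suc (length rest) ∸ length gt       ∎
  where
  open ≡.≡-Reasoning
  cgt = map (c ℤ.*_) gt
  rest′ = subPrefix rest cgt
  len = length-subPrefix rest cgt (subst (_≤ length rest) (≡.sym (Listₚ.length-map (c ℤ.*_) gt)) (ℕₚ.≮⇒≥ ¬lt))

-- The algorithm returns the quotient only; the remainder is recovered as the list on which the
-- recursion stops. The implicit leading 1 of the divisor cancels `c`, so each step changes only
-- `rest`. Fuel of at least the length of f does not run out early.
divHigh-remainder : ∀ fu gt f → length f ≤ fu → ∃ λ R → DegLt (length gt) R ×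
  (reverse f ≋ reverse (divHigh fu gt f) ⊗ reverse (+ 1 ∷ gt) ⊕ R)
divHigh-remainder zero     gt [] _ = [] , (λ _ _ → refl) , ≋-sym (≋-trans (+-identityʳ _) (zeroˡ _))
divHigh-remainder (suc fu) gt [] _ = [] , (λ _ _ → refl) , ≋-sym (≋-trans (+-identityʳ _) (zeroˡ _))
divHigh-remainder (suc fu) gt (c ∷ rest) (s≤s le) with length rest <? length gt
... | yes lt = reverse (c ∷ rest)
  , DegLt-mono {p = reverse (c ∷ rest)} (subst (_≤ length gt) (≡.sym (Listₚ.length-reverse (c ∷ rest))) lt)
      (DegLt-length (reverse (c ∷ rest)))
  , ≋-sym (≋-trans (+-cong (zeroˡ _) ≋-refl) (+-identityˡ _))
... | no ¬lt = R , dR , (begin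
  reverse (c ∷ rest)
    ≈⟨ reverse-∷ c rest ⟩
  reverse rest ⊕ C ⊗ Xpow (length rest)
    ≈⟨ +-cong (reverse-subPrefix rest cgt le′) (*-cong ≋-refl
         (≋-trans (≋-reflexive (cong Xpow (≡.sym (ℕₚ.m+[n∸m]≡n (ℕₚ.≮⇒≥ ¬lt))))) (Xpow-+ (length gt) _))) ⟩
  reverse rest′ ⊕ reverse cgt ⊗ Xpow (length rest ∸ length cgt) ⊕ C ⊗ (Xpow (length gt) ⊗ D)
    ≈⟨ +-cong (+-cong eq (*-cong (reverse-scale c gt)
         (≋-reflexive (cong (λ l → Xpow (length rest ∸ l)) (Listₚ.length-map (c ℤ.*_) gt))))) ≋-refl ⟩
  Q ⊗ reverse (+ 1 ∷ gt) ⊕ R ⊕ C ⊗ reverse gt ⊗ D ⊕ C ⊗ (Xpow (length gt) ⊗ D)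
    ≈⟨ solve 7 (λ q g r c h d l → q :* g :+ r :+ c :* h :* d :+ c :* (l :* d)
         := q :* g :+ c :* d :* (h :+ con (+ 1) :* l) :+ r)
         ≋-refl Q (reverse (+ 1 ∷ gt)) R C (reverse gt) D (Xpow (length gt)) ⟩
  Q ⊗ reverse (+ 1 ∷ gt) ⊕ C ⊗ D ⊗ (reverse gt ⊕ oneₚ ⊗ Xpow (length gt)) ⊕ R
    ≈⟨ +-cong (+-cong ≋-refl (*-cong (*-cong ≋-refl (≋-reflexive (cong Xpow lenQ))) (reverse-∷ (+ 1) gt))) ≋-refl ⟨
  Q ⊗ reverse (+ 1 ∷ gt) ⊕ C ⊗ Xpow (length q) ⊗ reverse (+ 1 ∷ gt) ⊕ R
    ≈⟨ +-cong (distribʳ (reverse (+ 1 ∷ gt)) Q (C ⊗ Xpow (length q))) ≋-refl ⟨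
  (Q ⊕ C ⊗ Xpow (length q)) ⊗ reverse (+ 1 ∷ gt) ⊕ R
    ≈⟨ +-cong (*-cong (reverse-∷ c q) ≋-refl) ≋-refl ⟨
  reverse (c ∷ q) ⊗ reverse (+ 1 ∷ gt) ⊕ R ∎)
  where
  open ≋-Reasoning
  open Solver
  cgt = map (c ℤ.*_) gt
  rest′ = subPrefix rest cgt
  le′ = subst (_≤ length rest) (≡.sym (Listₚ.length-map (c ℤ.*_) gt)) (ℕₚ.≮⇒≥ ¬lt)
  len = length-subPrefix rest cgt le′
  rec = divHigh-remainder fu gt rest′ (subst (_≤ fu) (≡.sym len) le)
  q = divHigh fu gt rest′
  Q = reverse q
  C = constₚ c
  D = Xpow (length rest ∸ length gt)
  R = proj₁ rec
  dR = proj₁ (proj₂ rec)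
  eq = proj₂ (proj₂ rec)
  lenQ : length q ≡ length rest ∸ length gt
  lenQ = ≡.trans (length-divHigh fu gt rest′ (subst (_≤ fu) (≡.sym len) le)) (cong (_∸ length gt) len)

-- A coefficient list without trailing zeros whose last entry is 1.
record MonicList (k : ℕ) (p : Poly) : Set where
  constructor monicList
  field
    size : length p ≡ suc k
    last : coeff p k ≡ + 1

MonicList⇒Monic : ∀ {k p} → MonicList k p → Monic k p
MonicList⇒Monic {p = p} (monicList s l) = monic l (subst (λ k → DegLt k p) s (DegLt-length p))

split-last : ∀ {k} p → length p ≡ suc k → ∃ λ r → p ≡ r ∷ʳ coeff p k
split-last {zero}  (a ∷ [])    refl = [] , refl
split-last {suc k} (a ∷ p) e with split-last p (ℕₚ.suc-injective e)
... | r , f = a ∷ r , cong (a ∷_) f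

length-+ₚ : ∀ p r → length (p +ₚ r) ≡ length p ℕ.⊔ length r
length-+ₚ []      r       = refl
length-+ₚ (a ∷ p) []      = refl
length-+ₚ (a ∷ p) (b ∷ r) = cong suc (length-+ₚ p r)

length-*ₚ : ∀ {k l} p r → length p ≡ suc k → length r ≡ suc l → length (p *ₚ r) ≡ suc (k ℕ.+ l)
length-*ₚ {zero} {l} (a ∷ []) r refl e = begin
  length (scaleₚ a r +ₚ (+ 0 ∷ []))  ≡⟨ length-+ₚ (scaleₚ a r) _ ⟩
  length (scaleₚ a r) ℕ.⊔ 1          ≡⟨ cong (ℕ._⊔ 1) (≡.trans (Listₚ.length-map _ r) e) ⟩
  suc (l ℕ.⊔ 0)                      ≡⟨ cong suc (ℕₚ.⊔-identityʳ l) ⟩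
  suc l                              ∎
  where open ≡.≡-Reasoning
length-*ₚ {suc k} {l} (a ∷ p) r e f = begin
  length (scaleₚ a r +ₚ (+ 0 ∷ p *ₚ r))           ≡⟨ length-+ₚ (scaleₚ a r) _ ⟩
  length (scaleₚ a r) ℕ.⊔ suc (length (p *ₚ r))  ≡⟨ cong₂ (λ x y → x ℕ.⊔ suc y) (≡.trans (Listₚ.length-map _ r) f)
                                                      (length-*ₚ p r (ℕₚ.suc-injective e) f) ⟩
  suc (l ℕ.⊔ suc (k ℕ.+ l))                       ≡⟨ cong suc (ℕₚ.m≤n⇒m⊔n≡n (ℕₚ.m≤n+m l (suc k))) ⟩
  suc (suc k ℕ.+ l)                               ∎
  where open ≡.≡-Reasoning

MonicList-1 : MonicList 0 oneₚ
MonicList-1 = monicList refl refl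

MonicList-*ₚ : ∀ {k l p r} → MonicList k p → MonicList l r → MonicList (k ℕ.+ l) (p *ₚ r)
MonicList-*ₚ {k} {l} {p} {r} mp mr = monicList
  (length-*ₚ p r (MonicList.size mp) (MonicList.size mr))
  (≡.trans (coeff-*-top p r (Monic.degree (MonicList⇒Monic mp)) (Monic.degree (MonicList⇒Monic mr)))
           (cong₂ ℤ._*_ (MonicList.last mp) (MonicList.last mr)))

-- The remainder is a multiple of g of smaller degree, hence zero. The quotient is again a list
-- ending in 1 without trailing zeros, which is the form a divisor must have for the next division.
divMonic-exact : ∀ {a b f g} → MonicList a f → MonicList b g → g ∣ᵖ f →
  MonicList (a ∸ b) (divMonic f g) × g ⊗ divMonic f g ≋ f
divMonic-exact {a} {b} {f} {g} mf mg (h , gh) with split-last g (MonicList.size mg)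
... | r , g≡ = monicList size last , exact
  where
  open ≡.≡-Reasoning
  gt = drop 1 (reverse g)
  Q = divHigh (length f) gt (reverse f)
  reverse-g : reverse g ≡ + 1 ∷ reverse r
  reverse-g = begin
    reverse g                    ≡⟨ cong reverse g≡ ⟩
    reverse (r ∷ʳ coeff g b)     ≡⟨ Listₚ.reverse-++ r (coeff g b ∷ []) ⟩
    coeff g b ∷ reverse r        ≡⟨ cong (_∷ reverse r) (MonicList.last mg) ⟩
    + 1 ∷ reverse r              ∎
  g-from-gt : reverse (+ 1 ∷ gt) ≡ g
  g-from-gt = begin
    reverse (+ 1 ∷ drop 1 (reverse g))          ≡⟨ cong (λ l → reverse (+ 1 ∷ drop 1 l)) reverse-g ⟩
    reverse (+ 1 ∷ reverse r)                   ≡⟨ cong reverse reverse-g ⟨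
    reverse (reverse g)                         ≡⟨ Listₚ.reverse-involutive g ⟩
    g                                           ∎
  length-gt : length gt ≡ b
  length-gt = ℕₚ.suc-injective (begin
    length (+ 1 ∷ gt)            ≡⟨ Listₚ.length-reverse (+ 1 ∷ gt) ⟨
    length (reverse (+ 1 ∷ gt))  ≡⟨ cong length g-from-gt ⟩
    length g                     ≡⟨ MonicList.size mg ⟩
    suc b                        ∎)
  bound : length (reverse f) ≤ length f
  bound = ℕₚ.≤-reflexive (Listₚ.length-reverse f)
  division = divHigh-remainder (length f) gt (reverse f) bound
  R = proj₁ division
  f≋ : f ≋ reverse Q ⊗ g ⊕ R
  f≋ = ≋-trans (≋-reflexive (≡.sym (Listₚ.reverse-involutive f)))
         (≋-trans (proj₂ (proj₂ division)) (≋-reflexive (cong (λ p → reverse Q ⊗ p ⊕ R) g-from-gt)))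
  open Solver
  R≋0 : R ≋ []
  R≋0 = multiple-of-small-degree (h ⊝ reverse Q) (Monic⇒HasDegree (MonicList⇒Monic mg))
    (subst (λ k → DegLt k R) length-gt (proj₁ (proj₂ division)))
    (≋-trans (⊗-distribˡ-⊝ g h (reverse Q))
    (≋-trans (+-cong (≋-trans gh f≋) ≋-refl)
    (solve 3 (λ q g r → q :* g :+ r :- g :* q := r) ≋-refl (reverse Q) g R)))
  exact : g ⊗ reverse Q ≋ f
  exact = ≋-trans (*-comm g _) (≋-sym (≋-trans f≋ (≋-trans (+-cong ≋-refl R≋0) (+-identityʳ _))))
  b≤a : b ≤ a
  b≤a = ℕₚ.≮⇒≥ λ a<b → Monic⇒≢0 (MonicList⇒Monic mf)
    (multiple-of-small-degree h (Monic⇒HasDegree (MonicList⇒Monic mg))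
      (DegLt-mono {p = f} a<b (Monic.degree (MonicList⇒Monic mf))) gh)
  size : length (reverse Q) ≡ suc (a ∸ b)
  size = begin
    length (reverse Q)               ≡⟨ Listₚ.length-reverse Q ⟩
    length Q                         ≡⟨ length-divHigh (length f) gt (reverse f) bound ⟩
    length (reverse f) ∸ length gt   ≡⟨ cong₂ _∸_ (≡.trans (Listₚ.length-reverse f) (MonicList.size mf)) length-gt ⟩
    suc a ∸ b                        ≡⟨ ℕₚ.+-∸-assoc 1 b≤a ⟩
    suc (a ∸ b)                      ∎
  last : coeff (reverse Q) (a ∸ b) ≡ + 1
  last = begin
    coeff (reverse Q) (a ∸ b)                  ≡⟨ ℤₚ.*-identityˡ _ ⟨
    + 1 ℤ.* coeff (reverse Q) (a ∸ b)          ≡⟨ cong (ℤ._* coeff (reverse Q) (a ∸ b)) (MonicList.last mg) ⟨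
    coeff g b ℤ.* coeff (reverse Q) (a ∸ b)    ≡⟨ coeff-⊗-top g (reverse Q) (Monic.degree (MonicList⇒Monic mg))
                                                    (subst (λ k → DegLt k (reverse Q)) size (DegLt-length (reverse Q))) ⟨
    coeff (g ⊗ reverse Q) (b ℕ.+ (a ∸ b))      ≡⟨ at exact (b ℕ.+ (a ∸ b)) ⟩
    coeff f (b ℕ.+ (a ∸ b))                    ≡⟨ cong (coeff f) (ℕₚ.m+[n∸m]≡n b≤a) ⟩
    coeff f a                                  ≡⟨ MonicList.last mf ⟩
    + 1                                        ∎

-- Cyclotomic polynomials

geom : ℕ → Poly → Poly
geom zero    p = []
geom (suc k) p = oneₚ ⊕ p ⊗ geom k p

geom-Xpow : ∀ g k → (Xpow g ⊝ oneₚ) ⊗ geom k (Xpow g) ≋ Xpow (k ℕ.* g) ⊝ oneₚ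
geom-Xpow g zero    = ≋-trans (zeroʳ _) (≋-sym (-‿inverseʳ oneₚ))
geom-Xpow g (suc k) = begin
  (P ⊝ oneₚ) ⊗ (oneₚ ⊕ P ⊗ geom k P)             ≈⟨ solve 2 (λ p h → (p :- con (+ 1)) :* (con (+ 1) :+ p :* h)
                                                        := p :- con (+ 1) :+ p :* ((p :- con (+ 1)) :* h)) ≋-refl P (geom k P) ⟩
  P ⊝ oneₚ ⊕ P ⊗ ((P ⊝ oneₚ) ⊗ geom k P)         ≈⟨ +-cong ≋-refl (*-cong ≋-refl (geom-Xpow g k)) ⟩
  P ⊝ oneₚ ⊕ P ⊗ (Xpow (k ℕ.* g) ⊝ oneₚ)         ≈⟨ solve 2 (λ p h → p :- con (+ 1) :+ p :* (h :- con (+ 1))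
                                                        := p :* h :- con (+ 1)) ≋-refl P (Xpow (k ℕ.* g)) ⟩
  P ⊗ Xpow (k ℕ.* g) ⊝ oneₚ                      ≈⟨ +-cong (Xpow-+ g (k ℕ.* g)) ≋-refl ⟨
  Xpow (g ℕ.+ k ℕ.* g) ⊝ oneₚ                    ∎
  where
  open ≋-Reasoning
  open Solver
  P = Xpow g

-- Powers of p are 1 modulo p - 1, so the sum of k of them becomes the integer k. This is the origin
-- of most constants in the Bézout identities below.
geom-mod : ∀ k p → ∃ λ w → geom k p ⊝ w ⊗ (p ⊝ oneₚ) ≋ constₚ (+ k)
geom-mod zero    p = [] , ≋-trans (+-cong ≋-refl (-‿cong (zeroˡ _))) (≋-trans (-‿inverseʳ []) (≋-sym 0∷[]≋[]))
geom-mod (suc k) p with geom-mod k p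
... | w , e = w ⊕ geom k p , (begin
  oneₚ ⊕ p ⊗ geom k p ⊝ (w ⊕ geom k p) ⊗ (p ⊝ oneₚ)
    ≈⟨ solve 3 (λ p h w → con (+ 1) :+ p :* h :- (w :+ h) :* (p :- con (+ 1))
         := con (+ 1) :+ (h :- w :* (p :- con (+ 1)))) ≋-refl p (geom k p) w ⟩
  oneₚ ⊕ (geom k p ⊝ w ⊗ (p ⊝ oneₚ))  ≈⟨ +-cong ≋-refl e ⟩
  oneₚ ⊕ constₚ (+ k)                 ≈⟨ const-+ (+ 1) (+ k) ⟨
  constₚ (+ suc k)                    ∎)
  where open ≋-Reasoning
        open Solver

Xpow-1-∣ : ∀ {d n} → d ℕ∣.∣ n → Xpow d ⊝ oneₚ ∣ᵖ Xpow n ⊝ oneₚ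
Xpow-1-∣ {d} (ℕ∣.divides k refl) = geom k (Xpow d) , geom-Xpow d k

XpowBézout : ℕ → ℕ → ℕ → Set
XpowBézout g m n = ∃ λ u → ∃ λ v → u ⊗ (Xpow m ⊝ oneₚ) ⊕ v ⊗ (Xpow n ⊝ oneₚ) ≋ Xpow g ⊝ oneₚ

-- If x m = g + y n, then (q^{xm} - 1) - q^g (q^{yn} - 1) = q^g - 1. No integer factor is lost here,
-- unlike for general pairs of polynomials.
Xpow-bézout : ∀ m n → XpowBézout (gcd m n) m n
Xpow-bézout m n with Bézout.identity (gcd-GCD m n)
... | Bézout.+- x y e = geom x M , ⊖ (Xpow g ⊗ geom y N) , (begin
  geom x M ⊗ (M ⊝ oneₚ) ⊕ ⊖ (Xpow g ⊗ geom y N) ⊗ (N ⊝ oneₚ)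
    ≈⟨ solve 5 (λ a m G b n → a :* m :+ :- (G :* b) :* n := m :* a :- G :* (n :* b)) ≋-refl
         (geom x M) (M ⊝ oneₚ) (Xpow g) (geom y N) (N ⊝ oneₚ) ⟩
  (M ⊝ oneₚ) ⊗ geom x M ⊝ Xpow g ⊗ ((N ⊝ oneₚ) ⊗ geom y N)
    ≈⟨ +-cong (≋-trans (geom-Xpow m x) (+-cong (≋-trans (≋-reflexive (cong Xpow (≡.sym e))) (Xpow-+ g (y ℕ.* n))) ≋-refl))
              (-‿cong (*-cong ≋-refl (geom-Xpow n y))) ⟩
  Xpow g ⊗ Xpow (y ℕ.* n) ⊝ oneₚ ⊝ Xpow g ⊗ (Xpow (y ℕ.* n) ⊝ oneₚ)
    ≈⟨ solve 2 (λ g b → g :* b :- con (+ 1) :- g :* (b :- con (+ 1)) := g :- con (+ 1)) ≋-refl (Xpow g) (Xpow (y ℕ.* n)) ⟩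
  Xpow g ⊝ oneₚ ∎)
  where
  open ≋-Reasoning
  open Solver
  g = gcd m n
  M = Xpow m
  N = Xpow n
... | Bézout.-+ x y e = ⊖ (Xpow g ⊗ geom x M) , geom y N , (begin
  ⊖ (Xpow g ⊗ geom x M) ⊗ (M ⊝ oneₚ) ⊕ geom y N ⊗ (N ⊝ oneₚ)
    ≈⟨ solve 5 (λ a m G b n → :- (G :* a) :* m :+ b :* n := n :* b :- G :* (m :* a)) ≋-refl
         (geom x M) (M ⊝ oneₚ) (Xpow g) (geom y N) (N ⊝ oneₚ) ⟩
  (N ⊝ oneₚ) ⊗ geom y N ⊝ Xpow g ⊗ ((M ⊝ oneₚ) ⊗ geom x M)
    ≈⟨ +-cong (≋-trans (geom-Xpow n y) (+-cong (≋-trans (≋-reflexive (cong Xpow (≡.sym e))) (Xpow-+ g (x ℕ.* m))) ≋-refl))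
              (-‿cong (*-cong ≋-refl (geom-Xpow m x))) ⟩
  Xpow g ⊗ Xpow (x ℕ.* m) ⊝ oneₚ ⊝ Xpow g ⊗ (Xpow (x ℕ.* m) ⊝ oneₚ)
    ≈⟨ solve 2 (λ g b → g :* b :- con (+ 1) :- g :* (b :- con (+ 1)) := g :- con (+ 1)) ≋-refl (Xpow g) (Xpow (x ℕ.* m)) ⟩
  Xpow g ⊝ oneₚ ∎)
  where
  open ≋-Reasoning
  open Solver
  g = gcd m n
  M = Xpow m
  N = Xpow n

MonicList-Xpow-1 : ∀ n → 1 ≤ n → MonicList n (Xpow n -ₚ oneₚ)
MonicList-Xpow-1 (suc n) _ = monicList
  (≡.trans (length-+ₚ (Xpow (suc n)) (negₚ oneₚ)) (cong suc (≡.trans (ℕₚ.⊔-identityʳ _) (length-Xpow n))))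
  (≡.trans (coeff-- (Xpow (suc n)) oneₚ (suc n)) (≡.trans (ℤₚ.+-identityʳ _) (coeff-Xpow n)))
  where
  length-Xpow : ∀ n → length (Xpow n) ≡ suc n
  length-Xpow zero    = refl
  length-Xpow (suc n) = cong suc (length-Xpow n)
  coeff-Xpow : ∀ n → coeff (Xpow n) n ≡ + 1
  coeff-Xpow zero    = refl
  coeff-Xpow (suc n) = coeff-Xpow n

∈-properDivisors⁻ : ∀ n {d} → d ∈ properDivisors n → 1 ≤ d × d < n × d ℕ∣.∣ n
∈-properDivisors⁻ n d∈ with ∈-filter⁻ (ℕ∣._∣? n) {xs = map suc (upTo (n ∸ 1))} d∈
... | d∈′ , d∣n with ∈-map⁻ suc d∈′
...   | e , e∈ , refl = s≤s z≤n , suc<n n (∈-upTo⁻ e∈) , d∣n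
  where
  suc<n : ∀ n → e < n ∸ 1 → suc e < n
  suc<n (suc n) e<n = s≤s e<n

∈-properDivisors⁺ : ∀ {d n} → 1 ≤ d → d < n → d ℕ∣.∣ n → d ∈ properDivisors n
∈-properDivisors⁺ {suc d} {suc n} _ (s≤s d<n) d∣n = ∈-filter⁺ (ℕ∣._∣? suc n) (∈-map⁺ suc (∈-upTo⁺ d<n)) d∣n

properDivisors-unique : ∀ n → Unique (properDivisors n)
properDivisors-unique n = Uniqueₚ.filter⁺ (ℕ∣._∣? n) (Uniqueₚ.map⁺ ℕₚ.suc-injective (Uniqueₚ.upTo⁺ (n ∸ 1)))

-- Inside `Φ n` the factors for d are computed with fuel n - 1, whereas `Φ d` has fuel d. Both
-- suffice, because the recursion descends to proper divisors.
cycFuel-irrelevant : ∀ fu fu′ n → 1 ≤ n → n ≤ fu → n ≤ fu′ → cycFuel fu n ≡ cycFuel fu′ n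
cycFuel-irrelevant zero     fu′       n 1≤n n≤0 _   = ⊥-elim (ℕₚ.<⇒≱ 1≤n n≤0)
cycFuel-irrelevant (suc fu) zero      n 1≤n _ n≤0   = ⊥-elim (ℕₚ.<⇒≱ 1≤n n≤0)
cycFuel-irrelevant (suc fu) (suc fu′) n 1≤n le le′ =
  cong (λ ps → divMonic (Xpow n -ₚ oneₚ) (prodₚ ps)) (Listₚ.map-cong-local (All.tabulate λ d∈ →
    let (1≤d , d<n , _) = ∈-properDivisors⁻ n d∈ in
    cycFuel-irrelevant fu fu′ _ 1≤d (ℕₚ.≤-pred (ℕₚ.≤-trans d<n le)) (ℕₚ.≤-pred (ℕₚ.≤-trans d<n le′))))

ΠΦ : List ℕ → Poly
ΠΦ ds = prodₚ (map Φ ds)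

Φ-unfold : ∀ n → 1 ≤ n → Φ n ≡ divMonic (Xpow n -ₚ oneₚ) (ΠΦ (properDivisors n))
Φ-unfold (suc n) _ = cong (λ ps → divMonic (Xpow (suc n) -ₚ oneₚ) (prodₚ ps)) (Listₚ.map-cong-local (All.tabulate λ {d} d∈ →
  let (1≤d , d<n , _) = ∈-properDivisors⁻ (suc n) d∈ in cycFuel-irrelevant n d d 1≤d (ℕₚ.≤-pred d<n) ℕₚ.≤-refl))

factor-∣-ΠΦ : ∀ {d ds} → d ∈ ds → Φ d ∣ᵖ ΠΦ ds
factor-∣-ΠΦ {ds = d ∷ ds} (here refl) = ∣ᵖ-respʳ (≋-reflexive (≡.sym (*ₚ≡⊗ (Φ d) _))) (∣ᵖ-⊗ʳ _ ∣ᵖ-refl)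
factor-∣-ΠΦ {ds = d ∷ ds} (there d∈)  = ∣ᵖ-respʳ (≋-reflexive (≡.sym (*ₚ≡⊗ (Φ d) _))) (∣ᵖ-⊗ˡ (Φ d) (factor-∣-ΠΦ d∈))

Coprime-ΠΦ : ∀ {f} ds → (∀ {d} → d ∈ ds → Coprime f (Φ d)) → Coprime f (ΠΦ ds)
Coprime-ΠΦ {f} []       _ = Coprime-1 f
Coprime-ΠΦ (d ∷ ds) h = Coprime-respʳ (≋-reflexive (≡.sym (*ₚ≡⊗ (Φ d) _)))
  (Coprime-⊗ (h (here refl)) (Coprime-ΠΦ ds (h ∘ there)))

MonicList-ΠΦ : ∀ ds → (∀ {d} → d ∈ ds → ∃ λ k → MonicList k (Φ d)) → ∃ λ k → MonicList k (ΠΦ ds)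
MonicList-ΠΦ []       _ = 0 , MonicList-1
MonicList-ΠΦ (d ∷ ds) h = _ , MonicList-*ₚ (proj₂ (h (here refl))) (proj₂ (MonicList-ΠΦ ds (h ∘ there)))

ΠΦ-∣ : ∀ {p} ds → Unique ds → (∀ {d} → d ∈ ds → ∃ λ k → MonicList k (Φ d)) →
  (∀ {d e} → d ∈ ds → e ∈ ds → d ≢ e → Coprime (Φ d) (Φ e)) →
  (∀ {d} → d ∈ ds → Φ d ∣ᵖ p) → ΠΦ ds ∣ᵖ p
ΠΦ-∣ {p} []       _        _  _   _   = p , *-identityˡ p
ΠΦ-∣ {p} (d ∷ ds) (d∉ ∷ u) ms cop div = subst (_∣ᵖ p) (≡.sym (*ₚ≡⊗ (Φ d) (ΠΦ ds)))
  (coprime-product-∣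
    (subst (Monic _) (*ₚ≡⊗ (Φ d) (ΠΦ ds)) (MonicList⇒Monic (proj₂ (MonicList-ΠΦ (d ∷ ds) ms))))
    (Coprime-ΠΦ ds λ e∈ → cop (here refl) (there e∈) (All.lookup d∉ e∈))
    (div (here refl))
    (ΠΦ-∣ ds u (ms ∘ there) (λ d∈ e∈ → cop (there d∈) (there e∈)) (div ∘ there)))

-- The fields are bundled because their proofs are entangled: `factors` at n needs coprimality of
-- the `Φ d` for the proper divisors d, and `coprimeΦ` at n needs `factors` at n and at e.
record Cyclotomic (n : ℕ) : Set where
  field
    monicΦ   : ∃ λ k → MonicList k (Φ n)
    factors  : Φ n ⊗ ΠΦ (properDivisors n) ≋ Xpow n ⊝ oneₚ
    coprimeΦ : ∀ e → 1 ≤ e → e < n → Coprime (Φ n) (Φ e)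

  Φ-∣ : Φ n ∣ᵖ Xpow n ⊝ oneₚ
  Φ-∣ = ΠΦ (properDivisors n) , factors

divides-cofactor : ∀ {a f p h} → ¬ a ≋ [] → a ∣ᵖ p → f ⊗ p ≋ a ⊗ h → f ∣ᵖ h
divides-cofactor {a} {f} {p} {h} a≢0 (s , as) e = s , ⊗-cancelˡ a≢0 (begin
  a ⊗ (f ⊗ s)  ≈⟨ solve 3 (λ a f s → a :* (f :* s) := f :* (a :* s)) ≋-refl a f s ⟩
  f ⊗ (a ⊗ s)  ≈⟨ *-cong ≋-refl as ⟩
  f ⊗ p        ≈⟨ e ⟩
  a ⊗ h        ∎)
  where open ≋-Reasoning
        open Solver

Xpow-1≢0 : ∀ n → 1 ≤ n → ¬ Xpow n ⊝ oneₚ ≋ []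
Xpow-1≢0 n 1≤n = subst (λ p → ¬ p ≋ []) (-ₚ≡⊝ (Xpow n) oneₚ) (Monic⇒≢0 (MonicList⇒Monic (MonicList-Xpow-1 n 1≤n)))

∣ᵖ-respˡ : ∀ {d e p} → d ≋ e → d ∣ᵖ p → e ∣ᵖ p
∣ᵖ-respˡ e (s , f) = s , ≋-trans (*-cong (≋-sym e) ≋-refl) f

coprimeΦ-≢ : ∀ {d e} → Cyclotomic d → Cyclotomic e → 1 ≤ d → 1 ≤ e → d ≢ e → Coprime (Φ d) (Φ e)
coprimeΦ-≢ {d} {e} cd ce 1≤d 1≤e d≢e with ℕₚ.<-cmp d e
... | tri< d<e _ _ = Coprime-sym (Cyclotomic.coprimeΦ ce d 1≤d d<e)
... | tri≈ _ d≡e _ = ⊥-elim (d≢e d≡e)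
... | tri> _ _ e<d = Cyclotomic.coprimeΦ cd e 1≤e e<d

-- The divisors of g are proper divisors of n, so q^g - 1 divides the product of the `Φ d` that
-- accompanies Φ_n in q^n - 1. Cancelling it leaves Φ_n as a divisor of (q^n - 1)/(q^g - 1). The
-- hypotheses are what the induction provides midway through its step at n.
Φ-∣-quotient : ∀ g n k → (∀ d → 1 ≤ d → d < n → Cyclotomic d) →
  Φ n ⊗ ΠΦ (properDivisors n) ≋ Xpow n ⊝ oneₚ → 1 ≤ g → g < n → n ≡ k ℕ.* g → Φ n ∣ᵖ geom k (Xpow g)
Φ-∣-quotient g n k cyc factors 1≤g g<n n≡kg =
  divides-cofactor (Xpow-1≢0 g 1≤g) (∣ᵖ-respˡ ΠΦds≋ ΠΦds∣) (≋-trans factors (≋-sym quotient))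
  where
  ds = g ∷ properDivisors g
  uniq : Unique ds
  uniq = All.tabulate (λ d∈ g≡d → ℕₚ.<-irrefl (≡.sym g≡d) (proj₁ (proj₂ (∈-properDivisors⁻ g d∈)))) ∷ properDivisors-unique g
  proper : ∀ {d} → d ∈ ds → d ∈ properDivisors n
  proper (here refl) = ∈-properDivisors⁺ 1≤g g<n (ℕ∣.divides k n≡kg)
  proper (there d∈)  = let (1≤d , d<g , d∣g) = ∈-properDivisors⁻ g d∈ in
    ∈-properDivisors⁺ 1≤d (ℕₚ.<-trans d<g g<n) (ℕ∣.∣-trans d∣g (ℕ∣.divides k n≡kg))
  pos : ∀ {d} → d ∈ ds → 1 ≤ d
  pos d∈ = proj₁ (∈-properDivisors⁻ n (proper d∈))
  cyc-ds : ∀ {d} → d ∈ ds → Cyclotomic d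
  cyc-ds d∈ = cyc _ (pos d∈) (proj₁ (proj₂ (∈-properDivisors⁻ n (proper d∈))))
  ΠΦds∣ : ΠΦ ds ∣ᵖ ΠΦ (properDivisors n)
  ΠΦds∣ = ΠΦ-∣ ds uniq (λ d∈ → Cyclotomic.monicΦ (cyc-ds d∈))
    (λ d∈ e∈ → coprimeΦ-≢ (cyc-ds d∈) (cyc-ds e∈) (pos d∈) (pos e∈)) (λ d∈ → factor-∣-ΠΦ (proper d∈))
  ΠΦds≋ : ΠΦ ds ≋ Xpow g ⊝ oneₚ
  ΠΦds≋ = ≋-trans (≋-reflexive (*ₚ≡⊗ (Φ g) (ΠΦ (properDivisors g)))) (Cyclotomic.factors (cyc g 1≤g g<n))
  quotient : (Xpow g ⊝ oneₚ) ⊗ geom k (Xpow g) ≋ Xpow n ⊝ oneₚ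
  quotient = ≋-trans (geom-Xpow g k) (≋-reflexive (cong (λ m → Xpow m ⊝ oneₚ) (≡.sym n≡kg)))

cyclotomic : ∀ n → 1 ≤ n → Cyclotomic n
cyclotomic = <-rec (λ n → 1 ≤ n → Cyclotomic n) λ n rec 1≤n → step n (λ d 1≤d d<n → rec d<n 1≤d) 1≤n
  where
  step : ∀ n → (∀ d → 1 ≤ d → d < n → Cyclotomic d) → 1 ≤ n → Cyclotomic n
  step n cyc 1≤n = record
    { monicΦ = _ , subst (MonicList _) (≡.sym (Φ-unfold n 1≤n)) (proj₁ exact)
    ; factors = factors
    ; coprimeΦ = cop′ }
    where
    pd = properDivisors n
    cycΦ : ∀ {d} → d ∈ pd → Cyclotomic d
    cycΦ d∈ = let (1≤d , d<n , _) = ∈-properDivisors⁻ n d∈ in cyc _ 1≤d d<n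
    cop : ∀ {d e} → d ∈ pd → e ∈ pd → d ≢ e → Coprime (Φ d) (Φ e)
    cop d∈ e∈ = coprimeΦ-≢ (cycΦ d∈) (cycΦ e∈) (proj₁ (∈-properDivisors⁻ n d∈)) (proj₁ (∈-properDivisors⁻ n e∈))
    exact = divMonic-exact (MonicList-Xpow-1 n 1≤n)
      (proj₂ (MonicList-ΠΦ pd (Cyclotomic.monicΦ ∘ cycΦ)))
      (∣ᵖ-respʳ (≋-reflexive (≡.sym (-ₚ≡⊝ (Xpow n) oneₚ)))
        (ΠΦ-∣ pd (properDivisors-unique n) (Cyclotomic.monicΦ ∘ cycΦ) cop λ d∈ →
          ∣ᵖ-trans (Cyclotomic.Φ-∣ (cycΦ d∈)) (Xpow-1-∣ (proj₂ (proj₂ (∈-properDivisors⁻ n d∈))))))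
    factors : Φ n ⊗ ΠΦ pd ≋ Xpow n ⊝ oneₚ
    factors = ≋-trans (*-comm (Φ n) _) (≋-trans
      (≋-reflexive (cong (ΠΦ pd ⊗_) (Φ-unfold n 1≤n)))
      (≋-trans (proj₂ exact) (≋-reflexive (-ₚ≡⊝ (Xpow n) oneₚ))))
    -- With g = gcd(n, e) and n = k g, Φ_n divides `geom k (Xpow g)`, which is k modulo q^g - 1. And
    -- q^g - 1 is a combination of q^n - 1 and q^e - 1, which are multiples of Φ_n and Φ_e. What
    -- remains is the constant k.
    cop′ : ∀ e → 1 ≤ e → e < n → Coprime (Φ n) (Φ e)
    cop′ e 1≤e e<n = s ⊝ w ⊗ u ⊗ ΠΦ pd , ⊖ (w ⊗ v ⊗ ΠΦ (properDivisors e)) , + k , k≢0 , (begin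
      (s ⊝ w ⊗ u ⊗ ΠΦ pd) ⊗ Φ n ⊕ ⊖ (w ⊗ v ⊗ ΠΦ (properDivisors e)) ⊗ Φ e
        ≈⟨ solve 8 (λ s w u v a b f h → (s :- w :* u :* a) :* f :+ :- (w :* v :* b) :* h
             := f :* s :- w :* (u :* (f :* a) :+ v :* (h :* b))) ≋-refl s w u v (ΠΦ pd) (ΠΦ (properDivisors e)) (Φ n) (Φ e) ⟩
      Φ n ⊗ s ⊝ w ⊗ (u ⊗ (Φ n ⊗ ΠΦ pd) ⊕ v ⊗ (Φ e ⊗ ΠΦ (properDivisors e)))
        ≈⟨ +-cong (proj₂ Φ∣geom) (-‿cong (*-cong ≋-refl (+-cong (*-cong ≋-refl factors)
             (*-cong ≋-refl (Cyclotomic.factors (cyc e 1≤e e<n)))))) ⟩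
      geom k (Xpow g) ⊝ w ⊗ (u ⊗ (Xpow n ⊝ oneₚ) ⊕ v ⊗ (Xpow e ⊝ oneₚ))
        ≈⟨ +-cong ≋-refl (-‿cong (*-cong ≋-refl (proj₂ (proj₂ bez)))) ⟩
      geom k (Xpow g) ⊝ w ⊗ (Xpow g ⊝ oneₚ)
        ≈⟨ proj₂ (geom-mod k (Xpow g)) ⟩
      constₚ (+ k) ∎)
      where
      open ≋-Reasoning
      open Solver
      g = gcd n e
      g∣n = gcd[m,n]∣m n e
      k = ℕ∣.quotient g∣n
      n≡kg : n ≡ k ℕ.* g
      n≡kg = ℕ∣._∣_.equality g∣n
      1≤g : 1 ≤ g
      1≤g = ℕₚ.n≢0⇒n>0 (gcd[m,n]≢0 n e (inj₁ (λ { refl → ℕₚ.<⇒≱ 1≤n z≤n })))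
      g<n : g < n
      g<n = ℕₚ.≤-<-trans (gcd[m,n]≤n n e {{ℕ.>-nonZero 1≤e}}) e<n
      k≢0 : + k ≢ + 0
      k≢0 eq = ℕₚ.<⇒≱ 1≤n (ℕₚ.≤-reflexive (≡.trans n≡kg (cong (ℕ._* g) (ℤₚ.+-injective eq))))
      Φ∣geom = Φ-∣-quotient g n k cyc factors 1≤g g<n n≡kg
      s = proj₁ Φ∣geom
      bez = Xpow-bézout n e
      u = proj₁ bez
      v = proj₁ (proj₂ bez)
      w = proj₁ (geom-mod k (Xpow g))

Φ-∣-geom : ∀ g k → 1 ≤ g → g < k ℕ.* g → Φ (k ℕ.* g) ∣ᵖ geom k (Xpow g)
Φ-∣-geom g k 1≤g g<kg = Φ-∣-quotient g (k ℕ.* g) k (λ d 1≤d _ → cyclotomic d 1≤d)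
  (Cyclotomic.factors (cyclotomic (k ℕ.* g) (ℕₚ.≤-trans 1≤g (ℕₚ.<⇒≤ g<kg)))) 1≤g g<kg refl

-- Polynomials coprime to [n]

1-q^_ : ℕ → Poly
1-q^ k = oneₚ ⊝ Xpow k

1+q^_ : ℕ → Poly
1+q^ k = oneₚ ⊕ Xpow k

1-q^-neg : ∀ k → 1-q^ k ≋ ⊖ (Xpow k ⊝ oneₚ)
1-q^-neg k = solve 1 (λ x → con (+ 1) :- x := :- (x :- con (+ 1))) ≋-refl (Xpow k)
  where open Solver

1-q^-nonzero : ∀ k → 1 ≤ k → ¬ 1-q^ k ≋ []
1-q^-nonzero k 1≤k e = Xpow-1≢0 k 1≤k (≋-trans
  (solve 1 (λ x → x :- con (+ 1) := :- (con (+ 1) :- x)) ≋-refl (Xpow k))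
  (≋-trans (-‿cong e) (≋-trans (≋-sym (+-identityˡ _)) (-‿inverseʳ []))))
  where open Solver

qint≋geom : ∀ n → qint n ≋ geom n X
qint≋geom zero    = ≋-refl
qint≋geom (suc n) = ≋-trans (horner (+ 1) (qint n)) (+-cong ≋-refl (*-cong ≋-refl (qint≋geom n)))

qint-factor : ∀ n → (oneₚ ⊝ X) ⊗ qint n ≋ 1-q^ n
qint-factor n = begin
  (oneₚ ⊝ X) ⊗ qint n            ≈⟨ *-cong (1-q^-neg 1) (qint≋geom n) ⟩
  ⊖ (X ⊝ oneₚ) ⊗ geom n X        ≈⟨ solve 2 (λ x g → :- x :* g := :- (x :* g)) ≋-refl (X ⊝ oneₚ) (geom n X) ⟩
  ⊖ ((X ⊝ oneₚ) ⊗ geom n X)      ≈⟨ -‿cong (geom-Xpow 1 n) ⟩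
  ⊖ (Xpow (n ℕ.* 1) ⊝ oneₚ)      ≡⟨ cong (λ k → ⊖ (Xpow k ⊝ oneₚ)) (ℕₚ.*-identityʳ n) ⟩
  ⊖ (Xpow n ⊝ oneₚ)              ≈⟨ 1-q^-neg n ⟨
  1-q^ n                         ∎
  where open ≋-Reasoning
        open Solver

MonicList-qint : ∀ n → MonicList n (qint (suc n))
MonicList-qint zero    = monicList refl refl
MonicList-qint (suc n) = monicList (cong suc (MonicList.size (MonicList-qint n))) (MonicList.last (MonicList-qint n))

Coprime-∣ˡ : ∀ {f g h} → g ∣ᵖ h → Coprime h f → Coprime g f
Coprime-∣ˡ d c = Coprime-sym (Coprime-∣ d (Coprime-sym c))

Coprime-⊗ˡ : ∀ {f g h} → Coprime f h → Coprime g h → Coprime (f ⊗ g) h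
Coprime-⊗ˡ c d = Coprime-sym (Coprime-⊗ (Coprime-sym c) (Coprime-sym d))

Coprime-1ˡ : ∀ f → Coprime oneₚ f
Coprime-1ˡ f = Coprime-sym (Coprime-1 f)

Coprime-X-qint : ∀ n → 1 ≤ n → Coprime X (qint n)
Coprime-X-qint (suc n) _ = ⊖ qint n , oneₚ , + 1 , 1≢0 , (begin
  ⊖ qint n ⊗ X ⊕ oneₚ ⊗ qint (suc n)            ≈⟨ +-cong ≋-refl (*-cong ≋-refl (horner (+ 1) (qint n))) ⟩
  ⊖ qint n ⊗ X ⊕ oneₚ ⊗ (oneₚ ⊕ X ⊗ qint n)     ≈⟨ solve 2 (λ g x → :- g :* x :+ con (+ 1) :* (con (+ 1) :+ x :* g) := con (+ 1))
                                                      ≋-refl (qint n) X ⟩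
  oneₚ ∎)
  where open ≋-Reasoning
        open Solver

qint-mod : ∀ n → ∃ λ w → qint n ⊝ w ⊗ (X ⊝ oneₚ) ≋ constₚ (+ n)
qint-mod n = let (w , e) = geom-mod n X in w , ≋-trans (+-cong (qint≋geom n) ≋-refl) e

+-nonzero : ∀ {n} → 1 ≤ n → + n ≢ + 0
+-nonzero 1≤n e = ℕₚ.<⇒≱ 1≤n (ℕₚ.≤-reflexive (ℤₚ.+-injective e))

Xpow-1-factor : ∀ n → (X ⊝ oneₚ) ⊗ qint n ≋ Xpow n ⊝ oneₚ
Xpow-1-factor n = ≋-trans (*-cong ≋-refl (qint≋geom n))
  (≋-trans (geom-Xpow 1 n) (≋-reflexive (cong (λ k → Xpow k ⊝ oneₚ) (ℕₚ.*-identityʳ n))))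

-- For coprime j and n, q^j - 1 and q^n - 1 = (q - 1) [n] generate q - 1, and [n] is the integer n
-- modulo q - 1.
Coprime-1-q^-qint : ∀ j n → 1 ≤ n → gcd j n ≡ 1 → Coprime (1-q^ j) (qint n)
Coprime-1-q^-qint j n 1≤n gcd≡1 with subst (λ g → XpowBézout g j n) gcd≡1 (Xpow-bézout j n) | qint-mod n
... | u , v , e | w , f = w ⊗ u , oneₚ ⊝ w ⊗ v ⊗ (X ⊝ oneₚ) , + n , +-nonzero 1≤n , (begin
  w ⊗ u ⊗ 1-q^ j ⊕ (oneₚ ⊝ w ⊗ v ⊗ (X ⊝ oneₚ)) ⊗ qint n
    ≈⟨ solve 6 (λ w u v x g j → w :* u :* (con (+ 1) :- j) :+ (con (+ 1) :- w :* v :* x) :* g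
         := g :- w :* (u :* (j :- con (+ 1)) :+ v :* (x :* g))) ≋-refl w u v (X ⊝ oneₚ) (qint n) (Xpow j) ⟩
  qint n ⊝ w ⊗ (u ⊗ (Xpow j ⊝ oneₚ) ⊕ v ⊗ ((X ⊝ oneₚ) ⊗ qint n))
    ≈⟨ +-cong ≋-refl (-‿cong (*-cong ≋-refl (≋-trans (+-cong ≋-refl (*-cong ≋-refl (Xpow-1-factor n))) e))) ⟩
  qint n ⊝ w ⊗ (X ⊝ oneₚ)  ≈⟨ f ⟩
  constₚ (+ n) ∎)
  where open ≋-Reasoning
        open Solver

odd⇒2∤ : ∀ p → ¬ 2 ℕ∣.∣ suc (2 ℕ.* p)
odd⇒2∤ p d with ℕ∣.∣m+n∣m⇒∣n {2} {2 ℕ.* p} {1} (subst (2 ℕ∣.∣_) (ℕₚ.+-comm 1 (2 ℕ.* p)) d) (ℕ∣.m∣m*n p)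
... | 2∣1 with ℕ∣.∣1⇒≡1 2∣1
...   | ()

-- q^{2j} ≡ 1 and q^n ≡ 1 give q^g ≡ 1 with g = gcd(2j,n) odd, hence g ∣ j and 2 = (1 + q^j) − (q^j − 1).
Coprime-1+q^-qint : ∀ j p → Coprime (1+q^ j) (qint (suc (2 ℕ.* p)))
Coprime-1+q^-qint j p with Xpow-bézout (2 ℕ.* j) (suc (2 ℕ.* p)) | Xpow-1-∣ {gcd (2 ℕ.* j) (suc (2 ℕ.* p))} {j} g∣j
  where
  n = suc (2 ℕ.* p)
  g = gcd (2 ℕ.* j) n
  g-coprime-2 : ℕCoprime.Coprime g 2
  g-coprime-2 {d} (d∣g , d∣2) with prime⇒irreducible prime[2] d∣2
  ... | inj₁ d≡1 = d≡1
  ... | inj₂ refl = ⊥-elim (odd⇒2∤ p (ℕ∣.∣-trans d∣g (gcd[m,n]∣n (2 ℕ.* j) n)))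
  g∣j : g ℕ∣.∣ j
  g∣j = coprime-divisor {g} {2} {j} g-coprime-2 (gcd[m,n]∣m (2 ℕ.* j) n)
... | u , v , e | h , f =
  oneₚ ⊝ h ⊗ u ⊗ (y ⊝ oneₚ) , ⊖ (h ⊗ v ⊗ (X ⊝ oneₚ)) , + 2 , (λ ()) , (begin
  (oneₚ ⊝ h ⊗ u ⊗ (y ⊝ oneₚ)) ⊗ (oneₚ ⊕ y) ⊕ ⊖ (h ⊗ v ⊗ (X ⊝ oneₚ)) ⊗ qint n
    ≈⟨ solve 6 (λ h u v y x g → (con (+ 1) :- h :* u :* (y :- con (+ 1))) :* (con (+ 1) :+ y) :+ :- (h :* v :* x) :* g
         := con (+ 1) :+ y :- (u :* (y :* y :- con (+ 1)) :+ v :* (x :* g)) :* h) ≋-refl h u v y (X ⊝ oneₚ) (qint n) ⟩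
  oneₚ ⊕ y ⊝ (u ⊗ (y ⊗ y ⊝ oneₚ) ⊕ v ⊗ ((X ⊝ oneₚ) ⊗ qint n)) ⊗ h
    ≈⟨ +-cong ≋-refl (-‿cong (*-cong (+-cong (*-cong ≋-refl (+-cong y² ≋-refl)) (*-cong ≋-refl (Xpow-1-factor n))) ≋-refl)) ⟩
  oneₚ ⊕ y ⊝ (u ⊗ (Xpow (2 ℕ.* j) ⊝ oneₚ) ⊕ v ⊗ (Xpow n ⊝ oneₚ)) ⊗ h
    ≈⟨ +-cong ≋-refl (-‿cong (≋-trans (*-cong e ≋-refl) f)) ⟩
  oneₚ ⊕ y ⊝ (y ⊝ oneₚ)
    ≈⟨ solve 1 (λ y → con (+ 1) :+ y :- (y :- con (+ 1)) := con (+ 2)) ≋-refl y ⟩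
  constₚ (+ 2) ∎)
  where
  open ≋-Reasoning
  open Solver
  n = suc (2 ℕ.* p)
  y = Xpow j
  y² : y ⊗ y ≋ Xpow (2 ℕ.* j)
  y² = ≋-trans (≋-sym (Xpow-+ j j)) (≋-reflexive (cong (λ i → Xpow (j ℕ.+ i)) (≡.sym (ℕₚ.+-identityʳ j))))

-- q-shifted factorials and the central q-binomial coefficient

pochhammer : ℕ → ℕ → Poly
pochhammer a zero    = oneₚ
pochhammer a (suc k) = 1-q^ a ⊗ pochhammer (2 ℕ.+ a) k

pochhammer-suc : ∀ a k → pochhammer a (suc k) ≋ pochhammer a k ⊗ 1-q^ (a ℕ.+ 2 ℕ.* k)
pochhammer-suc a zero    = ≋-trans (*-comm _ _) (≋-reflexive (cong (λ i → oneₚ ⊗ 1-q^ i) (≡.sym (ℕₚ.+-identityʳ a))))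
pochhammer-suc a (suc k) = begin
  1-q^ a ⊗ pochhammer (2 ℕ.+ a) (suc k)                               ≈⟨ *-cong ≋-refl (pochhammer-suc (2 ℕ.+ a) k) ⟩
  1-q^ a ⊗ (pochhammer (2 ℕ.+ a) k ⊗ 1-q^ (2 ℕ.+ a ℕ.+ 2 ℕ.* k))      ≈⟨ *-assoc _ _ _ ⟨
  1-q^ a ⊗ pochhammer (2 ℕ.+ a) k ⊗ 1-q^ (2 ℕ.+ a ℕ.+ 2 ℕ.* k)        ≡⟨ cong (λ i → 1-q^ a ⊗ pochhammer (2 ℕ.+ a) k ⊗ 1-q^ i) shift ⟩
  1-q^ a ⊗ pochhammer (2 ℕ.+ a) k ⊗ 1-q^ (a ℕ.+ 2 ℕ.* suc k)          ∎
  where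
  open ≋-Reasoning
  open ℕSolver.+-*-Solver
  shift : 2 ℕ.+ a ℕ.+ 2 ℕ.* k ≡ a ℕ.+ 2 ℕ.* suc k
  shift = solve 2 (λ a k → con 2 :+ a :+ con 2 :* k := a :+ con 2 :* (con 1 :+ k)) refl a k

pochhammer-nonzero : ∀ a k → 1 ≤ a → ¬ pochhammer a k ≋ []
pochhammer-nonzero a zero    _   = const-nonzero 1≢0
pochhammer-nonzero a (suc k) 1≤a = ⊗-nonzero (1-q^-nonzero a 1≤a) (pochhammer-nonzero (2 ℕ.+ a) k (s≤s z≤n))

-- This is (q;q)_k, that is, the q-factorial times (1 - q)^k.
qfact : ℕ → Poly
qfact zero    = oneₚ
qfact (suc k) = qfact k ⊗ 1-q^ (suc k)

qfact-nonzero : ∀ k → ¬ qfact k ≋ []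
qfact-nonzero zero    = const-nonzero 1≢0
qfact-nonzero (suc k) = ⊗-nonzero (qfact-nonzero k) (1-q^-nonzero (suc k) (s≤s z≤n))

-- The q-Pascal rule: with A = q^{a+1} and B = q^{b+1}, 1 - A B = (1 - A) + A (1 - B). It produces
-- the quotient as a polynomial, with no appeal to divisibility.
qbinomial : ∀ a b → ∃ λ G → G ⊗ (qfact a ⊗ qfact b) ≋ qfact (a ℕ.+ b)
qbinomial zero    b       = oneₚ , ≋-trans (*-identityˡ _) (*-identityˡ _)
qbinomial (suc a) zero    = oneₚ , ≋-trans (*-identityˡ _) (≋-trans (*-identityʳ _)
  (≋-reflexive (cong qfact (≡.sym (ℕₚ.+-identityʳ (suc a))))))
qbinomial (suc a) (suc b) with qbinomial a (suc b) | qbinomial (suc a) b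
... | G , e | H , f = G ⊕ A ⊗ H , (begin
  (G ⊕ A ⊗ H) ⊗ (qfact a ⊗ (oneₚ ⊝ A) ⊗ (qfact b ⊗ (oneₚ ⊝ B)))
    ≈⟨ solve 6 (λ G H A B x y → (G :+ A :* H) :* (x :* (con (+ 1) :- A) :* (y :* (con (+ 1) :- B)))
         := (con (+ 1) :- A) :* (G :* (x :* (y :* (con (+ 1) :- B)))) :+ A :* (con (+ 1) :- B) :* (H :* (x :* (con (+ 1) :- A) :* y)))
         ≋-refl G H A B (qfact a) (qfact b) ⟩
  (oneₚ ⊝ A) ⊗ (G ⊗ (qfact a ⊗ qfact (suc b))) ⊕ A ⊗ (oneₚ ⊝ B) ⊗ (H ⊗ (qfact (suc a) ⊗ qfact b))
    ≈⟨ +-cong (*-cong ≋-refl (≋-trans e (≋-reflexive (cong qfact (ℕₚ.+-suc a b))))) (*-cong ≋-refl f) ⟩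
  (oneₚ ⊝ A) ⊗ N ⊕ A ⊗ (oneₚ ⊝ B) ⊗ N
    ≈⟨ solve 3 (λ A B N → (con (+ 1) :- A) :* N :+ A :* (con (+ 1) :- B) :* N := N :* (con (+ 1) :- A :* B)) ≋-refl A B N ⟩
  N ⊗ (oneₚ ⊝ A ⊗ B)                        ≈⟨ *-cong ≋-refl (+-cong ≋-refl (-‿cong (Xpow-+ (suc a) (suc b)))) ⟨
  N ⊗ 1-q^ (suc a ℕ.+ suc b)                ≡⟨ cong (λ i → qfact i ⊗ 1-q^ (suc a ℕ.+ suc b)) (ℕₚ.+-suc a b) ⟨
  qfact (suc a ℕ.+ suc b)                   ∎)
  where
  open ≋-Reasoning
  open Solver
  A = Xpow (suc a)
  B = Xpow (suc b)
  N = qfact (suc (a ℕ.+ b))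

plusPochhammer : ℕ → Poly
plusPochhammer zero    = oneₚ
plusPochhammer (suc k) = plusPochhammer k ⊗ 1+q^ (suc k)

difference-of-squares : ∀ k → 1-q^ (2 ℕ.* k) ≋ 1-q^ k ⊗ 1+q^ k
difference-of-squares k = ≋-trans
  (+-cong ≋-refl (-‿cong (≋-trans (≋-reflexive (cong (λ i → Xpow (k ℕ.+ i)) (ℕₚ.+-identityʳ k))) (Xpow-+ k k))))
  (solve 1 (λ x → con (+ 1) :- x :* x := (con (+ 1) :- x) :* (con (+ 1) :+ x)) ≋-refl (Xpow k))
  where open Solver

pochhammer-2 : ∀ k → pochhammer 2 k ≋ qfact k ⊗ plusPochhammer k
pochhammer-2 zero    = ≋-sym (*-identityˡ _)
pochhammer-2 (suc k) = begin
  pochhammer 2 (suc k)                                                ≈⟨ pochhammer-suc 2 k ⟩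
  pochhammer 2 k ⊗ 1-q^ (2 ℕ.+ 2 ℕ.* k)                               ≡⟨ cong (λ i → pochhammer 2 k ⊗ 1-q^ i) (≡.sym (ℕₚ.*-suc 2 k)) ⟩
  pochhammer 2 k ⊗ 1-q^ (2 ℕ.* suc k)                                 ≈⟨ *-cong (pochhammer-2 k) (difference-of-squares (suc k)) ⟩
  qfact k ⊗ plusPochhammer k ⊗ (1-q^ (suc k) ⊗ 1+q^ (suc k))          ≈⟨ solve 4 (λ a b c d → a :* b :* (c :* d) := a :* c :* (b :* d))
                                                                           ≋-refl _ _ _ _ ⟩
  qfact (suc k) ⊗ plusPochhammer (suc k)                              ∎
  where open ≋-Reasoning
        open Solver

qfact-even : ∀ k → qfact (2 ℕ.* k) ≋ pochhammer 1 k ⊗ pochhammer 2 k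
qfact-even zero    = ≋-sym (*-identityˡ _)
qfact-even (suc k) = begin
  qfact (2 ℕ.* suc k)                                     ≡⟨ cong qfact (ℕₚ.*-suc 2 k) ⟩
  qfact (2 ℕ.* k) ⊗ a ⊗ b                                 ≈⟨ *-cong (*-cong (qfact-even k) ≋-refl) ≋-refl ⟩
  pochhammer 1 k ⊗ pochhammer 2 k ⊗ a ⊗ b                 ≈⟨ solve 4 (λ x y a b → x :* y :* a :* b := x :* a :* (y :* b))
                                                               ≋-refl (pochhammer 1 k) (pochhammer 2 k) a b ⟩
  pochhammer 1 k ⊗ a ⊗ (pochhammer 2 k ⊗ b)               ≈⟨ *-cong (pochhammer-suc 1 k) (pochhammer-suc 2 k) ⟨
  pochhammer 1 (suc k) ⊗ pochhammer 2 (suc k)             ∎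
  where
  open ≋-Reasoning
  open Solver
  a = 1-q^ (1 ℕ.+ 2 ℕ.* k)
  b = 1-q^ (2 ℕ.+ 2 ℕ.* k)

-- (q;q²)_k / (q²;q²)_k is the central q-binomial coefficient divided by (−q;q)_k².
central-qbinomial : ∀ k → ∃ λ G → pochhammer 1 k ⊗ (plusPochhammer k ⊗ plusPochhammer k) ≋ G ⊗ pochhammer 2 k
central-qbinomial k with qbinomial k k
... | G , e = G , (begin
  u ⊗ (M ⊗ M)      ≈⟨ *-assoc u M M ⟨
  u ⊗ M ⊗ M        ≈⟨ *-cong cancelled ≋-refl ⟩
  G ⊗ Q ⊗ M        ≈⟨ *-assoc G Q M ⟩
  G ⊗ (Q ⊗ M)      ≈⟨ *-cong ≋-refl (pochhammer-2 k) ⟨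
  G ⊗ pochhammer 2 k ∎)
  where
  open ≋-Reasoning
  open Solver
  u = pochhammer 1 k
  M = plusPochhammer k
  Q = qfact k
  cancelled : u ⊗ M ≋ G ⊗ Q
  cancelled = ⊗-cancelˡ (qfact-nonzero k) (begin
    Q ⊗ (u ⊗ M)             ≈⟨ solve 3 (λ q u m → q :* (u :* m) := u :* (q :* m)) ≋-refl Q u M ⟩
    u ⊗ (Q ⊗ M)             ≈⟨ *-cong ≋-refl (pochhammer-2 k) ⟨
    u ⊗ pochhammer 2 k      ≈⟨ qfact-even k ⟨
    qfact (2 ℕ.* k)         ≡⟨ cong (λ i → qfact (k ℕ.+ i)) (ℕₚ.+-identityʳ k) ⟩
    qfact (k ℕ.+ k)         ≈⟨ e ⟨
    G ⊗ (Q ⊗ Q)             ≈⟨ solve 2 (λ g q → g :* (q :* q) := q :* (g :* q)) ≋-refl G Q ⟩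
    Q ⊗ (G ⊗ Q)             ∎)

Coprime-plusPochhammer : ∀ k p → Coprime (plusPochhammer k) (qint (suc (2 ℕ.* p)))
Coprime-plusPochhammer zero    p = Coprime-1ˡ _
Coprime-plusPochhammer (suc k) p = Coprime-⊗ˡ (Coprime-plusPochhammer k p) (Coprime-1+q^-qint (suc k) p)

-- Cancelling [3] (1 - q^{n+3})² against (1 - q^n)³

[3] : Poly
[3] = oneₚ ⊕ X ⊕ X ⊗ X

[3]-factor : (oneₚ ⊝ X) ⊗ [3] ≋ 1-q^ 3
[3]-factor = begin
  (oneₚ ⊝ X) ⊗ [3]        ≈⟨ solve 1 (λ x → (con (+ 1) :- x) :* (con (+ 1) :+ x :+ x :* x) := con (+ 1) :- x :* (x :* x)) ≋-refl X ⟩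
  oneₚ ⊝ X ⊗ (X ⊗ X)      ≈⟨ +-cong ≋-refl (-‿cong (≋-trans (Xpow-+ 1 2) (*-cong ≋-refl (Xpow-+ 1 1)))) ⟨
  1-q^ 3                  ∎
  where open ≋-Reasoning
        open Solver

-- If 3 ∣ n, then the denominator [3] (1 − q^{n+3})² is not coprime to [n]; its common factors with
-- (1 − q^n)³ cancel, and what remains of (1 − q^n)³ is still divisible by Φ_n².
record DenominatorSplit (n : ℕ) : Set where
  field
    h g κ   : Poly
    split   : 1-q^ n ⊗ 1-q^ n ⊗ 1-q^ n ⊗ g ≋ κ ⊗ (h ⊗ h) ⊗ ([3] ⊗ (1-q^ (3 ℕ.+ n) ⊗ 1-q^ (3 ℕ.+ n)))
    Φ∣h     : Φ n ∣ᵖ h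
    coprime : Coprime g (qint n)

-- Here 1 - q^n = (1 - q³) H and 1 - q^{n+3} = (1 - q³) g₀. Of (1 - q³)³ one factor pays for [3] and
-- two complete g₀² to (1 - q^{n+3})², leaving H³. Since [n] = [3] H, the coprimality of g₀ comes
-- from g₀ = 1 + q³ H and from g₀ being k + 1 modulo 1 - q³.
denominatorSplit-3∣ : ∀ n k → n ≡ k ℕ.* 3 → 3 < n → DenominatorSplit n
denominatorSplit-3∣ n k refl 3<n = record
  { h = H ; g = g₀ ⊗ g₀ ; κ = (oneₚ ⊝ X) ⊗ H
  ; split = begin
      Z ⊗ Z ⊗ Z ⊗ (g₀ ⊗ g₀)
        ≈⟨ *-cong (*-cong (*-cong Z≋ Z≋) Z≋) ≋-refl ⟩
      T ⊗ H ⊗ (T ⊗ H) ⊗ (T ⊗ H) ⊗ (g₀ ⊗ g₀)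
        ≈⟨ solve 3 (λ t h g → t :* h :* (t :* h) :* (t :* h) :* (g :* g) := t :* (h :* (h :* h) :* (t :* g :* (t :* g))))
             ≋-refl T H g₀ ⟩
      T ⊗ (H ⊗ (H ⊗ H) ⊗ (T ⊗ g₀ ⊗ (T ⊗ g₀)))
        ≈⟨ *-cong (≋-sym [3]-factor) (*-cong ≋-refl (*-cong (≋-sym Z′≋) (≋-sym Z′≋))) ⟩
      (oneₚ ⊝ X) ⊗ [3] ⊗ (H ⊗ (H ⊗ H) ⊗ (Z′ ⊗ Z′))
        ≈⟨ solve 4 (λ x s h z → x :* s :* (h :* (h :* h) :* (z :* z)) := x :* h :* (h :* h) :* (s :* (z :* z)))
             ≋-refl (oneₚ ⊝ X) [3] H Z′ ⟩
      (oneₚ ⊝ X) ⊗ H ⊗ (H ⊗ H) ⊗ ([3] ⊗ (Z′ ⊗ Z′)) ∎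
  -- For n = 3 the polynomial H would be 1; this is where n > 3 enters.
  ; Φ∣h = Φ-∣-geom 3 k (s≤s z≤n) 3<n
  ; coprime = Coprime-⊗ˡ coprime-g₀ coprime-g₀ }
  where
  open ≋-Reasoning
  open Solver
  H = geom k (Xpow 3)
  g₀ = geom (suc k) (Xpow 3)
  T = 1-q^ 3
  Z = 1-q^ (k ℕ.* 3)
  Z′ = 1-q^ (3 ℕ.+ k ℕ.* 3)
  geom-factor : ∀ j → 1-q^ (j ℕ.* 3) ≋ T ⊗ geom j (Xpow 3)
  geom-factor j = begin
    1-q^ (j ℕ.* 3)                              ≈⟨ 1-q^-neg (j ℕ.* 3) ⟩
    ⊖ (Xpow (j ℕ.* 3) ⊝ oneₚ)                   ≈⟨ -‿cong (geom-Xpow 3 j) ⟨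
    ⊖ ((Xpow 3 ⊝ oneₚ) ⊗ geom j (Xpow 3))       ≈⟨ solve 2 (λ x g → :- ((x :- con (+ 1)) :* g) := (con (+ 1) :- x) :* g)
                                                     ≋-refl (Xpow 3) (geom j (Xpow 3)) ⟩
    T ⊗ geom j (Xpow 3)                         ∎
  Z≋ = geom-factor k
  Z′≋ = geom-factor (suc k)
  qint≋ : [3] ⊗ H ≋ qint (k ℕ.* 3)
  qint≋ = ⊗-cancelˡ (1-q^-nonzero 1 (s≤s z≤n)) (begin
    (oneₚ ⊝ X) ⊗ ([3] ⊗ H)       ≈⟨ *-assoc _ _ _ ⟨
    (oneₚ ⊝ X) ⊗ [3] ⊗ H         ≈⟨ *-cong [3]-factor ≋-refl ⟩
    T ⊗ H                        ≈⟨ Z≋ ⟨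
    Z                            ≈⟨ qint-factor (k ℕ.* 3) ⟨
    (oneₚ ⊝ X) ⊗ qint (k ℕ.* 3)  ∎)
  coprime-H : Coprime g₀ H
  coprime-H = oneₚ , ⊖ Xpow 3 , + 1 , 1≢0 ,
    solve 2 (λ x h → con (+ 1) :* (con (+ 1) :+ x :* h) :+ :- x :* h := con (+ 1)) ≋-refl (Xpow 3) H
  coprime-[3] : Coprime g₀ [3]
  coprime-[3] with geom-mod (suc k) (Xpow 3)
  ... | w , e = oneₚ , w ⊗ (oneₚ ⊝ X) , + suc k , (λ ()) , (begin
    oneₚ ⊗ g₀ ⊕ w ⊗ (oneₚ ⊝ X) ⊗ [3]    ≈⟨ +-cong (*-identityˡ g₀) (≋-trans (*-assoc w _ _) (*-cong ≋-refl [3]-factor)) ⟩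
    g₀ ⊕ w ⊗ 1-q^ 3                     ≈⟨ solve 3 (λ g w x → g :+ w :* (con (+ 1) :- x) := g :- w :* (x :- con (+ 1)))
                                             ≋-refl g₀ w (Xpow 3) ⟩
    g₀ ⊝ w ⊗ (Xpow 3 ⊝ oneₚ)            ≈⟨ e ⟩
    constₚ (+ suc k)                    ∎)
  coprime-g₀ : Coprime g₀ (qint (k ℕ.* 3))
  coprime-g₀ = Coprime-respʳ qint≋ (Coprime-⊗ coprime-[3] coprime-H)

Φ-∣-qint : ∀ n → 1 < n → Φ n ∣ᵖ qint n
Φ-∣-qint n 1<n = ∣ᵖ-respʳ (≋-sym (qint≋geom n))
  (subst (λ m → Φ m ∣ᵖ geom n X) (ℕₚ.*-identityʳ n) (Φ-∣-geom 1 n (s≤s z≤n) (subst (1 <_) (≡.sym (ℕₚ.*-identityʳ n)) 1<n)))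

-- Now gcd(3, n) = gcd(n + 3, n) = 1, so the whole of [3] (1 - q^{n+3})² is coprime to [n] and
-- nothing has to cancel.
denominatorSplit-3∤ : ∀ n → ¬ 3 ℕ∣.∣ n → 3 < n → DenominatorSplit n
denominatorSplit-3∤ n 3∤n 3<n = record
  { h = qint n ; g = [3] ⊗ (Z′ ⊗ Z′) ; κ = (oneₚ ⊝ X) ⊗ (oneₚ ⊝ X) ⊗ (oneₚ ⊝ X) ⊗ qint n
  ; split = ≋-trans
      (*-cong (*-cong (*-cong Z≋ Z≋) Z≋) ≋-refl)
      (solve 3 (λ x g s → x :* g :* (x :* g) :* (x :* g) :* s := x :* x :* x :* g :* (g :* g) :* s)
        ≋-refl (oneₚ ⊝ X) (qint n) ([3] ⊗ (Z′ ⊗ Z′)))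
  ; Φ∣h = Φ-∣-qint n (ℕₚ.≤-trans (s≤s (s≤s z≤n)) 3<n)
  ; coprime = Coprime-⊗ˡ
      (Coprime-∣ˡ (oneₚ ⊝ X , ≋-trans (*-comm [3] _) [3]-factor) (Coprime-1-q^-qint 3 n 1≤n (coprime⇒gcd≡1 coprime-3)))
      (Coprime-⊗ˡ coprime-Z′ coprime-Z′) }
  where
  open Solver
  Z′ = 1-q^ (3 ℕ.+ n)
  1≤n = ℕₚ.≤-trans (s≤s z≤n) 3<n
  Z≋ = ≋-sym (qint-factor n)
  coprime-3 : ℕCoprime.Coprime 3 n
  coprime-3 (d∣3 , d∣n) with prime⇒irreducible (from-yes (prime? 3)) d∣3
  ... | inj₁ d≡1  = d≡1
  ... | inj₂ refl = ⊥-elim (3∤n d∣n)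
  coprime-Z′ = Coprime-1-q^-qint (3 ℕ.+ n) n 1≤n
    (coprime⇒gcd≡1 (subst (λ m → ℕCoprime.Coprime m n) (ℕₚ.+-comm n 3) (coprime-+ coprime-3)))

denominatorSplit : ∀ n → 3 < n → DenominatorSplit n
denominatorSplit n 3<n with 3 ℕ∣.∣? n
... | yes (ℕ∣.divides k n≡3k) = denominatorSplit-3∣ n k n≡3k 3<n
... | no 3∤n                  = denominatorSplit-3∤ n 3∤n 3<n

-- Values of fractions

-- The pairs built by `sumF` and `prodF` are never reduced. Proofs follow a convenient value a/b and
-- know of the actual denominator only that it is non-zero.
record HasValue (x : Frac) (a b : Poly) : Set where
  constructor hasValue
  field
    den≢0 : ¬ proj₂ x ≋ []
    cross : proj₁ x ⊗ b ≋ a ⊗ proj₂ x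

HasValue-resp : ∀ {x a b a′ b′} → ¬ b ≋ [] → a ⊗ b′ ≋ a′ ⊗ b → HasValue x a b → HasValue x a′ b′
HasValue-resp {N , D} {a} {b} {a′} {b′} b≢0 e (hasValue D≢0 c) = hasValue D≢0 (⊗-cancelˡ b≢0 (begin
  b ⊗ (N ⊗ b′)   ≈⟨ solve 3 (λ b n c → b :* (n :* c) := n :* b :* c) ≋-refl b N b′ ⟩
  N ⊗ b ⊗ b′     ≈⟨ *-cong c ≋-refl ⟩
  a ⊗ D ⊗ b′     ≈⟨ solve 3 (λ a d b → a :* d :* b := a :* b :* d) ≋-refl a D b′ ⟩
  a ⊗ b′ ⊗ D     ≈⟨ *-cong e ≋-refl ⟩
  a′ ⊗ b ⊗ D     ≈⟨ solve 3 (λ a b d → a :* b :* d := b :* (a :* d)) ≋-refl a′ b D ⟩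
  b ⊗ (a′ ⊗ D)   ∎))
  where open ≋-Reasoning
        open Solver

HasValue-≡ : ∀ {x y a b} → x ≡ y → HasValue x a b → HasValue y a b
HasValue-≡ refl v = v

HasValue-refl : ∀ a b → ¬ b ≋ [] → HasValue (a , b) a b
HasValue-refl a b b≢0 = hasValue b≢0 ≋-refl

HasValue-*f : ∀ {x y a b c d} → HasValue x a b → HasValue y c d → HasValue (x *f y) (a ⊗ c) (b ⊗ d)
HasValue-*f {N , D} {M , E} {a} {b} {c} {d} (hasValue D≢0 p) (hasValue E≢0 r) =
  HasValue-≡ (≡.sym (cong₂ _,_ (*ₚ≡⊗ N M) (*ₚ≡⊗ D E))) (hasValue (⊗-nonzero D≢0 E≢0) (begin
    N ⊗ M ⊗ (b ⊗ d)      ≈⟨ solve 4 (λ n m b d → n :* m :* (b :* d) := n :* b :* (m :* d)) ≋-refl N M b d ⟩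
    N ⊗ b ⊗ (M ⊗ d)      ≈⟨ *-cong p r ⟩
    a ⊗ D ⊗ (c ⊗ E)      ≈⟨ solve 4 (λ a d c e → a :* d :* (c :* e) := a :* c :* (d :* e)) ≋-refl a D c E ⟩
    a ⊗ c ⊗ (D ⊗ E)      ∎))
  where open ≋-Reasoning
        open Solver

HasValue-/f : ∀ {x y a b c d} → ¬ c ≋ [] → HasValue x a b → HasValue y c d → HasValue (x /f y) (a ⊗ d) (b ⊗ c)
HasValue-/f {N , D} {M , E} {a} {b} {c} {d} c≢0 (hasValue D≢0 p) (hasValue E≢0 r) =
  HasValue-≡ (≡.sym (cong₂ _,_ (*ₚ≡⊗ N E) (*ₚ≡⊗ D M))) (hasValue (⊗-nonzero D≢0 M≢0) (begin
    N ⊗ E ⊗ (b ⊗ c)      ≈⟨ solve 4 (λ n e b c → n :* e :* (b :* c) := n :* b :* (c :* e)) ≋-refl N E b c ⟩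
    N ⊗ b ⊗ (c ⊗ E)      ≈⟨ *-cong p (≋-sym r) ⟩
    a ⊗ D ⊗ (M ⊗ d)      ≈⟨ solve 4 (λ a d m e → a :* d :* (m :* e) := a :* e :* (d :* m)) ≋-refl a D M d ⟩
    a ⊗ d ⊗ (D ⊗ M)      ∎))
  where
  open ≋-Reasoning
  open Solver
  M≢0 : ¬ M ≋ []
  M≢0 M≋0 = ⊗-nonzero c≢0 E≢0 (≋-trans (≋-sym r) (≋-trans (*-cong M≋0 ≋-refl) (zeroˡ d)))

HasValue-+f : ∀ {x y a b c d} → HasValue x a b → HasValue y c d → HasValue (x +f y) (a ⊗ d ⊕ c ⊗ b) (b ⊗ d)
HasValue-+f {N , D} {M , E} {a} {b} {c} {d} (hasValue D≢0 p) (hasValue E≢0 r) =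
  HasValue-≡ (≡.sym (cong₂ _,_ (≡.trans (+ₚ≡⊕ _ _) (cong₂ _⊕_ (*ₚ≡⊗ N E) (*ₚ≡⊗ M D))) (*ₚ≡⊗ D E)))
  (hasValue (⊗-nonzero D≢0 E≢0) (begin
    (N ⊗ E ⊕ M ⊗ D) ⊗ (b ⊗ d)
      ≈⟨ solve 6 (λ n e m d b f → (n :* e :+ m :* d) :* (b :* f) := n :* b :* (e :* f) :+ m :* f :* (d :* b)) ≋-refl N E M D b d ⟩
    N ⊗ b ⊗ (E ⊗ d) ⊕ M ⊗ d ⊗ (D ⊗ b)
      ≈⟨ +-cong (*-cong p ≋-refl) (*-cong r ≋-refl) ⟩
    a ⊗ D ⊗ (E ⊗ d) ⊕ c ⊗ E ⊗ (D ⊗ b)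
      ≈⟨ solve 6 (λ a c e d b f → a :* d :* (e :* f) :+ c :* e :* (d :* b) := (a :* f :+ c :* b) :* (d :* e)) ≋-refl a c E D b d ⟩
    (a ⊗ d ⊕ c ⊗ b) ⊗ (D ⊗ E) ∎))
  where open ≋-Reasoning
        open Solver

-- `sumF` folds from the right, so the head is split off and the sequences `C` and `E` are shifted
-- by one; C 1 / E 1 then cancels between the head and the rest.
HasValue-sumF-telescope : ∀ N (f : ℕ → Frac) (C E : ℕ → Poly) → (∀ k → ¬ E k ≋ []) →
  (∀ k → HasValue (f k) (C (suc k) ⊗ E k ⊝ C k ⊗ E (suc k)) (E (suc k) ⊗ E k)) →
  HasValue (sumF (applyUpTo f N)) (C N ⊗ E 0 ⊝ C 0 ⊗ E N) (E N ⊗ E 0)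
HasValue-sumF-telescope zero    f C E E≢0 v = HasValue-resp {zeroF} {[]} {oneₚ} (const-nonzero 1≢0)
  (≋-trans (zeroˡ _) (≋-sym (≋-trans (*-identityʳ _) (-‿inverseʳ _)))) (HasValue-refl [] oneₚ (const-nonzero 1≢0))
HasValue-sumF-telescope (suc N) f C E E≢0 v = HasValue-resp
  (⊗-nonzero (⊗-nonzero (E≢0 1) (E≢0 0)) (⊗-nonzero (E≢0 (suc N)) (E≢0 1)))
  (solve 6 (λ c₀ e₀ c₁ e₁ c e →
     ((c₁ :* e₀ :- c₀ :* e₁) :* (e :* e₁) :+ (c :* e₁ :- c₁ :* e) :* (e₁ :* e₀)) :* (e :* e₀)
     := (c :* e₀ :- c₀ :* e) :* (e₁ :* e₀ :* (e :* e₁)))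
     ≋-refl (C 0) (E 0) (C 1) (E 1) (C (suc N)) (E (suc N)))
  (HasValue-+f (v 0) (HasValue-sumF-telescope N (f ∘ suc) (C ∘ suc) (E ∘ suc) (E≢0 ∘ suc) (v ∘ suc)))
  where open Solver

HasValue-prodF : ∀ a k (f : ℕ → Frac) → (∀ j → HasValue (f j) (1-q^ (a ℕ.+ 2 ℕ.* j)) oneₚ) →
  HasValue (prodF (applyUpTo f k)) (pochhammer a k) oneₚ
HasValue-prodF a zero    f v = HasValue-refl oneₚ oneₚ (const-nonzero 1≢0)
HasValue-prodF a (suc k) f v = HasValue-resp (⊗-nonzero (const-nonzero 1≢0) (const-nonzero 1≢0))
  (≋-trans (*-identityʳ _) (≋-sym (≋-trans (*-cong ≋-refl (*-identityˡ oneₚ)) (*-identityʳ _))))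
  (HasValue-*f (subst (λ i → HasValue (f 0) (1-q^ i) oneₚ) (ℕₚ.+-identityʳ a) (v 0))
    (HasValue-prodF (2 ℕ.+ a) k (f ∘ suc) (λ j → subst (λ i → HasValue (f (suc j)) (1-q^ i) oneₚ) (shift j) (v (suc j)))))
  where
  open ℕSolver.+-*-Solver
  shift : ∀ j → a ℕ.+ 2 ℕ.* suc j ≡ 2 ℕ.+ a ℕ.+ 2 ℕ.* j
  shift = solve 2 (λ a j → a :+ con 2 :* (con 1 :+ j) := con 2 :+ a :+ con 2 :* j) refl a

HasValue-1-qpow : ∀ e → HasValue (oneF -f qpowF (+ e)) (1-q^ e) oneₚ
HasValue-1-qpow e = HasValue-≡ (≡.sym (cong₂ _,_
    (≡.trans (-ₚ≡⊝ _ _) (cong₂ _⊝_ (*ₚ≡⊗ oneₚ oneₚ) (*ₚ≡⊗ (Xpow e) oneₚ))) (*ₚ≡⊗ oneₚ oneₚ)))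
  (hasValue (⊗-nonzero (const-nonzero 1≢0) (const-nonzero 1≢0))
    (solve 1 (λ x → (con (+ 1) :* con (+ 1) :- x :* con (+ 1)) :* con (+ 1)
       := (con (+ 1) :- x) :* (con (+ 1) :* con (+ 1))) ≋-refl (Xpow e)))
  where open Solver

HasValue-poch : ∀ a k → HasValue (poch (+ a) 2 k) (pochhammer a k) oneₚ
HasValue-poch a k = HasValue-≡ (cong prodF (≡.sym (Listₚ.map-upTo _ k)))
  (HasValue-prodF a k (λ j → oneF -f qpowF (+ a ℤ.+ + (2 ℕ.* j))) (λ j → HasValue-1-qpow (a ℕ.+ 2 ℕ.* j)))

HasValue-poch⁻ : ∀ k → HasValue (poch -[1+ 0 ] 2 k) ((X ⊝ oneₚ) ⊗ pochhammer 1 k) (X ⊝ Xpow (2 ℕ.* k))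
HasValue-poch⁻ zero    = hasValue (const-nonzero 1≢0) (solve 1 (λ x → con (+ 1) :* (x :- con (+ 1))
    := (x :- con (+ 1)) :* con (+ 1) :* con (+ 1)) ≋-refl X)
  where open Solver
HasValue-poch⁻ (suc k) = HasValue-≡ (cong prodF (≡.sym (Listₚ.map-upTo (λ j → oneF -f qpowF (-[1+ 0 ] ℤ.+ + (2 ℕ.* j))) (suc k))))
  (HasValue-resp (⊗-nonzero X≢0 (const-nonzero 1≢0))
    (begin
      (X ⊝ oneₚ) ⊗ u ⊗ (X ⊝ Xpow (2 ℕ.* suc k))
        ≈⟨ *-cong ≋-refl (+-cong ≋-refl (-‿cong (≋-trans (≋-reflexive (cong Xpow (ℕₚ.*-suc 2 k))) (Xpow-suc (suc (2 ℕ.* k)))))) ⟩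
      (X ⊝ oneₚ) ⊗ u ⊗ (X ⊝ X ⊗ y)
        ≈⟨ solve 3 (λ x u y → (x :- con (+ 1)) :* u :* (x :- x :* y)
             := (x :- con (+ 1)) :* (u :* (con (+ 1) :- y)) :* (x :* con (+ 1))) ≋-refl X u y ⟩
      (X ⊝ oneₚ) ⊗ (u ⊗ (oneₚ ⊝ y)) ⊗ (X ⊗ oneₚ)
        ≈⟨ *-cong (*-cong ≋-refl (pochhammer-suc 1 k)) ≋-refl ⟨
      (X ⊝ oneₚ) ⊗ pochhammer 1 (suc k) ⊗ (X ⊗ oneₚ) ∎)
    (HasValue-*f first (HasValue-prodF 1 k _ λ j →
      subst (λ i → HasValue (oneF -f qpowF (-[1+ 0 ] ℤ.+ + i)) (1-q^ (1 ℕ.+ 2 ℕ.* j)) oneₚ) (≡.sym (ℕₚ.*-suc 2 j))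
        (HasValue-1-qpow (1 ℕ.+ 2 ℕ.* j)))))
  where
  open ≋-Reasoning
  open Solver
  u = pochhammer 1 k
  y = Xpow (1 ℕ.+ 2 ℕ.* k)
  X≢0 : ¬ X ≋ []
  X≢0 e = 1≢0 (at e 1)
  -- Only the factor j = 0 has a negative exponent and therefore the denominator q.
  first : HasValue (oneF -f qpowF -[1+ 0 ]) (X ⊝ oneₚ) X
  first = HasValue-≡ (≡.sym (cong₂ _,_
      (≡.trans (-ₚ≡⊝ _ _) (cong₂ _⊝_ (*ₚ≡⊗ oneₚ X) (*ₚ≡⊗ oneₚ oneₚ))) (*ₚ≡⊗ oneₚ X)))
    (hasValue (⊗-nonzero (const-nonzero 1≢0) X≢0)
      (solve 1 (λ x → (con (+ 1) :* x :- con (+ 1) :* con (+ 1)) :* x := (x :- con (+ 1)) :* (con (+ 1) :* x)) ≋-refl X))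

-- The closed form

infix 9 _² _⁴
_² _⁴ : Poly → Poly
p ² = p ⊗ p
p ⁴ = p ² ⊗ p ²

HasValue-sq : ∀ {x a b} → HasValue x a b → HasValue (sq x) (a ²) (b ²)
HasValue-sq v = HasValue-*f v v

²-cong : ∀ {p r} → p ≋ r → p ² ≋ r ²
²-cong e = *-cong e e

⁴-cong : ∀ {p r} → p ≋ r → p ⁴ ≋ r ⁴
⁴-cong e = ²-cong (²-cong e)

α : Poly → Poly
α y = X ⊗ (oneₚ ⊕ X) ⊝ constₚ (+ 2) ⊗ (oneₚ ⊕ X ⊗ X) ⊗ y ⊕ (oneₚ ⊕ X) ⊗ (y ⊗ y)

α-cong : ∀ {y z} → y ≋ z → α y ≋ α z
α-cong e = +-cong (+-cong ≋-refl (-‿cong (*-cong ≋-refl e))) (*-cong ≋-refl (*-cong e e))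

-- α is the solution of degree 2 of Gosper's equation for the summand, in the variable y = q^{2k}.
gosper : ∀ y → (oneₚ ⊝ X ⊗ y) ² ⊗ (X ⊝ y) ² ⊗ α (X ⊗ (X ⊗ y)) ⊝ X ² ⊗ (oneₚ ⊝ y) ² ⊗ (oneₚ ⊝ X ⊗ (X ⊗ y)) ² ⊗ α y
  ≋ X ⊗ (oneₚ ⊝ X) ⊗ (oneₚ ⊝ X) ⁴ ⊗ [3] ⊗ (oneₚ ⊝ X ⊗ (y ⊗ y)) ⊗ (y ⊗ y)
gosper y = solve 2 (λ x y →
    let 1# = con (+ 1)
        sq = λ p → p :* p
        alpha = λ y → x :* (1# :+ x) :- con (+ 2) :* (1# :+ x :* x) :* y :+ (1# :+ x) :* (y :* y)
    in sq (1# :- x :* y) :* sq (x :- y) :* alpha (x :* (x :* y))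
         :- sq x :* sq (1# :- y) :* sq (1# :- x :* (x :* y)) :* alpha y
       := x :* (1# :- x) :* sq (sq (1# :- x)) :* (1# :+ x :+ x :* x) :* (1# :- x :* (y :* y)) :* (y :* y))
  ≋-refl X y
  where open Solver

⁴-nonzero : ∀ {p} → ¬ p ≋ [] → ¬ p ⁴ ≋ []
⁴-nonzero nz = ⊗-nonzero (⊗-nonzero nz nz) (⊗-nonzero nz nz)

1-X≢0 : ¬ oneₚ ⊝ X ≋ []
1-X≢0 = 1-q^-nonzero 1 (s≤s z≤n)

[3]≢0 : ¬ [3] ≋ []
[3]≢0 = ⊗-nonzeroʳ⁻ (λ e → 1-q^-nonzero 3 (s≤s z≤n) (≋-trans (≋-sym [3]-factor) e))

module _ (k : ℕ) where
  private
    y u v : Poly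
    y = Xpow (2 ℕ.* k)
    u = pochhammer 1 k
    v = pochhammer 2 k

  -- certNum / certDen is Gosper's antidifference of the summand; ⁺ marks its value at k + 1 in terms of the data at k.
  certNum certDen : Poly
  certNum = X ⊗ (oneₚ ⊕ X) ² ⊗ u ⁴ ⊗ (oneₚ ⊝ y) ² ⊗ α y
  certDen = (oneₚ ⊝ X) ² ⊗ [3] ⊗ v ⁴ ⊗ (X ⊝ y) ²

  certNum⁺ certDen⁺ : Poly
  certNum⁺ = X ⊗ (oneₚ ⊕ X) ² ⊗ (u ⊗ 1-q^ (1 ℕ.+ 2 ℕ.* k)) ⁴ ⊗ (1-q^ (2 ℕ.+ 2 ℕ.* k)) ² ⊗ α (X ⊗ (X ⊗ y))
  certDen⁺ = (oneₚ ⊝ X) ² ⊗ [3] ⊗ (v ⊗ 1-q^ (2 ℕ.+ 2 ℕ.* k)) ⁴ ⊗ (X ⊗ 1-q^ (1 ℕ.+ 2 ℕ.* k)) ²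

  termNum termDen : Poly
  termNum = qint (suc (4 ℕ.* k)) ⊗ (oneₚ ⊝ X) ² ⊗ u ⁴ ⊗ ((oneₚ ⊝ X) ⊗ (oneₚ ⊕ X)) ² ⊗ (y ⊗ y)
  termDen = (X ⊝ y) ² ⊗ v ⁴ ⊗ (1-q^ (2 ℕ.+ 2 ℕ.* k)) ²

  private
    Xpow-2k+2 : Xpow (2 ℕ.* suc k) ≋ X ⊗ (X ⊗ y)
    Xpow-2k+2 = ≋-trans (≋-reflexive (cong Xpow (ℕₚ.*-suc 2 k))) (≋-trans (Xpow-suc (suc (2 ℕ.* k))) (*-cong ≋-refl (Xpow-suc (2 ℕ.* k))))

    Xpow-4k : Xpow (4 ℕ.* k) ≋ y ⊗ y
    Xpow-4k = ≋-trans (≋-reflexive (cong Xpow (solve 1 (λ k → con 4 :* k := con 2 :* k :+ con 2 :* k) refl k)))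
                      (Xpow-+ (2 ℕ.* k) (2 ℕ.* k))
      where open ℕSolver.+-*-Solver

    1-q^1+2k : 1-q^ (1 ℕ.+ 2 ℕ.* k) ≋ oneₚ ⊝ X ⊗ y
    1-q^1+2k = +-cong ≋-refl (-‿cong (Xpow-suc (2 ℕ.* k)))

    1-q^2+2k : 1-q^ (2 ℕ.+ 2 ℕ.* k) ≋ oneₚ ⊝ X ⊗ (X ⊗ y)
    1-q^2+2k = +-cong ≋-refl (-‿cong (≋-trans (Xpow-suc (suc (2 ℕ.* k))) (*-cong ≋-refl (Xpow-suc (2 ℕ.* k)))))

  -- The difference is q - 1 for k = 0 and q (1 - q^{2k-1}) otherwise.
  X-y≢0 : ¬ X ⊝ y ≋ []
  X-y≢0 = nonzero k
    where
    nonzero : ∀ k → ¬ X ⊝ Xpow (2 ℕ.* k) ≋ []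
    nonzero zero    = Xpow-1≢0 1 (s≤s z≤n)
    nonzero (suc j) e = ⊗-nonzero (λ X≋0 → 1≢0 (at X≋0 1)) (1-q^-nonzero (suc (2 ℕ.* j)) (s≤s z≤n)) (≋-trans
      (≋-trans (solve 2 (λ x y → x :* (con (+ 1) :- y) := x :- x :* y) ≋-refl X (Xpow (suc (2 ℕ.* j))))
        (+-cong ≋-refl (-‿cong (≋-trans (≋-sym (Xpow-suc (suc (2 ℕ.* j)))) (≋-reflexive (cong Xpow (≡.sym (ℕₚ.*-suc 2 j)))))))) e)
      where open Solver

  private
    v≢0 : ¬ v ≋ []
    v≢0 = pochhammer-nonzero 2 k (s≤s z≤n)

  certDen≢0 : ¬ certDen ≋ []
  certDen≢0 = ⊗-nonzero (⊗-nonzero (⊗-nonzero (⊗-nonzero 1-X≢0 1-X≢0) [3]≢0) (⁴-nonzero v≢0)) (⊗-nonzero X-y≢0 X-y≢0)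

  HasValue-term : HasValue (term k) termNum termDen
  HasValue-term = HasValue-resp
    (⊗-nonzero (⊗-nonzero (⊗-nonzero (⊗-nonzero 1≢0ₚ (⊗-nonzero X-y≢0 X-y≢0)) (⊗-nonzero 1≢0ₚ 1≢0ₚ)) c≢0) 1≢0ₚ)
    (begin
      g ⊗ ((X ⊝ oneₚ) ⊗ u) ² ⊗ u ² ⊗ (oneₚ ² ⊗ oneₚ ²) ⊗ Xpow (4 ℕ.* k) ⊗ termDen
        ≈⟨ *-cong (*-cong ≋-refl Xpow-4k) ≋-refl ⟩
      g ⊗ ((X ⊝ oneₚ) ⊗ u) ² ⊗ u ² ⊗ (oneₚ ² ⊗ oneₚ ²) ⊗ (y ⊗ y) ⊗ ((X ⊝ y) ² ⊗ v ⁴ ⊗ d ²)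
        ≈⟨ solve 7 (λ g x u y b v d → let 1# = con (+ 1) ; sq = λ p → p :* p in
             g :* sq ((x :- 1#) :* u) :* sq u :* (sq 1# :* sq 1#) :* (y :* y) :* (b :* sq (sq v) :* sq d)
             := g :* sq (1# :- x) :* sq (sq u) :* (y :* y) :* b :* sq v :* sq (v :* d))
             ≋-refl g X u y ((X ⊝ y) ²) v d ⟩
      g ⊗ (oneₚ ⊝ X) ² ⊗ u ⁴ ⊗ (y ⊗ y) ⊗ (X ⊝ y) ² ⊗ v ² ⊗ (v ⊗ d) ²
        -- `pochhammer 2 (suc k)` unfolds to `1-q^ 2 ⊗ w`; splitting off its last factor instead of
        -- its first gives `v ⊗ d`.
        ≈⟨ *-cong ≋-refl (²-cong (≋-sym (pochhammer-suc 2 k))) ⟩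
      g ⊗ (oneₚ ⊝ X) ² ⊗ u ⁴ ⊗ (y ⊗ y) ⊗ (X ⊝ y) ² ⊗ v ² ⊗ (1-q^ 2 ⊗ w) ²
        ≈⟨ *-cong ≋-refl (²-cong (*-cong (difference-of-squares 1) ≋-refl)) ⟩
      g ⊗ (oneₚ ⊝ X) ² ⊗ u ⁴ ⊗ (y ⊗ y) ⊗ (X ⊝ y) ² ⊗ v ² ⊗ (1-q^ 1 ⊗ 1+q^ 1 ⊗ w) ²
        ≈⟨ solve 7 (λ g x u y b v w → let 1# = con (+ 1) ; sq = λ p → p :* p in
             g :* sq (1# :- x) :* sq (sq u) :* (y :* y) :* b :* sq v :* sq ((1# :- x) :* (1# :+ x) :* w)
             := g :* sq (1# :- x) :* sq (sq u) :* sq ((1# :- x) :* (1# :+ x)) :* (y :* y)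
                :* (1# :* b :* sq 1# :* (sq w :* sq v) :* 1#))
             ≋-refl g X u y ((X ⊝ y) ²) v w ⟩
      termNum ⊗ (oneₚ ⊗ (X ⊝ y) ² ⊗ oneₚ ² ⊗ (w ² ⊗ v ²) ⊗ oneₚ) ∎)
    (HasValue-*f
      (HasValue-/f c≢0
        (HasValue-*f (HasValue-*f (HasValue-refl g oneₚ 1≢0ₚ) (HasValue-sq (HasValue-poch⁻ k))) (HasValue-sq (HasValue-poch 1 k)))
        (HasValue-*f (HasValue-sq (HasValue-poch 4 k)) (HasValue-sq (HasValue-poch 2 k))))
      (HasValue-refl (Xpow (4 ℕ.* k)) oneₚ 1≢0ₚ))
    where
    open ≋-Reasoning
    open Solver
    g = qint (suc (4 ℕ.* k))
    w = pochhammer 4 k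
    d = 1-q^ (2 ℕ.+ 2 ℕ.* k)
    1≢0ₚ : ¬ oneₚ ≋ []
    1≢0ₚ = const-nonzero 1≢0
    w≢0 : ¬ w ≋ []
    w≢0 = pochhammer-nonzero 4 k (s≤s z≤n)
    c≢0 : ¬ w ² ⊗ v ² ≋ []
    c≢0 = ⊗-nonzero (⊗-nonzero w≢0 w≢0) (⊗-nonzero v≢0 v≢0)

  -- Once the common factor K is taken out, the difference of the two values is the left side of
  -- `gosper`. Its right side contains 1 - q^{4k+1} = (1 - q) [4k+1], which supplies the q-integer
  -- of the summand.
  certificate : termNum ⊗ (certDen⁺ ⊗ certDen) ≋ (certNum⁺ ⊗ certDen ⊝ certNum ⊗ certDen⁺) ⊗ termDen
  certificate = ≋-sym (begin
    (certNum⁺ ⊗ certDen ⊝ certNum ⊗ certDen⁺) ⊗ termDen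
      -- The identity holds with a, d, X - y, 1 - y and both values of α as independent variables;
      -- their dependence on y enters only through `bracket`.
      ≈⟨ *-cong (solve 12 (λ x f u a d α′ r s v b c α →
           let sq = λ p → p :* p ; fo = λ p → sq (sq p) in
           x :* f :* fo (u :* a) :* sq d :* α′ :* (r :* s :* fo v :* sq b)
             :- x :* f :* fo u :* sq c :* α :* (r :* s :* fo (v :* d) :* sq (x :* a))
           := x :* f :* fo u :* r :* s :* fo v :* sq a :* sq d :* (sq a :* sq b :* α′ :- sq x :* sq c :* sq d :* α))
           ≋-refl X ((oneₚ ⊕ X) ²) u a d (α (X ⊗ (X ⊗ y))) ((oneₚ ⊝ X) ²) [3] v (X ⊝ y) (oneₚ ⊝ y) (α y)) ≋-refl ⟩
    K ⊗ (a ² ⊗ (X ⊝ y) ² ⊗ α (X ⊗ (X ⊗ y)) ⊝ X ² ⊗ (oneₚ ⊝ y) ² ⊗ d ² ⊗ α y) ⊗ termDen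
      ≈⟨ *-cong (*-cong ≋-refl bracket) ≋-refl ⟩
    K ⊗ (X ⊗ r ⊗ r ⁴ ⊗ [3] ⊗ (r ⊗ g) ⊗ (y ⊗ y)) ⊗ termDen
      ≈⟨ solve 11 (λ x f u r s v a d g y b →
           let sq = λ p → p :* p ; fo = λ p → sq (sq p) in
           x :* sq f :* fo u :* sq r :* s :* fo v :* sq a :* sq d :* (x :* r :* fo r :* s :* (r :* g) :* (y :* y))
             :* (sq b :* fo v :* sq d)
           := g :* sq r :* fo u :* sq (r :* f) :* (y :* y)
             :* (sq r :* s :* fo (v :* d) :* sq (x :* a) :* (sq r :* s :* fo v :* sq b)))
           ≋-refl X (oneₚ ⊕ X) u r [3] v a d g y (X ⊝ y) ⟩
    termNum ⊗ (certDen⁺ ⊗ certDen) ∎)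
    where
    open ≋-Reasoning
    open Solver
    g = qint (suc (4 ℕ.* k))
    r = oneₚ ⊝ X
    a = 1-q^ (1 ℕ.+ 2 ℕ.* k)
    d = 1-q^ (2 ℕ.+ 2 ℕ.* k)
    K = X ⊗ (oneₚ ⊕ X) ² ⊗ u ⁴ ⊗ (oneₚ ⊝ X) ² ⊗ [3] ⊗ v ⁴ ⊗ a ² ⊗ d ²
    bracket : a ² ⊗ (X ⊝ y) ² ⊗ α (X ⊗ (X ⊗ y)) ⊝ X ² ⊗ (oneₚ ⊝ y) ² ⊗ d ² ⊗ α y
      ≋ X ⊗ r ⊗ r ⁴ ⊗ [3] ⊗ (r ⊗ g) ⊗ (y ⊗ y)
    bracket = begin
      a ² ⊗ (X ⊝ y) ² ⊗ α (X ⊗ (X ⊗ y)) ⊝ X ² ⊗ (oneₚ ⊝ y) ² ⊗ d ² ⊗ α y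
        ≈⟨ +-cong (*-cong (*-cong (²-cong 1-q^1+2k) ≋-refl) ≋-refl)
                  (-‿cong (*-cong (*-cong ≋-refl (²-cong 1-q^2+2k)) ≋-refl)) ⟩
      (oneₚ ⊝ X ⊗ y) ² ⊗ (X ⊝ y) ² ⊗ α (X ⊗ (X ⊗ y)) ⊝ X ² ⊗ (oneₚ ⊝ y) ² ⊗ (oneₚ ⊝ X ⊗ (X ⊗ y)) ² ⊗ α y
        ≈⟨ gosper y ⟩
      X ⊗ r ⊗ r ⁴ ⊗ [3] ⊗ (oneₚ ⊝ X ⊗ (y ⊗ y)) ⊗ (y ⊗ y)
        ≈⟨ *-cong (*-cong ≋-refl (+-cong ≋-refl (-‿cong (≋-trans (Xpow-suc (4 ℕ.* k)) (*-cong ≋-refl Xpow-4k))))) ≋-refl ⟨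
      X ⊗ r ⊗ r ⁴ ⊗ [3] ⊗ 1-q^ (suc (4 ℕ.* k)) ⊗ (y ⊗ y)
        ≈⟨ *-cong (*-cong ≋-refl (qint-factor (suc (4 ℕ.* k)))) ≋-refl ⟨
      X ⊗ r ⊗ r ⁴ ⊗ [3] ⊗ (r ⊗ g) ⊗ (y ⊗ y) ∎

  α-arg : α (Xpow (2 ℕ.* suc k)) ≋ α (X ⊗ (X ⊗ y))
  α-arg = α-cong Xpow-2k+2

  c⁺ : oneₚ ⊝ Xpow (2 ℕ.* suc k) ≋ 1-q^ (2 ℕ.+ 2 ℕ.* k)
  c⁺ = ≋-reflexive (cong 1-q^_ (ℕₚ.*-suc 2 k))

  b⁺ : X ⊝ Xpow (2 ℕ.* suc k) ≋ X ⊗ 1-q^ (1 ℕ.+ 2 ℕ.* k)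
  b⁺ = begin
    X ⊝ Xpow (2 ℕ.* suc k)   ≈⟨ +-cong ≋-refl (-‿cong Xpow-2k+2) ⟩
    X ⊝ X ⊗ (X ⊗ y)          ≈⟨ solve 2 (λ x y → x :- x :* (x :* y) := x :* (con (+ 1) :- x :* y)) ≋-refl X y ⟩
    X ⊗ (oneₚ ⊝ X ⊗ y)       ≈⟨ *-cong ≋-refl 1-q^1+2k ⟨
    X ⊗ 1-q^ (1 ℕ.+ 2 ℕ.* k) ∎
    where open ≋-Reasoning
          open Solver

certNum-suc : ∀ k → certNum (suc k) ≋ certNum⁺ k
certNum-suc k = *-cong (*-cong (*-cong ≋-refl (⁴-cong (pochhammer-suc 1 k))) (²-cong (c⁺ k))) (α-arg k)

certDen-suc : ∀ k → certDen (suc k) ≋ certDen⁺ k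
certDen-suc k = *-cong (*-cong ≋-refl (⁴-cong (pochhammer-suc 2 k))) (²-cong (b⁺ k))

-- The factor (1 - y)² vanishes at y = 1.
certNum-0 : certNum 0 ≋ []
certNum-0 = ≋-trans (*-cong (≋-trans (*-cong ≋-refl (≋-trans (*-cong (-‿inverseʳ oneₚ) ≋-refl) (zeroˡ _))) (zeroʳ _)) ≋-refl) (zeroˡ _)

-- T_{m+1} written with the data at m, after cancelling q (1 - q^{2m+1})² (1 - q^{2m+2})².
sumNum sumDen : ℕ → Poly
sumNum m = (oneₚ ⊕ X) ² ⊗ pochhammer 1 m ⁴ ⊗ (1-q^ (1 ℕ.+ 2 ℕ.* m)) ² ⊗ α (X ⊗ (X ⊗ Xpow (2 ℕ.* m)))
sumDen m = X ⊗ (oneₚ ⊝ X) ² ⊗ [3] ⊗ pochhammer 2 m ⁴ ⊗ (1-q^ (2 ℕ.+ 2 ℕ.* m)) ²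

HasValue-sumTo : ∀ m → HasValue (sumTo m) (sumNum m) (sumDen m)
HasValue-sumTo m = HasValue-≡ (cong sumF (≡.sym (Listₚ.map-upTo term (suc m))))
  (HasValue-resp (⊗-nonzero (certDen≢0 (suc m)) (certDen≢0 0)) (begin
      (certNum (suc m) ⊗ E₀ ⊝ certNum 0 ⊗ certDen (suc m)) ⊗ sumDen m
        ≈⟨ *-cong (+-cong ≋-refl (-‿cong (≋-trans (*-cong certNum-0 ≋-refl) (≋-trans (zeroˡ _) (≋-sym 0∷[]≋[]))))) ≋-refl ⟩
      (certNum (suc m) ⊗ E₀ ⊝ constₚ (+ 0)) ⊗ sumDen m
        ≈⟨ *-cong (+-cong (*-cong (certNum-suc m) ≋-refl) ≋-refl) ≋-refl ⟩
      (certNum⁺ m ⊗ E₀ ⊝ constₚ (+ 0)) ⊗ sumDen m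
        ≈⟨ solve 10 (λ x f u a d α r s v e → let sq = λ p → p :* p ; fo = λ p → sq (sq p) in
             (x :* f :* fo (u :* a) :* sq d :* α :* e :- con (+ 0)) :* (x :* r :* s :* fo v :* sq d)
             := f :* fo u :* sq a :* α :* (r :* s :* fo (v :* d) :* sq (x :* a) :* e))
             ≋-refl X ((oneₚ ⊕ X) ²) (pochhammer 1 m) (1-q^ (1 ℕ.+ 2 ℕ.* m)) (1-q^ (2 ℕ.+ 2 ℕ.* m))
             (α (X ⊗ (X ⊗ Xpow (2 ℕ.* m)))) ((oneₚ ⊝ X) ²) [3] (pochhammer 2 m) E₀ ⟩
      sumNum m ⊗ (certDen⁺ m ⊗ E₀)
        ≈⟨ *-cong ≋-refl (*-cong (certDen-suc m) ≋-refl) ⟨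
      sumNum m ⊗ (certDen (suc m) ⊗ E₀) ∎)
    (HasValue-sumF-telescope (suc m) term certNum certDen certDen≢0 λ k →
      HasValue-resp (termDen≢0 k) (≋-trans
        (*-cong ≋-refl (*-cong (certDen-suc k) ≋-refl))
        (≋-trans (certificate k)
          (*-cong (+-cong (*-cong (≋-sym (certNum-suc k)) ≋-refl) (-‿cong (*-cong ≋-refl (≋-sym (certDen-suc k))))) ≋-refl)))
        (HasValue-term k)))
  where
  open ≋-Reasoning
  open Solver
  E₀ = certDen 0
  termDen≢0 : ∀ k → ¬ termDen k ≋ []
  termDen≢0 k = ⊗-nonzero (⊗-nonzero (⊗-nonzero (X-y≢0 k) (X-y≢0 k)) (⁴-nonzero (pochhammer-nonzero 2 k (s≤s z≤n))))
    (⊗-nonzero (1-q^-nonzero (2 ℕ.+ 2 ℕ.* k) (s≤s z≤n)) (1-q^-nonzero (2 ℕ.+ 2 ℕ.* k) (s≤s z≤n)))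

-- Multiplying `sumNum` by F⁴ replaces u⁴ by (1 - q^n)⁴ G⁴ v⁴. One factor 1 - q^n becomes (1 - q)
-- [n]; the other three, together with g, are rewritten by `split` so that [3] and (1 - q^{n+3})²
-- appear and cancel against `sumDen`. What is left in the denominator is E.
congruence : ∀ p → let n = suc (2 ℕ.* p) in 3 < n → CongMod (sumTo (suc p)) zeroF (qint n *ₚ Φ n *ₚ Φ n)
congruence p 3<n = congruentToZero {E = E} {M = M′}
  (MonicList⇒Monic (MonicList-*ₚ (MonicList-*ₚ (MonicList-qint (2 ℕ.* p)) monicΦ) monicΦ))
  (HasValue.den≢0 value)
  coprime-E-P
  (⊗-cancelˡ W≢0 (begin
    W ⊗ (N ⊗ E)
      ≈⟨ solve 8 (λ s v d n x r F g → let sq = λ p → p :* p ; fo = λ p → sq (sq p) in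
           s :* fo v :* sq d :* (n :* (x :* sq r :* fo F :* g))
           := n :* (x :* sq r :* s :* fo v :* sq d) :* (fo F :* g)) ≋-refl [3] v d N X r F g ⟩
    N ⊗ (X ⊗ r ² ⊗ [3] ⊗ v ⁴ ⊗ d ²) ⊗ (F ⁴ ⊗ g)
      ≈⟨ *-cong (HasValue.cross value) ≋-refl ⟩
    f ² ⊗ u ⁴ ⊗ a ² ⊗ α′ ⊗ D ⊗ (F ⁴ ⊗ g)
      ≈⟨ solve 7 (λ f u a α D F g → let sq = λ p → p :* p ; fo = λ p → sq (sq p) in
           sq f :* fo u :* sq a :* α :* D :* (fo F :* g) := sq f :* sq a :* α :* D :* g :* fo (u :* F))
           ≋-refl f u a α′ D F g ⟩
    f ² ⊗ a ² ⊗ α′ ⊗ D ⊗ g ⊗ (u ⊗ F) ⁴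
      ≈⟨ *-cong ≋-refl (⁴-cong uF) ⟩
    f ² ⊗ a ² ⊗ α′ ⊗ D ⊗ g ⊗ (Z ⊗ G ⊗ v) ⁴
      ≈⟨ solve 6 (λ A D g Z G v → let sq = λ p → p :* p ; fo = λ p → sq (sq p) in
           A :* D :* g :* fo (Z :* G :* v) := A :* D :* fo G :* fo v :* Z :* (Z :* Z :* Z :* g))
           ≋-refl (f ² ⊗ a ² ⊗ α′) D g Z G v ⟩
    f ² ⊗ a ² ⊗ α′ ⊗ D ⊗ G ⁴ ⊗ v ⁴ ⊗ Z ⊗ (Z ⊗ Z ⊗ Z ⊗ g)
      ≈⟨ *-cong (*-cong ≋-refl (≋-sym (qint-factor n))) (≋-trans split
           (*-cong (*-cong ≋-refl (*-cong (≋-sym (proj₂ Φ∣h)) (≋-sym (proj₂ Φ∣h)))) ≋-refl)) ⟩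
    f ² ⊗ a ² ⊗ α′ ⊗ D ⊗ G ⁴ ⊗ v ⁴ ⊗ (r ⊗ qint n)
      ⊗ (κ ⊗ (Φ n ⊗ h′ ⊗ (Φ n ⊗ h′)) ⊗ ([3] ⊗ (1-q^ (3 ℕ.+ n) ⊗ 1-q^ (3 ℕ.+ n))))
      ≡⟨ cong (λ t → f ² ⊗ a ² ⊗ α′ ⊗ D ⊗ G ⁴ ⊗ v ⁴ ⊗ (r ⊗ qint n)
           ⊗ (κ ⊗ (Φ n ⊗ h′ ⊗ (Φ n ⊗ h′)) ⊗ ([3] ⊗ (1-q^ t ⊗ 1-q^ t)))) 3+n ⟩
    f ² ⊗ a ² ⊗ α′ ⊗ D ⊗ G ⁴ ⊗ v ⁴ ⊗ (r ⊗ qint n) ⊗ (κ ⊗ (Φ n ⊗ h′ ⊗ (Φ n ⊗ h′)) ⊗ ([3] ⊗ (d ⊗ d)))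
      ≈⟨ solve 11 (λ A D G v r b κ c h s d → let sq = λ p → p :* p ; fo = λ p → sq (sq p) in
           A :* D :* G :* fo v :* (r :* b) :* (κ :* (c :* h :* (c :* h)) :* (s :* (d :* d)))
           := s :* fo v :* sq d :* (b :* c :* c :* (A :* G :* κ :* r :* sq h) :* D))
           ≋-refl (f ² ⊗ a ² ⊗ α′) D (G ⁴) v r (qint n) κ (Φ n) h′ [3] d ⟩
    W ⊗ (qint n ⊗ Φ n ⊗ Φ n ⊗ M′ ⊗ D)
      ≡⟨ cong (λ t → W ⊗ (t ⊗ M′ ⊗ D)) P≡ ⟨
    W ⊗ (qint n *ₚ Φ n *ₚ Φ n ⊗ M′ ⊗ D) ∎))
  where
  open ≋-Reasoning
  open Solver
  n = suc (2 ℕ.* p)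
  m = suc p
  value = HasValue-sumTo m
  N = proj₁ (sumTo m)
  D = proj₂ (sumTo m)
  open DenominatorSplit (denominatorSplit n 3<n)
  monicΦ = proj₂ (Cyclotomic.monicΦ (cyclotomic n (s≤s z≤n)))
  Φ∣qint = Φ-∣-qint n (ℕₚ.≤-trans (s≤s (s≤s z≤n)) 3<n)
  h′ = proj₁ Φ∣h
  G = proj₁ (central-qbinomial p)
  f = oneₚ ⊕ X
  r = oneₚ ⊝ X
  u = pochhammer 1 m
  v = pochhammer 2 m
  a = 1-q^ (1 ℕ.+ 2 ℕ.* m)
  d = 1-q^ (2 ℕ.+ 2 ℕ.* m)
  α′ = α (X ⊗ (X ⊗ Xpow (2 ℕ.* m)))
  Z = 1-q^ n
  S = plusPochhammer p
  -- Going from p to m = p + 1 adds the factor 1 - q^n to u and 1 - q^{n+1} to v. The latter and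
  -- (-q;q)_p² therefore make up the denominator of u/v in terms of the q-binomial coefficient.
  F = S ⊗ S ⊗ 1-q^ (suc n)
  E = X ⊗ r ² ⊗ F ⁴ ⊗ g
  -- The part of `sumDen m` that cancels; the rest of it, q (1 - q)², goes into E.
  W = [3] ⊗ v ⁴ ⊗ d ²
  M′ = f ² ⊗ a ² ⊗ α′ ⊗ G ⁴ ⊗ κ ⊗ r ⊗ h′ ²
  3+n : 3 ℕ.+ n ≡ 2 ℕ.+ 2 ℕ.* m
  3+n = cong (2 ℕ.+_) (≡.sym (ℕₚ.*-suc 2 p))
  P≡ : qint n *ₚ Φ n *ₚ Φ n ≡ qint n ⊗ Φ n ⊗ Φ n
  P≡ = ≡.trans (*ₚ≡⊗ (qint n *ₚ Φ n) (Φ n)) (cong (_⊗ Φ n) (*ₚ≡⊗ (qint n) (Φ n)))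
  W≢0 : ¬ W ≋ []
  W≢0 = ⊗-nonzero (⊗-nonzero [3]≢0 (⁴-nonzero (pochhammer-nonzero 2 m (s≤s z≤n))))
    (⊗-nonzero (1-q^-nonzero (2 ℕ.+ 2 ℕ.* m) (s≤s z≤n)) (1-q^-nonzero (2 ℕ.+ 2 ℕ.* m) (s≤s z≤n)))
  uF : u ⊗ F ≋ Z ⊗ G ⊗ v
  uF = begin
    u ⊗ F
      ≈⟨ *-cong (pochhammer-suc 1 p) ≋-refl ⟩
    pochhammer 1 p ⊗ Z ⊗ (S ⊗ S ⊗ 1-q^ (suc n))
      ≈⟨ solve 4 (λ u z s e → u :* z :* (s :* s :* e) := z :* (u :* (s :* s)) :* e) ≋-refl (pochhammer 1 p) Z S (1-q^ (suc n)) ⟩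
    Z ⊗ (pochhammer 1 p ⊗ (S ⊗ S)) ⊗ 1-q^ (suc n)
      ≈⟨ *-cong (*-cong ≋-refl (proj₂ (central-qbinomial p))) ≋-refl ⟩
    Z ⊗ (G ⊗ pochhammer 2 p) ⊗ 1-q^ (suc n)
      ≈⟨ solve 4 (λ z g v e → z :* (g :* v) :* e := z :* g :* (v :* e)) ≋-refl Z G (pochhammer 2 p) (1-q^ (suc n)) ⟩
    Z ⊗ G ⊗ (pochhammer 2 p ⊗ 1-q^ (suc n))
      ≈⟨ *-cong ≋-refl (pochhammer-suc 2 p) ⟨
    Z ⊗ G ⊗ v ∎
  coprime-² : ∀ {x} → Coprime x (qint n) → Coprime (x ²) (qint n)
  coprime-² c = Coprime-⊗ˡ c c
  coprime-r : Coprime r (qint n)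
  coprime-r = Coprime-1-q^-qint 1 n (s≤s z≤n) (coprime⇒gcd≡1 (1-coprimeTo n))
  coprime-F : Coprime F (qint n)
  coprime-F = Coprime-⊗ˡ (coprime-² (Coprime-plusPochhammer p p)) (Coprime-1-q^-qint (suc n) n (s≤s z≤n)
    (coprime⇒gcd≡1 (subst (λ j → ℕCoprime.Coprime j n) (ℕₚ.+-comm n 1) (coprime-+ (1-coprimeTo n)))))
  coprime-E : Coprime E (qint n)
  coprime-E = Coprime-⊗ˡ (Coprime-⊗ˡ (Coprime-⊗ˡ (Coprime-X-qint n (s≤s z≤n)) (coprime-² coprime-r))
    (coprime-² (coprime-² coprime-F))) coprime
  coprime-E-P : Coprime E (qint n *ₚ Φ n *ₚ Φ n)
  coprime-E-P = subst (Coprime E) (≡.sym P≡)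
    (Coprime-⊗ (Coprime-⊗ coprime-E (Coprime-∣ Φ∣qint coprime-E)) (Coprime-∣ Φ∣qint coprime-E))

theorem5p5 : (n : ℕ) → 3 < n → n % 2 ≡ 1 →
    CongMod (sumTo (suc n / 2)) zeroF (qint n *ₚ Φ n *ₚ Φ n)
theorem5p5 n 3<n n-odd =
  subst (λ m → CongMod (sumTo m) zeroF P) (≡.sym half)
    (subst (λ j → CongMod (sumTo (suc p)) zeroF (qint j *ₚ Φ j *ₚ Φ j)) (≡.sym n≡) (congruence p (subst (3 <_) n≡ 3<n)))
  where
  P = qint n *ₚ Φ n *ₚ Φ n
  p = n / 2
  n≡p*2 : n ≡ suc (p ℕ.* 2)
  n≡p*2 = ≡.trans (m≡m%n+[m/n]*n n 2) (cong (ℕ._+ p ℕ.* 2) n-odd)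
  n≡ : n ≡ suc (2 ℕ.* p)
  n≡ = ≡.trans n≡p*2 (cong suc (ℕₚ.*-comm p 2))
  half : suc n / 2 ≡ suc p
  -- `suc (suc (p ℕ.* 2))` is `suc p ℕ.* 2` by definition.
  half = ≡.trans (cong (λ j → suc j / 2) n≡p*2) (m*n/n≡m (suc p) 2)
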